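{- Let $(W,S)$ be a Coxeter system. Every Bruhat interval $[u,v]$ in $W$ with $u<v$ has the generalized lifting property if and only if $(W,S)$ is finite and simply-laced.
   Context: $(W,S)$ is a Coxeter system with Coxeter matrix $m$; it is simply-laced if $m(s,r)\le 3$ for all $s,r\in S$. $T=\{wsw^{ -1}: s\in S, w\in W\}$ is its set of reflections, $\ell$ the length function, $\le$ the Bruhat order, and $u\lhd v$ means $u<v$ and $\ell(v)=\ell(u)+1$. For $u,v\in W$ let $D(u)=\{t\in T: ut<u\}$, $A(u)=\{t\in T: u<ut\}$ and $AD(u,v)=A(u)\cap D(v)$. A Bruhat interval $[u,v]=\{z\in W: u\le z\le v\}$ with $u<v$ has the generalized lifting property (GLP) if there exists $t\in AD(u,v)$ such that $u\lhd ut\le v$ and $u\le vt\lhd v$.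
   Formalization: The generating set S is taken finite; for infinite S the claim fails, e.g. for the finitely supported permutations of the natural numbers (type A_∞), where every interval lies in a finite simply-laced parabolic subgroup and has the property although W is infinite. -}

module Defs where

open import Data.Nat using (ℕ; _≤_; _<_; _+_)
open import Data.Fin using (Fin)
open import Data.Maybe using (Maybe; just; nothing)
open import Data.List using (List; []; _∷_; _++_; length; reverse; concat; replicate)
open import Data.List.Relation.Unary.Any using (Any)
open import Data.Product using (Σ; ∃; ∃-syntax; _×_; _,_)
open import Relation.Binary.PropositionalEquality using (_≡_; _≢_)
open import Relation.Binary.Construct.Closure.ReflexiveTransitive using (Star)
open import Relation.Nullary using (¬_)

-- A Coxeter matrix on the finite generating set S = Fin n.
-- m s r = nothing  encodes  m(s,r) = ∞ ; m s r = just k encodes m(s,r) = k.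
record CoxeterMatrix (n : ℕ) : Set where
  field
    m     : Fin n → Fin n → Maybe ℕ
    diag  : ∀ s → m s s ≡ just 1
    symm  : ∀ s r → m s r ≡ m r s
    offd  : ∀ s r → s ≢ r → ∀ k → m s r ≡ just k → 2 ≤ k

module Coxeter {n : ℕ} (M : CoxeterMatrix n) where
  open CoxeterMatrix M

  Word : Set
  Word = List (Fin n)

  alt : Fin n → Fin n → ℕ → Word
  alt s r k = concat (replicate k (s ∷ r ∷ []))

  -- the congruence on words generated by the Coxeter relations (s r)^{m(s,r)} = e;
  -- W = ⟨ S | (s r)^{m(s,r)} = e ⟩ is Word modulo _~_ (as a setoid);
  -- product is concatenation, inverse is reversal.
  data _~_ : Word → Word → Set where
    ~refl  : ∀ {w} → w ~ w
    ~sym   : ∀ {w w'} → w ~ w' → w' ~ w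
    ~trans : ∀ {w w' w''} → w ~ w' → w' ~ w'' → w ~ w''
    ~rel   : ∀ (u v : Word) (s r : Fin n) (k : ℕ) → m s r ≡ just k →
             (u ++ alt s r k ++ v) ~ (u ++ v)

  HasLength : Word → ℕ → Set
  HasLength w k = (∃[ w' ] (w' ~ w × length w' ≡ k)) × (∀ w' → w' ~ w → k ≤ length w')

  _ℓ<_ : Word → Word → Set
  u ℓ< v = ∃[ a ] ∃[ b ] (HasLength u a × HasLength v b × a < b)

  _ℓ+1≡_ : Word → Word → Set
  u ℓ+1≡ v = ∃[ a ] (HasLength u a × HasLength v (a + 1))

  IsReflection : Word → Set
  IsReflection t = ∃[ w ] ∃[ s ] (t ~ (w ++ s ∷ [] ++ reverse w))

  BStep : Word → Word → Set
  BStep u v = ∃[ t ] (IsReflection t × v ~ (u ++ t) × u ℓ< v)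

  _≤B_ : Word → Word → Set
  u ≤B v = ∃[ u' ] (u ~ u' × Star BStep u' v)

  _<B_ : Word → Word → Set
  u <B v = u ≤B v × ¬ (u ~ v)

  _⊲_ : Word → Word → Set
  u ⊲ v = u <B v × u ℓ+1≡ v

  GLP : Word → Word → Set
  GLP u v = ∃[ t ] ( IsReflection t
                   × u <B (u ++ t)
                   × (v ++ t) <B v
                   × u ⊲ (u ++ t) × (u ++ t) ≤B v
                   × u ≤B (v ++ t) × (v ++ t) ⊲ v )

  AllIntervalsGLP : Set
  AllIntervalsGLP = ∀ u v → u <B v → GLP u v

  FiniteW : Set
  FiniteW = ∃[ L ] (∀ (w : Word) → Any (w ~_) L)

  SimplyLaced : Set
  SimplyLaced = ∀ s r → ∃[ k ] (m s r ≡ just k × k ≤ 3)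

{-# OPTIONS --safe #-}
module Submission where

-- Necessity of m ≤ 3. If s r has order at least 4, the interval [s, srs] is bad: an atom st with t a reflection is
-- sr or rs, so vt is srsr or the identity. That sr really has order m is seen in a deformation of the geometric
-- representation which needs no real numbers, and the strong exchange property comes from the parity of the number
-- of occurrences of a reflection in a word.
--
-- Sufficiency. For a finite simply-laced system all roots β ≠ ±α satisfy |⟨β , α⟩| ≤ 1. Take β of minimal height in
-- AD(u,v). If β is simple, this is the lifting property. Otherwise some simple s has ⟨β , α_s⟩ = 1, and by minimality s
-- is a descent of both or of neither of u and v, so that the claim for (u, v, β) follows from (us, vs, β - α_s).
--
-- Necessity of finiteness. If the Tits form is positive definite, the lengths are bounded through the vector ρ - wρ.
-- Otherwise let δ ≥ 0 be of minimal height with B(δ,δ) ≤ 0. Then δ is isotropic and orthogonal to its support, and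
-- some coordinate δ_o is 1. Let D be the rest of the support, z the longest element of W_D, and θ = δ - α_o = w α_i a
-- root of W_D. The interval from u = w z⁻¹ to v = s_i w⁻¹ s_o u is bad: for a candidate t with root β, the root uβ is
-- α_o, and then vt is too short, or it is a sum of two roots which u⁻¹ keeps positive, and then ut does not cover u.

open import Defs
open import Algebra.Bundles using (CommutativeSemiring; Group)
open import Data.Bool.Base using (Bool; true; false; not; _∧_; _xor_)
open import Data.Bool.Properties as Bool using (xor-assoc)
open import Data.Empty using (⊥; ⊥-elim)
open import Data.Fin.Base as Fin using (Fin; zero; suc; toℕ; combine; remQuot)
import Data.Fin.Properties as Fin
open import Data.Integer.Base as ℤ using (ℤ; +_; -[1+_]; 0ℤ; 1ℤ; -1ℤ; _+_; _*_; _-_; -_; _≤_; _<_; +≤+; -≤+; +<+)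
import Data.Integer.DivMod as DivMod
import Data.Integer.Properties as ℤ
open import Data.Integer.Tactic.RingSolver using (solve-∀)
open import Data.List.Base as List using (List; []; _∷_; _++_; length; reverse)
open import Data.List.Membership.Propositional.Properties using (∈-concatMap⁺; ∈-map⁺; ∈-allFin)
import Data.List.Properties as List
open import Data.List.Relation.Unary.All using (All; []; _∷_)
import Data.List.Relation.Unary.All.Properties as All
open import Data.List.Relation.Unary.Any as Any using (Any; here; there)
import Data.List.Relation.Unary.Any.Properties as Any
open import Data.Maybe.Base using (Maybe; just; nothing)
open import Data.Nat.Base as ℕ using (ℕ; zero; suc; z≤n; s≤s)
open import Data.Nat.Divisibility using (_∣_; _∣?_; ∣m∣n⇒∣m+n; ∣m+n∣m⇒∣n; ∣-refl; ∣⇒≤; divides)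
import Data.Nat.Properties as ℕ
import Data.Nat.Solver as ℕS
open import Data.Product.Base using (∃; ∃-syntax; _×_; _,_; proj₁; proj₂)
open import Data.Sum.Base using (_⊎_; inj₁; inj₂; [_,_]′)
open import Data.Vec.Base as Vec using (Vec)
import Data.Vec.Properties as Vec
open import Function.Base using (_∘_; id; case_of_)
open import Function.Bundles using (_⇔_; mk⇔)
open import Level using (0ℓ)
open import Relation.Binary.Construct.Closure.ReflexiveTransitive using (Star; ε; _◅_)
open import Relation.Binary.Definitions using (Tri; tri<; tri≈; tri>)
open import Relation.Binary.PropositionalEquality
open import Relation.Nullary using (¬_; Dec; yes; no; contradiction)
open import Relation.Nullary.Decidable using (¬?; _×-dec_; dec-true; dec-false)
open import Relation.Nullary.Decidable.Core using (does; proof; ¬¬-excluded-middle)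
open import Relation.Nullary.Reflects using (Reflects; ofʸ; ofⁿ; invert)
open import Algebra.Properties.Semiring.Sum (CommutativeSemiring.semiring ℤ.+-*-commutativeSemiring)
  using (sum; sum-cong-≗; sum-replicate-zero; ∑-distrib-+; ∑-comm; *-distribˡ-sum; *-distribʳ-sum)

-- The Coxeter group

-- The two halves of the necessity proof work with different means. As long as an entry of the
-- matrix may exceed 3, roots would need cosines and equality in W cannot be decided by looking at
-- them; so equality is reasoned about under double negation, and the cosines become formal shifts.
-- In the simply-laced case roots are integer vectors with decidable signs, and the length becomes a
-- computable function on words.
--
-- That δ has a coordinate 1 is usually read off the list of affine diagrams: δ is the null root of
-- an affine subdiagram, o one of its special nodes, θ the highest root of the finite diagram D. No
-- list is used here. The least positive value of an integral functional at δ takes its place, and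
-- chip firing on the diagram shows that some coordinate of δ attains it.
--
-- For the same reason definiteness always appears with an explicit constant, as x_i² ≤ C q(x). This
-- one estimate bounds the lengths in a definite parabolic subgroup as well as the chip
-- configurations.

module Words {n : ℕ} (M : CoxeterMatrix n) where
  open CoxeterMatrix M public
  open Coxeter M public

  ~reflexive : ∀ {u v} → u ≡ v → u ~ v
  ~reflexive refl = ~refl

  ++-congˡ : ∀ x {u v} → u ~ v → (x ++ u) ~ (x ++ v)
  ++-congˡ x ~refl = ~refl
  ++-congˡ x (~sym p) = ~sym (++-congˡ x p)
  ++-congˡ x (~trans p q) = ~trans (++-congˡ x p) (++-congˡ x q)
  ++-congˡ x (~rel u v s r k e) =
    subst₂ _~_ (List.++-assoc x u _) (List.++-assoc x u v) (~rel (x ++ u) v s r k e)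

  ++-congʳ : ∀ y {u v} → u ~ v → (u ++ y) ~ (v ++ y)
  ++-congʳ y ~refl = ~refl
  ++-congʳ y (~sym p) = ~sym (++-congʳ y p)
  ++-congʳ y (~trans p q) = ~trans (++-congʳ y p) (++-congʳ y q)
  ++-congʳ y (~rel u v s r k e) = subst₂ _~_ eq (sym (List.++-assoc u v y)) (~rel u (v ++ y) s r k e)
    where
    eq : u ++ alt s r k ++ v ++ y ≡ (u ++ alt s r k ++ v) ++ y
    eq = trans (cong (u ++_) (sym (List.++-assoc (alt s r k) v y))) (sym (List.++-assoc u _ y))

  ++-cong : ∀ {u u' v v'} → u ~ u' → v ~ v' → (u ++ v) ~ (u' ++ v')
  ++-cong {u} {u'} {v} {v'} p q = ~trans (++-congʳ v p) (++-congˡ u' q)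

  square : ∀ s w → (s ∷ s ∷ w) ~ w
  square s w = ~rel [] w s s 1 (diag s)

  inverseʳ : ∀ w → (w ++ reverse w) ~ []
  inverseʳ [] = ~refl
  inverseʳ (s ∷ w) = ~trans (~reflexive eq) (~trans (++-congˡ (s ∷ []) (++-congʳ (s ∷ []) (inverseʳ w))) (square s []))
    where
    eq : s ∷ w ++ reverse (s ∷ w) ≡ s ∷ (w ++ reverse w) ++ s ∷ []
    eq = cong (s ∷_) (trans (cong (w ++_) (List.unfold-reverse s w)) (sym (List.++-assoc w (reverse w) _)))

  inverseˡ : ∀ w → (reverse w ++ w) ~ []
  inverseˡ w = subst (λ v → (reverse w ++ v) ~ []) (List.reverse-involutive w) (inverseʳ (reverse w))

  reverse-cong : ∀ {u v} → u ~ v → reverse u ~ reverse v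
  reverse-cong {u} {v} p =
    ~trans (~reflexive (sym (List.++-identityʳ (reverse u))))
    (~trans (++-congˡ (reverse u) (~sym (inverseʳ v)))
    (~trans (++-congˡ (reverse u) (++-congʳ (reverse v) (~sym p)))
    (~trans (~reflexive (sym (List.++-assoc (reverse u) u (reverse v))))
            (++-congʳ (reverse v) (inverseˡ u)))))

  W : Group 0ℓ 0ℓ
  W = record
    { Carrier = Word ; _≈_ = _~_ ; _∙_ = _++_ ; ε = [] ; _⁻¹ = reverse
    ; isGroup = record
      { isMonoid = record
        { isSemigroup = record
          { isMagma = record
            { isEquivalence = record { refl = ~refl ; sym = ~sym ; trans = ~trans }
            ; ∙-cong = ++-cong }
          ; assoc = λ x y z → ~reflexive (List.++-assoc x y z) }
        ; identity = (λ x → ~refl) , (λ x → ~reflexive (List.++-identityʳ x)) }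
      ; inverse = inverseˡ , inverseʳ
      ; ⁻¹-cong = reverse-cong } }

  open import Algebra.Properties.Group W public
    using (∙-cancelˡ; ∙-cancelʳ; inverseˡ-unique; \\-leftDividesˡ; \\-leftDividesʳ; //-rightDividesʳ)
  module ~-Reasoning where
    open import Relation.Binary.Reasoning.Setoid (Group.setoid W) public

  reflection-involutive : ∀ {t} → IsReflection t → reverse t ~ t
  reflection-involutive {t} (x , s , p) = begin
    reverse t                       ≈⟨ reverse-cong p ⟩
    reverse (x ++ s ∷ reverse x)    ≡⟨ List.reverse-++ x _ ⟩
    reverse (s ∷ reverse x) ++ reverse x ≡⟨ cong (_++ reverse x) (List.unfold-reverse s (reverse x)) ⟩
    (reverse (reverse x) ++ s ∷ []) ++ reverse x ≡⟨ cong (λ y → (y ++ s ∷ []) ++ reverse x) (List.reverse-involutive x) ⟩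
    (x ++ s ∷ []) ++ reverse x      ≡⟨ List.++-assoc x (s ∷ []) (reverse x) ⟩
    x ++ s ∷ reverse x              ≈⟨ p ⟨
    t                               ∎
    where open ~-Reasoning

  -- The sign character of W. It rules out equalities between short words of different parity, which
  -- is half of the length computations for srs.
  parity : Word → Bool
  parity [] = false
  parity (s ∷ w) = not (parity w)

  parity-++ : ∀ u v → parity (u ++ v) ≡ parity u xor parity v
  parity-++ [] v = refl
  parity-++ (s ∷ u) v with parity u | parity-++ u v
  ... | true | e rewrite e = not-involutive (parity v)
    where
    not-involutive : ∀ b → not (not b) ≡ b
    not-involutive true = refl
    not-involutive false = refl
  ... | false | e = cong not e

  parity-alt : ∀ s r k w → parity (alt s r k ++ w) ≡ parity w
  parity-alt s r zero w = refl
  parity-alt s r (suc k) w with parity (alt s r k ++ w) | parity-alt s r k w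
  ... | true | e = e
  ... | false | e = e

  parity-cong : ∀ {u v} → u ~ v → parity u ≡ parity v
  parity-cong ~refl = refl
  parity-cong (~sym p) = sym (parity-cong p)
  parity-cong (~trans p q) = trans (parity-cong p) (parity-cong q)
  parity-cong (~rel u v s r k e) =
    trans (parity-++ u _) (trans (cong (parity u xor_) (parity-alt s r k v)) (sym (parity-++ u v)))

-- Strong exchange, up to double negation

infix 3 _↔_
infixr 4 _⊕_

_↔_ : Set → Set → Set
P ↔ Q = (P → Q) × (Q → P)

-- Exclusive or, written as a negation: it is stable under double negation whatever its arguments
-- are, so truth tables may be checked after assuming the arguments decided.
_⊕_ : Set → Set → Set
P ⊕ Q = ¬ (P ↔ Q)

↔-sym : ∀ {P Q} → P ↔ Q → Q ↔ P
↔-sym (f , g) = g , f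

↔-trans : ∀ {P Q R} → P ↔ Q → Q ↔ R → P ↔ R
↔-trans (f , g) (h , k) = h ∘ f , g ∘ k

⊕-cong : ∀ {P P' Q Q'} → P ↔ P' → Q ↔ Q' → (P ⊕ Q) ↔ (P' ⊕ Q')
⊕-cong p q =
  (λ h e → h (↔-trans p (↔-trans e (↔-sym q)))) , (λ h e → h (↔-trans (↔-sym p) (↔-trans e q)))

⊕-irrefl : ∀ {P Q} → P ↔ Q → ¬ (P ⊕ Q)
⊕-irrefl e h = h e

⊕-identityˡ : ∀ {P} → (¬ ¬ P → P) → (⊥ ⊕ P) ↔ P
⊕-identityˡ stable = (λ h → stable (λ ¬p → h (⊥-elim , ¬p))) , (λ p (f , g) → g p)

⊕-reflects : ∀ {P Q : Set} {a b} → Reflects P a → Reflects Q b → Reflects (P ⊕ Q) (a xor b)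
⊕-reflects (ofʸ p) (ofʸ q) = ofⁿ λ h → h ((λ _ → q) , (λ _ → p))
⊕-reflects (ofʸ p) (ofⁿ ¬q) = ofʸ λ (f , _) → ¬q (f p)
⊕-reflects (ofⁿ ¬p) (ofʸ q) = ofʸ λ (_ , g) → ¬p (g q)
⊕-reflects (ofⁿ ¬p) (ofⁿ ¬q) = ofⁿ λ h → h (⊥-elim ∘ ¬p , ⊥-elim ∘ ¬q)

reflects-transfer : ∀ {X Y : Set} {a} → Reflects X a → Reflects Y a → X → Y
reflects-transfer (ofʸ _) (ofʸ y) x = y
reflects-transfer (ofⁿ ¬x) _ x = ⊥-elim (¬x x)

⊕-assoc : ∀ {P Q R} → ((P ⊕ Q) ⊕ R) ↔ (P ⊕ (Q ⊕ R))
⊕-assoc {P} {Q} {R} = lem , lem'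
  where
  lem : ((P ⊕ Q) ⊕ R) → P ⊕ (Q ⊕ R)
  lem h k =
    ¬¬-excluded-middle {A = P} λ p → ¬¬-excluded-middle {A = Q} λ q → ¬¬-excluded-middle {A = R} λ r →
    reflects-transfer (⊕-reflects (⊕-reflects (proof p) (proof q)) (proof r))
      (subst (Reflects (P ⊕ (Q ⊕ R))) (sym (xor-assoc (does p) (does q) (does r)))
        (⊕-reflects (proof p) (⊕-reflects (proof q) (proof r)))) h k
  lem' : P ⊕ (Q ⊕ R) → (P ⊕ Q) ⊕ R
  lem' h k =
    ¬¬-excluded-middle {A = P} λ p → ¬¬-excluded-middle {A = Q} λ q → ¬¬-excluded-middle {A = R} λ r →
    reflects-transfer (⊕-reflects (proof p) (⊕-reflects (proof q) (proof r)))
      (subst (Reflects ((P ⊕ Q) ⊕ R)) (xor-assoc (does p) (does q) (does r))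
        (⊕-reflects (⊕-reflects (proof p) (proof q)) (proof r))) h k

⨁ : (ℕ → Set) → ℕ → Set
⨁ f zero = ⊥
⨁ f (suc k) = f 0 ⊕ ⨁ (f ∘ suc) k

⨁-stable : ∀ f k → ¬ ¬ ⨁ f k → ⨁ f k
⨁-stable f zero h = h id
⨁-stable f (suc k) h e = h (λ g → g e)

⨁-cong : ∀ {f g} k → (∀ i → f i ↔ g i) → ⨁ f k ↔ ⨁ g k
⨁-cong zero h = id , id
⨁-cong (suc k) h = ⊕-cong (h 0) (⨁-cong k (h ∘ suc))

⨁-+ : ∀ f k l → ⨁ f (k ℕ.+ l) ↔ (⨁ f k ⊕ ⨁ (λ i → f (k ℕ.+ i)) l)
⨁-+ f zero l = ↔-sym (⊕-identityˡ (⨁-stable f l))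
⨁-+ f (suc k) l = ↔-trans (⊕-cong (id , id) (⨁-+ (f ∘ suc) k l)) (↔-sym ⊕-assoc)

-- The two halves of the sum agree term by term and cancel.
⨁-periodic : ∀ f k → (∀ i → f i ↔ f (k ℕ.+ i)) → ¬ ⨁ f (k ℕ.+ k)
⨁-periodic f k h x = ⊕-irrefl (⨁-cong k h) (proj₁ (⨁-+ f k k) x)

-- Odd w t says that t occurs an odd number of times among the reflections s₁ ⋯ sᵢ ⋯ s₁ of w = s₁ ⋯ sₖ.
-- Equality in W is not decidable at this stage, so the parity is a ¬¬-stable proposition, not a Boolean.
module Exchange {n : ℕ} (M : CoxeterMatrix n) where
  open Words M

  conj : Word → Word → Word
  conj x t = reverse x ++ t ++ x

  conj-cong : ∀ x {t t'} → t ~ t' → conj x t ~ conj x t'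
  conj-cong x p = ++-congˡ (reverse x) (++-congʳ x p)

  Odd : Word → Word → Set
  Odd [] t = ⊥
  Odd (s ∷ w) t = (t ~ (s ∷ [])) ⊕ Odd w (conj (s ∷ []) t)

  Odd-stable : ∀ w t → ¬ ¬ Odd w t → Odd w t
  Odd-stable [] t h = h id
  Odd-stable (s ∷ w) t h e = h (λ g → g e)

  Odd-cong : ∀ w {t t'} → t ~ t' → Odd w t ↔ Odd w t'
  Odd-cong [] p = id , id
  Odd-cong (s ∷ w) p =
    ⊕-cong (~trans (~sym p) , ~trans p) (Odd-cong w (conj-cong (s ∷ []) p))

  conj-++ : ∀ x y t → conj (x ++ y) t ≡ conj y (conj x t)
  conj-++ x y t = begin
    reverse (x ++ y) ++ t ++ x ++ y          ≡⟨ cong (_++ (t ++ x ++ y)) (List.reverse-++ x y) ⟩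
    (reverse y ++ reverse x) ++ t ++ x ++ y  ≡⟨ List.++-assoc (reverse y) (reverse x) _ ⟩
    reverse y ++ reverse x ++ t ++ x ++ y    ≡⟨ cong (λ z → reverse y ++ reverse x ++ z) (List.++-assoc t x y) ⟨
    reverse y ++ reverse x ++ (t ++ x) ++ y  ≡⟨ cong (reverse y ++_) (List.++-assoc (reverse x) (t ++ x) y) ⟨
    conj y (conj x t)                        ∎
    where open ≡-Reasoning

  conj-trivial : ∀ x t → x ~ [] → conj x t ~ t
  conj-trivial x t p = ~trans (++-cong (reverse-cong p) (++-congˡ t p)) (~reflexive (List.++-identityʳ t))

  conj-reverse : ∀ x t → conj x (conj (reverse x) t) ~ t
  conj-reverse x t = ~trans (~reflexive (sym (conj-++ (reverse x) x t))) (conj-trivial _ t (inverseˡ x))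

  Odd-++ : ∀ u v t → Odd (u ++ v) t ↔ (Odd u t ⊕ Odd v (conj u t))
  Odd-++ [] v t =
    ↔-trans (Odd-cong v (~reflexive (sym (List.++-identityʳ t)))) (↔-sym (⊕-identityˡ (Odd-stable v _)))
  Odd-++ (s ∷ u) v t =
    ↔-trans (⊕-cong (id , id) (Odd-++ u v _))
    (↔-trans (⊕-cong (id , id) (⊕-cong (id , id) (Odd-cong v (~reflexive (sym (conj-++ (s ∷ []) u t))))))
      (↔-sym ⊕-assoc))

  alternating : Fin n → Fin n → ℕ → Word
  alternating s r zero = []
  alternating s r (suc k) = s ∷ alternating r s k

  alt-alternating : ∀ s r k → alt s r k ≡ alternating s r (k ℕ.+ k)
  alt-alternating s r zero = refl
  alt-alternating s r (suc k) rewrite ℕ.+-suc k k = cong (λ w → s ∷ r ∷ w) (alt-alternating s r k)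

  alternating-+ : ∀ s r k j → alternating s r (k ℕ.+ k ℕ.+ j) ≡ alternating s r (k ℕ.+ k) ++ alternating s r j
  alternating-+ s r zero j = refl
  alternating-+ s r (suc k) j rewrite ℕ.+-suc k k = cong (λ w → s ∷ r ∷ w) (alternating-+ s r k j)

  alternating-∷ʳ : ∀ s r i → alternating r s (suc (i ℕ.+ i)) ++ s ∷ [] ≡ alternating r s (suc (suc (i ℕ.+ i)))
  alternating-∷ʳ s r zero = refl
  alternating-∷ʳ s r (suc i) rewrite ℕ.+-suc i i = cong (λ w → r ∷ s ∷ w) (alternating-∷ʳ s r i)

  -- The palindrome (s r)^i s of length 2i + 1: the reflection contributed by the letter at position
  -- i, counted from zero, of the word s r s r ⋯.
  alternating-reflection : Fin n → Fin n → ℕ → Word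
  alternating-reflection s r i = alternating s r (suc (i ℕ.+ i))

  conj-alternating : ∀ s r i → conj (s ∷ []) (alternating-reflection r s i) ≡ alternating-reflection s r (suc i)
  conj-alternating s r i = cong (s ∷_)
    (trans (alternating-∷ʳ s r i) (cong (alternating r s) (cong suc (sym (ℕ.+-suc i i)))))

  conj-involutive : ∀ s t → conj (s ∷ []) (conj (s ∷ []) t) ~ t
  conj-involutive s t = conj-reverse (s ∷ []) t

  Odd-alternating : ∀ s r k t → Odd (alternating s r k) t ↔ ⨁ (λ i → t ~ alternating-reflection s r i) k
  Odd-alternating s r zero t = id , id
  Odd-alternating s r (suc k) t = ⊕-cong (id , id)
    (↔-trans (Odd-alternating r s k (conj (s ∷ []) t)) (⨁-cong k λ i →
      (λ p → ~trans (~sym (conj-involutive s t)) (~trans (conj-cong (s ∷ []) p) (~reflexive (conj-alternating s r i)))) ,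
      (λ p → ~trans (conj-cong (s ∷ []) (~trans p (~reflexive (sym (conj-alternating s r i)))))
               (conj-involutive s _))))

  -- By the relation itself, the reflections at the positions i and k + i among the 2k letters are
  -- equal in W.
  Odd-alt : ∀ s r k t → m s r ≡ just k → ¬ Odd (alt s r k) t
  Odd-alt s r k t e h = ⨁-periodic (λ i → t ~ alternating-reflection s r i) k periodic
    (proj₁ (Odd-alternating s r (k ℕ.+ k) t) (subst (λ w → Odd w t) (alt-alternating s r k) h))
    where
    shift : ∀ i → alternating-reflection s r (k ℕ.+ i) ~ alternating-reflection s r i
    shift i = ~trans (~reflexive (trans (cong (alternating s r) index) (trans (alternating-+ s r k _)
      (cong (_++ alternating s r (suc (i ℕ.+ i))) (sym (alt-alternating s r k)))))) (~rel [] _ s r k e)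
      where
      open ℕS.+-*-Solver
      index : suc (k ℕ.+ i ℕ.+ (k ℕ.+ i)) ≡ k ℕ.+ k ℕ.+ suc (i ℕ.+ i)
      index = solve 2 (λ k i → con 1 :+ (k :+ i :+ (k :+ i)) := k :+ k :+ (con 1 :+ (i :+ i))) refl k i
    periodic : ∀ i → t ~ alternating-reflection s r i ↔ t ~ alternating-reflection s r (k ℕ.+ i)
    periodic i = (λ p → ~trans p (~sym (shift i))) , (λ p → ~trans p (shift i))

  -- The parity descends to W. Classically it is the indicator of the left inversions of w.
  Odd-respects-~ : ∀ {w w'} → w ~ w' → ∀ t → Odd w t ↔ Odd w' t
  Odd-respects-~ ~refl t = id , id
  Odd-respects-~ (~sym p) t = ↔-sym (Odd-respects-~ p t)
  Odd-respects-~ (~trans p q) t = ↔-trans (Odd-respects-~ p t) (Odd-respects-~ q t)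
  Odd-respects-~ (~rel u v s r k e) t =
    ↔-trans (Odd-++ u _ t) (↔-trans (⊕-cong (id , id) drop) (↔-sym (Odd-++ u v t)))
    where
    t' = conj u t
    drop : Odd (alt s r k ++ v) t' ↔ Odd v t'
    drop = ↔-trans (Odd-++ (alt s r k) v t')
      (↔-trans (⊕-cong ((λ h → Odd-alt s r k t' e h) , ⊥-elim)
                 (Odd-cong v (conj-trivial _ t' (subst (_~ []) (List.++-identityʳ _) (~rel [] [] s r k e)))))
        (⊕-identityˡ (Odd-stable v t')))

  -- For t = x s x⁻¹ the contributions of x and of x⁻¹ cancel, which leaves the one of s.
  Odd-reflection : ∀ t → IsReflection t → Odd t t
  Odd-reflection t (x , s , p) = proj₂ (Odd-respects-~ p t) (proj₂ (Odd-++ x _ t) λ (f , g) →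
    cancel λ (h , k) →
      let no-Odd-x : ¬ Odd x t
          no-Odd-x o = f o ((λ _ → proj₂ (Odd-cong (reverse x) simple') (k o)) , (λ _ → simple))
      in no-Odd-x (g λ (h' , k') → no-Odd-x (h (proj₁ (Odd-cong (reverse x) simple') (h' simple)))))
    where
    c = conj x t
    simple : c ~ (s ∷ [])
    simple = begin
      conj x t                                            ≈⟨ conj-cong x p ⟩
      conj x (x ++ s ∷ reverse x)                         ≡⟨ cong (λ y → conj x (y ++ s ∷ reverse x))
          (List.reverse-involutive x) ⟨
      conj x (conj (reverse x) (s ∷ []))                  ≈⟨ conj-reverse x _ ⟩
      s ∷ []                                              ∎
      where open ~-Reasoning
    simple' : conj (s ∷ []) c ~ c
    simple' = ~trans (conj-cong (s ∷ []) simple) (~trans (square s _) (~sym simple))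
    back : conj (reverse x) c ~ t
    back = subst (λ y → conj (reverse x) (conj y t) ~ t) (List.reverse-involutive x) (conj-reverse (reverse x) t)
    cancel : ¬ ¬ (Odd (reverse x) c ↔ Odd x t)
    cancel h = proj₁ (Odd-respects-~ (inverseˡ x) c)
      (proj₂ (Odd-++ (reverse x) x c) (h ∘ λ e → ↔-trans e (Odd-cong x back)))

  -- `t` is odd in itself and is fixed by conjugation with itself, so multiplying by `t` toggles the
  -- parity at `t`.
  Odd-flip : ∀ t w → IsReflection t → ¬ Odd w t → Odd (t ++ w) t
  Odd-flip t w t-refl h = proj₂ (Odd-++ t w t) λ (f , _) →
    h (proj₁ (Odd-cong w (~trans (~reflexive (sym (List.++-assoc (reverse t) t t))) (++-congʳ t (inverseˡ t))))
         (f (Odd-reflection t t-refl)))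

  deletions : Word → List Word
  deletions [] = []
  deletions (s ∷ w) = w ∷ List.map (s ∷_) (deletions w)

  -- An odd count is not zero, and deleting a letter at which `t` occurs yields t w. Locating that
  -- letter takes case distinctions on equality in W, hence the double negation.
  exchange : ∀ w t → Odd w t → ¬ ¬ Any ((t ++ w) ~_) (deletions w)
  exchange (s ∷ w) t o h = ¬¬-excluded-middle {A = t ~ (s ∷ [])} λ where
      (yes p) → h (here (~trans (++-congʳ (s ∷ w) p) (square s w)))
      (no ¬p) → exchange w (conj (s ∷ []) t)
        (Odd-stable w _ λ ¬o → o ((λ p → ⊥-elim (¬p p)) , (λ o' → ⊥-elim (¬o o'))))
        λ a → h (there (Any.map⁺ (Any.map lift a)))
    where
    lift : ∀ {d} → (conj (s ∷ []) t ++ w) ~ d → (t ++ s ∷ w) ~ (s ∷ d)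
    lift {d} p = begin
      t ++ s ∷ w                   ≈⟨ square s _ ⟨
      s ∷ s ∷ t ++ s ∷ w           ≡⟨ cong (λ z → s ∷ s ∷ z) (List.++-assoc t (s ∷ []) w) ⟨
      s ∷ conj (s ∷ []) t ++ w     ≈⟨ ++-congˡ (s ∷ []) p ⟩
      s ∷ d                        ∎
      where open ~-Reasoning

-- The interval [s, srs]

module LargeOrder {n : ℕ} (M : CoxeterMatrix n) where
  open Words M
  open Exchange M

  HasLength-unique : ∀ {w k l} → HasLength w k → HasLength w l → k ≡ l
  HasLength-unique ((w , p , refl) , h) ((w' , p' , refl) , h') = ℕ.≤-antisym (h w' p') (h' w p)

  HasLength-cong : ∀ {w w' k} → w ~ w' → HasLength w k → HasLength w' k
  HasLength-cong p ((v , q , e) , h) = (v , ~trans q p , e) , λ x q' → h x (~trans q' (~sym p))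

  ≤B-length : ∀ {x y k l} → Star BStep x y → HasLength x k → HasLength y l → k ℕ.≤ l
  ≤B-length ε hk hl = ℕ.≤-reflexive (HasLength-unique hk hl)
  ≤B-length ((t , tr , p , a , b , ha , hb , a<b) ◅ q) hk hl =
    ℕ.≤-trans (ℕ.<⇒≤ (subst (ℕ._< b) (HasLength-unique ha hk) a<b)) (≤B-length q hb hl)

  module _ (s r : Fin n)
    (sr≁ε : ¬ (s ∷ r ∷ []) ~ [])
    (srsr≁ε : ¬ (s ∷ r ∷ s ∷ r ∷ []) ~ [])
    (srsrsr≁ε : ¬ (s ∷ r ∷ s ∷ r ∷ s ∷ r ∷ []) ~ [])
    where

    private
      -- Since `ρ i` is (s r)^i s, the three hypotheses on s and r amount to `ρ 0`, `ρ 1`, `ρ 2`,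
      -- `ρ 3` being distinct.
      ρ : ℕ → Word
      ρ = alternating-reflection s r

      ρ₀≁ρ₁ : ¬ ρ 0 ~ ρ 1
      ρ₀≁ρ₁ p = sr≁ε (~sym (∙-cancelʳ (s ∷ []) [] (s ∷ r ∷ []) p))

      ρ₀≁ρ₂ : ¬ ρ 0 ~ ρ 2
      ρ₀≁ρ₂ p = srsr≁ε (~sym (∙-cancelʳ (s ∷ []) [] (s ∷ r ∷ s ∷ r ∷ []) p))

      ρ₀≁ρ₃ : ¬ ρ 0 ~ ρ 3
      ρ₀≁ρ₃ p = srsrsr≁ε (~sym (∙-cancelʳ (s ∷ []) [] (s ∷ r ∷ s ∷ r ∷ s ∷ r ∷ []) p))

      ρ₁≁ρ₂ : ¬ ρ 1 ~ ρ 2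
      ρ₁≁ρ₂ p = sr≁ε (~sym (∙-cancelʳ (s ∷ r ∷ s ∷ []) [] (s ∷ r ∷ []) p))

      ρ₁≁ρ₃ : ¬ ρ 1 ~ ρ 3
      ρ₁≁ρ₃ p = srsr≁ε (~sym (∙-cancelʳ (s ∷ r ∷ s ∷ []) [] (s ∷ r ∷ s ∷ r ∷ []) p))

      ρ₂≁ρ₃ : ¬ ρ 2 ~ ρ 3
      ρ₂≁ρ₃ p = sr≁ε (~sym (∙-cancelʳ (s ∷ r ∷ s ∷ r ∷ s ∷ []) [] (s ∷ r ∷ []) p))

      odd : ∀ k t → Reflects (⨁ (λ i → t ~ ρ i) k) true → Odd (alternating s r k) t
      odd k t h = proj₂ (Odd-alternating s r k t) (invert h)

      srs srsr : Word
      srs = alternating s r 3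
      srsr = alternating s r 4

      srs-odd₀ : Odd srs (ρ 0)
      srs-odd₀ = odd 3 _ (⊕-reflects (ofʸ ~refl) (⊕-reflects (ofⁿ ρ₀≁ρ₁) (⊕-reflects (ofⁿ ρ₀≁ρ₂) (ofⁿ id))))

      srs-odd₁ : Odd srs (ρ 1)
      srs-odd₁ = odd 3 _ (⊕-reflects (ofⁿ (ρ₀≁ρ₁ ∘ ~sym)) (⊕-reflects (ofʸ ~refl) (⊕-reflects (ofⁿ ρ₁≁ρ₂) (ofⁿ id))))

      srsr-odd₀ : Odd srsr (ρ 0)
      srsr-odd₀ = odd 4 _ (⊕-reflects (ofʸ ~refl) (⊕-reflects (ofⁿ ρ₀≁ρ₁)
        (⊕-reflects (ofⁿ ρ₀≁ρ₂) (⊕-reflects (ofⁿ ρ₀≁ρ₃) (ofⁿ id)))))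

      srsr-odd₁ : Odd srsr (ρ 1)
      srsr-odd₁ = odd 4 _ (⊕-reflects (ofⁿ (ρ₀≁ρ₁ ∘ ~sym)) (⊕-reflects (ofʸ ~refl)
        (⊕-reflects (ofⁿ ρ₁≁ρ₂) (⊕-reflects (ofⁿ ρ₁≁ρ₃) (ofⁿ id)))))

      srsr-odd₂ : Odd srsr (ρ 2)
      srsr-odd₂ = odd 4 _ (⊕-reflects (ofⁿ (ρ₀≁ρ₂ ∘ ~sym)) (⊕-reflects (ofⁿ (ρ₁≁ρ₂ ∘ ~sym))
        (⊕-reflects (ofʸ ~refl) (⊕-reflects (ofⁿ ρ₂≁ρ₃) (ofⁿ id)))))

      Odd-letter : ∀ c {t} → Odd (c ∷ []) t → ¬ ¬ (t ~ (c ∷ []))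
      Odd-letter c o h = o (⊥-elim ∘ h , ⊥-elim)

      Odd-pair : ∀ c d {t} → Odd (c ∷ d ∷ []) t → ¬ ¬ (t ~ (c ∷ []) ⊎ conj (c ∷ []) t ~ (d ∷ []))
      Odd-pair c d o h = o (⊥-elim ∘ h ∘ inj₁ , λ o' → ⊥-elim (o' (⊥-elim ∘ h ∘ inj₂ , ⊥-elim)))

      conj-injective : ∀ c {t t'} → conj (c ∷ []) t ~ conj (c ∷ []) t' → t ~ t'
      conj-injective c p =
        ~trans (~sym (conj-involutive c _)) (~trans (conj-cong (c ∷ []) p) (conj-involutive c _))

      srs≁letter : ∀ c → ¬ (c ∷ []) ~ srs
      srs≁letter c p =
        Odd-letter c (proj₂ (Odd-respects-~ p _) srs-odd₀) λ p₀ →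
        Odd-letter c (proj₂ (Odd-respects-~ p _) srs-odd₁) λ p₁ →
        ρ₀≁ρ₁ (~trans p₀ (~sym p₁))

      -- Pigeonhole: three distinct odd reflections of srsr would have to share the two positions of
      -- a word with two letters.
      srsr≁pair : ∀ c d → ¬ (c ∷ d ∷ []) ~ srsr
      srsr≁pair c d p =
        Odd-pair c d (proj₂ (Odd-respects-~ p _) srsr-odd₀) λ q₀ →
        Odd-pair c d (proj₂ (Odd-respects-~ p _) srsr-odd₁) λ q₁ →
        Odd-pair c d (proj₂ (Odd-respects-~ p _) srsr-odd₂) λ q₂ →
        case q₀ , q₁ , q₂ of λ where
          (inj₁ a , inj₁ b , _) → ρ₀≁ρ₁ (~trans a (~sym b))
          (inj₁ a , inj₂ b , inj₁ c) → ρ₀≁ρ₂ (~trans a (~sym c))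
          (inj₁ a , inj₂ b , inj₂ c') → ρ₁≁ρ₂ (conj-injective c (~trans b (~sym c')))
          (inj₂ a , inj₁ b , inj₁ c) → ρ₁≁ρ₂ (~trans b (~sym c))
          (inj₂ a , inj₁ b , inj₂ c') → ρ₀≁ρ₂ (conj-injective c (~trans a (~sym c')))
          (inj₂ a , inj₂ b , _) → ρ₀≁ρ₁ (conj-injective c (~trans a (~sym b)))

      length-s : HasLength (s ∷ []) 1
      length-s = (_ , ~refl , refl) , λ where
        [] p → contradiction (parity-cong p) λ ()
        (_ ∷ _) p → s≤s z≤n

      length-sr : HasLength (s ∷ r ∷ []) 2
      length-sr = (_ , ~refl , refl) , λ where
        [] p → ⊥-elim (sr≁ε (~sym p))
        (_ ∷ []) p → contradiction (parity-cong p) λ ()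
        (_ ∷ _ ∷ _) p → s≤s (s≤s z≤n)

      length-srs : HasLength srs 3
      length-srs = (_ , ~refl , refl) , λ where
        [] p → contradiction (parity-cong p) λ ()
        (c ∷ []) p → ⊥-elim (srs≁letter c p)
        (_ ∷ _ ∷ []) p → contradiction (parity-cong p) λ ()
        (_ ∷ _ ∷ _ ∷ _) p → s≤s (s≤s (s≤s z≤n))

      s<srs : (s ∷ []) <B srs
      s<srs =
        ( s ∷ [] , ~refl
        , (r ∷ [] , ([] , r , ~refl) , ~refl , 1 , 2 , length-s , length-sr , ℕ.≤-refl)
        ◅ (s ∷ [] , ([] , s , ~refl) , ~refl , 2 , 3 , length-sr , length-srs , ℕ.≤-refl) ◅ ε)
        , ρ₀≁ρ₁

      length-0 : ∀ {w k} → HasLength w k → w ~ [] → k ≡ 0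
      length-0 (_ , h) p = ℕ.n≤0⇒n≡0 (h [] (~sym p))

      -- By lengths, a chain from x to srs has exactly one step x t = srs. Then x is the inverse of
      -- t srs, and exchange deletes a letter of srs.
      atoms : ∀ {x} → HasLength x 2 → x ≤B srs →
              ¬ ¬ (x ~ (s ∷ r ∷ []) ⊎ x ~ [] ⊎ x ~ (r ∷ s ∷ []))
      atoms hx (x' , p , ε) h = contradiction (HasLength-unique (HasLength-cong p hx) length-srs) λ ()
      atoms {x} hx (x' , p , (t , t-refl , q , a , b , ha , hb , a<b) ◅ (_ , _ , _ , a' , b' , ha' , hb' , a'<b') ◅ y≤) h
        with refl ← HasLength-unique ha (HasLength-cong p hx) | refl ← HasLength-unique ha' hb =
        contradiction (ℕ.≤-trans (s≤s a<b) (ℕ.≤-trans a'<b' (≤B-length y≤ hb' length-srs))) λ where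
          (s≤s (s≤s (s≤s ())))
      atoms {x} hx@((d , d~x , d-length) , _) (x' , p , (t , t-refl@(w , c , t~) , q , _) ◅ ε) h =
        ¬¬-excluded-middle {A = Odd srs t} λ where
          (yes o) → exchange srs t o λ where
            (here e) → h (inj₁ (from e))
            (there (here e)) → h (inj₂ (inj₁ (~trans (from e) (square s []))))
            (there (there (here e))) → h (inj₂ (inj₂ (from e)))
          -- Otherwise `t` is odd in t srs, the inverse of x, which has a word with two letters;
          -- exchange in that word would make srs a single letter.
          (no ¬o) → long d d-length (~trans d~x x~) (Odd-flip t srs t-refl ¬o)
        where
        t⁻¹~t : reverse t ~ t
        t⁻¹~t = reflection-involutive t-refl
        x~ : x ~ reverse (t ++ srs)
        x~ = begin
          x                     ≈⟨ p ⟩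
          x'                    ≈⟨ //-rightDividesʳ t x' ⟨
          (x' ++ t) ++ reverse t ≈⟨ ++-congʳ (reverse t) q ⟨
          srs ++ reverse t      ≡⟨ List.reverse-++ t srs ⟨
          reverse (t ++ srs)    ∎
          where open ~-Reasoning
        from : ∀ {y} → (t ++ srs) ~ y → x ~ reverse y
        from e = ~trans x~ (reverse-cong e)
        long : ∀ d → length d ≡ 2 → d ~ reverse (t ++ srs) → ¬ Odd (t ++ srs) t
        long (a ∷ b ∷ []) refl e o = exchange (b ∷ a ∷ []) t (proj₁ (Odd-respects-~ ts~ t) o) λ where
            (here e) → short (~trans srs~ e)
            (there (here e)) → short (~trans srs~ e)
          where
          ts~ : (t ++ srs) ~ (b ∷ a ∷ [])
          ts~ = subst (_~ _) (List.reverse-involutive (t ++ srs)) (~sym (reverse-cong e))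
          srs~ : srs ~ (t ++ b ∷ a ∷ [])
          srs~ = ~trans (~sym (\\-leftDividesʳ t srs)) (~trans (++-congʳ _ t⁻¹~t) (++-congˡ t ts~))
          short : ∀ {c} → ¬ srs ~ (c ∷ [])
          short e = srs≁letter _ (~sym e)

    no-GLP : ¬ AllIntervalsGLP
    no-GLP glp with glp (s ∷ []) srs s<srs
    ... | t , _ , _ , _ , (_ , a , ha , hst) , st≤srs , _ , (_ , b , hvt , hv)
      with refl ← HasLength-unique ha length-s | refl ← ℕ.suc-injective
          (trans (ℕ.+-comm 1 b) (HasLength-unique hv length-srs)) =
      atoms hst st≤srs λ where
        (inj₁ e) → let (d , d~ , ∣d∣) , _ = hvt in
          not-pair d ∣d∣ (~trans d~ (++-congˡ srs (∙-cancelˡ (s ∷ []) t (r ∷ []) e)))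
        (inj₂ (inj₁ e)) → contradiction (length-0 hst e) λ ()
        (inj₂ (inj₂ e)) → contradiction (length-0 hvt (~trans (++-congˡ (s ∷ r ∷ []) e)
            (~trans (++-congˡ (s ∷ []) (square r _)) (square s [])))) λ ()
      where
      not-pair : ∀ d → length d ≡ 2 → ¬ d ~ srsr
      not-pair (a ∷ b ∷ []) refl = srsr≁pair a b

-- The order of a product of two generators

sum-zero : ∀ {n} {f : Fin n → ℤ} → (∀ i → f i ≡ 0ℤ) → sum f ≡ 0ℤ
sum-zero {n} h = trans (sum-cong-≗ h) (sum-replicate-zero n)

sum-neg : ∀ {n} (f : Fin n → ℤ) → sum (λ i → - f i) ≡ - sum f
sum-neg {zero} f = refl
sum-neg {suc n} f = trans (cong (_+_ (- f zero)) (sum-neg (f ∘ suc))) (sym (ℤ.neg-distrib-+ (f zero) _))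

sum-- : ∀ {n} (f g : Fin n → ℤ) → sum (λ i → f i - g i) ≡ sum f - sum g
sum-- f g = trans (∑-distrib-+ f (λ i → - g i)) (cong (_+_ (sum f)) (sum-neg g))

sum-differ-at : ∀ {n} (s : Fin n) (f g : Fin n → ℤ) → (∀ j → s ≢ j → f j ≡ g j) → sum f - f s ≡ sum g - g s
sum-differ-at zero f g h =
  trans (cancel (f zero) _) (trans (sum-cong-≗ (λ j → h (suc j) λ ())) (sym (cancel (g zero) _)))
  where
  cancel : ∀ a b → a + b - a ≡ b
  cancel = solve-∀
sum-differ-at (suc s) f g h = trans (assoc (f zero) _ _)
  (trans (cong₂ _+_ (h zero λ ()) (sum-differ-at s (f ∘ suc) (g ∘ suc) λ j ne → h (suc j) (ne ∘ Fin.suc-injective)))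
    (sym (assoc (g zero) _ _)))
  where
  assoc : ∀ a b c → a + b - c ≡ a + (b - c)
  assoc = solve-∀

sum-single : ∀ {n} (s : Fin n) (f : Fin n → ℤ) → (∀ j → s ≢ j → f j ≡ 0ℤ) → sum f ≡ f s
sum-single {n} s f h = trans (split (sum f) (f s)) (trans (cong (_+ f s)
    (trans (sum-differ-at s f (λ _ → 0ℤ) h) (trans (ℤ.+-identityʳ (sum {n} λ _ → 0ℤ)) (sum-zero {n} λ _ → refl))))
        (ℤ.+-identityˡ _))
  where
  split : ∀ a b → a ≡ a - b + b
  split = solve-∀

∑< : ℕ → (ℕ → ℤ) → ℤ
∑< k f = sum {k} (f ∘ toℕ)

∑<-shift : ∀ k f → ∑< k (f ∘ suc) ≡ ∑< k f + f k - f 0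
∑<-shift zero f = sym (trans (cong (_- f 0) (ℤ.+-identityˡ (f 0))) (ℤ.+-inverseʳ (f 0)))
∑<-shift (suc k) f = trans (cong (_+_ (f 1)) (∑<-shift k (f ∘ suc))) (rearrange (f 0) (f 1) _ _)
  where
  rearrange : ∀ a b c d → b + (c + d - b) ≡ a + c + d - a
  rearrange = solve-∀

∑<-const : ∀ k c → ∑< k (λ _ → c) ≡ + k * c
∑<-const zero c = sym (ℤ.*-zeroˡ c)
∑<-const (suc k) c = trans (cong (_+_ (c)) (∑<-const k c)) (sym (ℤ.suc-* (+ k) c))

-- W acts on the n-tuples of sum-zero periodic functions below by a deformed geometric representation:
-- the entries -2 cos(π/m) of the Tits form are replaced by the pairs -(1 + p), -(1 + p⁻¹),
-- where p shifts one coordinate of the argument and satisfies 1 + p + ⋯ + p^(m-1) = 0.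
module Deformation {n : ℕ} (M : CoxeterMatrix n) where
  open Words M

  N : ℕ
  N = n ℕ.* n

  pair : Fin n → Fin n → Fin N
  pair = combine

  Point : Set
  Point = Vec ℕ N

  -- For m = ∞ no relation is required and any value ≥ 4 serves; for m = 1 the value is never used.
  modulus : Maybe ℕ → ℕ
  modulus (just (suc (suc k))) = suc (suc k)
  modulus _ = 4

  2≤modulus : ∀ e → 2 ℕ.≤ modulus e
  2≤modulus nothing = s≤s (s≤s z≤n)
  2≤modulus (just zero) = s≤s (s≤s z≤n)
  2≤modulus (just (suc zero)) = s≤s (s≤s z≤n)
  2≤modulus (just (suc (suc k))) = s≤s (s≤s z≤n)

  period : Fin N → ℕ
  period i = modulus (m (proj₁ (remQuot {n} n i)) (proj₂ (remQuot {n} n i)))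

  period-pair : ∀ a b → period (pair a b) ≡ modulus (m a b)
  period-pair a b = cong (λ z → modulus (m (proj₁ z) (proj₂ z))) (Fin.remQuot-combine {n} {n} a b)

  shift : Fin N → ℕ → Point → Point
  shift i k x = Vec.updateAt x i (k ℕ.+_)

  shift-0 : ∀ i x → shift i 0 x ≡ x
  shift-0 i x = Vec.updateAt-id i x

  shift-+ : ∀ i k l x → shift i k (shift i l x) ≡ shift i (k ℕ.+ l) x
  shift-+ i k l x =
    trans (Vec.updateAt-updateAt i x) (Vec.updateAt-cong i (λ y → sym (ℕ.+-assoc k l y)) x)

  shift-comm : ∀ i j k l x → shift i k (shift j l x) ≡ shift j l (shift i k x)
  shift-comm i j k l x with i Fin.≟ j
  ... | yes refl = trans (shift-+ i k l x) (trans (cong (λ z → shift i z x) (ℕ.+-comm k l)) (sym (shift-+ i l k x)))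
  ... | no i≢j = Vec.updateAt-commutes i j i≢j x

  -- Points have natural coordinates, so shifts only go forward. On these functions the shift by the
  -- period is the identity, and p⁻¹ becomes the shift by one less than the period.
  record Good (F : Point → ℤ) : Set where
    constructor mkGood
    field
      sum-zero-along : ∀ i x → ∑< (period i) (λ t → F (shift i t x)) ≡ 0ℤ
  open Good

  Good-periodic : ∀ {F} → Good F → ∀ i x → F (shift i (period i) x) ≡ F x
  Good-periodic {F} g i x = trans (solve-for (∑< (period i) (λ t → F (shift i t x))) (F (shift i (period i) x))
      (F (shift i 0 x))) (trans (cong₂ (λ a b → a - b + F (shift i 0 x))
      (trans (sym (∑<-shift (period i) λ t → F (shift i t x)))
        (trans (sum-cong-≗ {period i} λ t → cong F (trans (cong (λ z → shift i z x) (sym (ℕ.+-comm (toℕ t) 1)))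
            (sym (shift-+ i (toℕ t) 1 x)))) (sum-zero-along g i (shift i 1 x))))
      (sum-zero-along g i x)) (trans (ℤ.+-identityˡ _) (cong F (shift-0 i x))))
    where
    solve-for : ∀ a b c → b ≡ (a + b - c) - a + c
    solve-for = solve-∀

  Good-shift : ∀ {F} → Good F → ∀ j l → Good (F ∘ shift j l)
  Good-shift {F} g j l .sum-zero-along i x =
    trans (sum-cong-≗ {period i} λ t → cong F (shift-comm j i l (toℕ t) x)) (sum-zero-along g i (shift j l x))

  Good-+ : ∀ {F G} → Good F → Good G → Good (λ x → F x + G x)
  Good-+ f g .sum-zero-along i x =
    trans (∑-distrib-+ {period i} _ _) (cong₂ _+_ (sum-zero-along f i x) (sum-zero-along g i x))

  Good-neg : ∀ {F} → Good F → Good (λ x → - F x)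
  Good-neg f .sum-zero-along i x = trans (sum-neg {period i} _) (cong -_ (sum-zero-along f i x))

  Good-sum : ∀ {k} {F : Fin k → Point → ℤ} → (∀ j → Good (F j)) → Good (λ x → sum (λ j → F j x))
  Good-sum {F = F} g .sum-zero-along i x =
    trans (∑-comm {period i} λ t j → F j (shift i (toℕ t) x)) (sum-zero λ j → sum-zero-along (g j) i x)

  Config : Set
  Config = Fin n → Point → ℤ

  _≐_ : Config → Config → Set
  v ≐ v' = ∀ c x → v c x ≡ v' c x

  -- The product of two opposite entries is (1 + p)(1 + p⁻¹) = 2 + p + p⁻¹, the counterpart of (2
  -- cos(π/m))² = 2 + ζ + ζ⁻¹ with ζ = exp(2πi/m).
  coupling′ : ∀ s c → Tri (s Fin.< c) (s ≡ c) (c Fin.< s) → (Point → ℤ) → Point → ℤ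
  coupling′ s c (tri< _ _ _) F x = - (F x + F (shift (pair s c) 1 x))
  coupling′ s c (tri≈ _ _ _) F x = F x + F x
  coupling′ s c (tri> _ _ _) F x = - (F x + F (shift (pair c s) (ℕ.pred (period (pair c s))) x))

  coupling : ∀ s c → (Point → ℤ) → Point → ℤ
  coupling s c = coupling′ s c (Fin.<-cmp s c)

  coupling-cong : ∀ s c {F G} → (∀ x → F x ≡ G x) → ∀ x → coupling s c F x ≡ coupling s c G x
  coupling-cong s c h x with Fin.<-cmp s c
  ... | tri< _ _ _ = cong -_ (cong₂ _+_ (h _) (h _))
  ... | tri≈ _ _ _ = cong₂ _+_ (h _) (h _)
  ... | tri> _ _ _ = cong -_ (cong₂ _+_ (h _) (h _))

  coupling-Good : ∀ s c {F} → Good F → Good (coupling s c F)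
  coupling-Good s c g with Fin.<-cmp s c
  ... | tri< _ _ _ = Good-neg (Good-+ g (Good-shift g _ _))
  ... | tri≈ _ _ _ = Good-+ g g
  ... | tri> _ _ _ = Good-neg (Good-+ g (Good-shift g _ _))

  coupling-zero : ∀ s c {F} → (∀ x → F x ≡ 0ℤ) → ∀ x → coupling s c F x ≡ 0ℤ
  coupling-zero s c h x with Fin.<-cmp s c
  ... | tri< _ _ _ = cong -_ (cong₂ _+_ (h _) (h _))
  ... | tri≈ _ _ _ = cong₂ _+_ (h _) (h _)
  ... | tri> _ _ _ = cong -_ (cong₂ _+_ (h _) (h _))

  coupling-self : ∀ s F x → coupling s s F x ≡ F x + F x
  coupling-self s F x with Fin.<-cmp s s
  ... | tri< s<s _ _ = contradiction s<s (Fin.<-irrefl refl)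
  ... | tri≈ _ _ _ = refl
  ... | tri> _ _ s<s = contradiction s<s (Fin.<-irrefl refl)

  coupling-< : ∀ s c F x → s Fin.< c → coupling s c F x ≡ - (F x + F (shift (pair s c) 1 x))
  coupling-< s c F x p with Fin.<-cmp s c
  ... | tri< _ _ _ = refl
  ... | tri≈ ¬p _ _ = contradiction p ¬p
  ... | tri> ¬p _ _ = contradiction p ¬p

  coupling-> : ∀ s c F x → c Fin.< s →
    coupling s c F x ≡ - (F x + F (shift (pair c s) (ℕ.pred (period (pair c s))) x))
  coupling-> s c F x p with Fin.<-cmp s c
  ... | tri< _ _ ¬p = contradiction p ¬p
  ... | tri≈ _ _ ¬p = contradiction p ¬p
  ... | tri> _ _ _ = refl

  σ : Fin n → Config → Config
  σ s v c x with s Fin.≟ c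
  ... | yes _ = v s x - sum (λ d → coupling s d (v d) x)
  ... | no _ = v c x

  σ-same : ∀ s v x → σ s v s x ≡ v s x - sum (λ d → coupling s d (v d) x)
  σ-same s v x with s Fin.≟ s
  ... | yes _ = refl
  ... | no s≢s = contradiction refl s≢s

  σ-other : ∀ {s c} v x → s ≢ c → σ s v c x ≡ v c x
  σ-other {s} {c} v x s≢c with s Fin.≟ c
  ... | yes s≡c = contradiction s≡c s≢c
  ... | no _ = refl

  σ-cong : ∀ s {v v'} → v ≐ v' → σ s v ≐ σ s v'
  σ-cong s h c x with s Fin.≟ c
  ... | yes _ = cong₂ _-_ (h s x) (sum-cong-≗ λ d → coupling-cong s d (h d) x)
  ... | no _ = h c x

  σ-Good : ∀ s {v} → (∀ c → Good (v c)) → ∀ c → Good (σ s v c)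
  σ-Good s {v} g c .sum-zero-along i x with s Fin.≟ c
  ... | yes _ = sum-zero-along σv-Good i x
    where
    σv-Good : Good (λ x → v s x - sum (λ d → coupling s d (v d) x))
    σv-Good = Good-+ (g s) (Good-neg (Good-sum λ d → coupling-Good s d (g d)))
  ... | no _ = sum-zero-along (g c) i x

  -- The inhomogeneous term of σ s, relative to another generator r.
  rest : Fin n → Fin n → Config → Point → ℤ
  rest s r v x = sum (λ d → coupling s d (v d) x) - coupling s s (v s) x - coupling s r (v r) x

  σ-rest : ∀ s r v x → σ s v s x ≡ - v s x - coupling s r (v r) x - rest s r v x
  σ-rest s r v x = trans (σ-same s v x)
    (trans (rearrange (v s x) (sum λ d → coupling s d (v d) x) (coupling s s (v s) x) (coupling s r (v r) x))
    (trans (cong (λ z → v s x - z - coupling s r (v r) x - rest s r v x) (coupling-self s (v s) x))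
      (double (v s x) (coupling s r (v r) x) (rest s r v x))))
    where
    rearrange : ∀ a b c d → a - b ≡ a - c - d - (b - c - d)
    rearrange = solve-∀
    double : ∀ a b c → a - (a + a) - b - c ≡ - a - b - c
    double = solve-∀

  rest-σˡ : ∀ s r v x → s ≢ r → rest s r (σ s v) x ≡ rest s r v x
  rest-σˡ s r v x s≢r = cong₂ _-_
    (sum-differ-at s (λ d → coupling s d (σ s v d) x) (λ d → coupling s d (v d) x) λ j s≢j → coupling-cong s j
        (λ y → σ-other v y s≢j) x)
    (coupling-cong s r (λ y → σ-other v y s≢r) x)

  rest-σʳ : ∀ s r v x → s ≢ r → rest s r (σ r v) x ≡ rest s r v x
  rest-σʳ s r v x s≢r = trans (swap (sum (f (σ r v))) _ (f (σ r v) r)) (trans (cong₂ _-_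
      (sum-differ-at r (f (σ r v)) (f v) λ j r≢j → coupling-cong s j (λ y → σ-other v y r≢j) x)
      (coupling-cong s s (λ y → σ-other v y (s≢r ∘ sym)) x)) (swap (sum (f v)) (f v r) _))
    where
    f : Config → Fin n → ℤ
    f v d = coupling s d (v d) x
    swap : ∀ a b c → a - b - c ≡ a - c - b
    swap = solve-∀

  σ-involutive : ∀ s v → σ s (σ s v) ≐ v
  σ-involutive s v c x with s Fin.≟ c
  ... | no s≢c = σ-other v x s≢c
  ... | yes refl = trans (cong₂ _-_ (σ-same s v x) new) (cancel (v s x) T)
    where
    T = sum (λ d → coupling s d (v d) x)
    T' = sum (λ d → coupling s d (σ s v d) x)
    solve-for : ∀ a b c d → a - b ≡ c - d → a ≡ c - d + b
    solve-for a b c d e = trans (split a b) (cong (_+ b) e)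
      where
      split : ∀ a b → a ≡ a - b + b
      split = solve-∀
    simplify : ∀ t u → t - (u + u) + ((u - t) + (u - t)) ≡ - t
    simplify = solve-∀
    cancel : ∀ u t → (u - t) - - t ≡ u
    cancel = solve-∀
    new : T' ≡ - T
    new = trans (solve-for T' _ T _
        (sum-differ-at s (λ d → coupling s d (σ s v d) x) _ λ j s≢j → coupling-cong s j (λ y → σ-other v y s≢j) x))
      (trans (cong₂ (λ a b → T - a + b) (coupling-self s (v s) x)
        (trans (coupling-self s (σ s v s) x) (cong₂ _+_ (σ-same s v x) (σ-same s v x)))) (simplify T (v s x)))

  module Braid {s r : Fin n} (s<r : s Fin.< r) where
    private
      s≢r : s ≢ r
      s≢r refl = Fin.<-irrefl refl s<r
      i = pair s r

    p q : Point → Point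
    p = shift i 1
    q = shift i (ℕ.pred (period i))

    iterate : ℕ → Config → Config
    iterate zero v = v
    iterate (suc j) v = σ s (σ r (iterate j v))

    iterate-Good : ∀ j {v} → (∀ c → Good (v c)) → ∀ c → Good (iterate j v c)
    iterate-Good zero g = g
    iterate-Good (suc j) g = σ-Good s (σ-Good r (iterate-Good j g))

    iterate-other : ∀ j v {c} x → s ≢ c → r ≢ c → iterate j v c x ≡ v c x
    iterate-other zero v x _ _ = refl
    iterate-other (suc j) v x s≢c r≢c =
      trans (σ-other _ x s≢c) (trans (σ-other _ x r≢c) (iterate-other j v x s≢c r≢c))

    qp : ∀ {F} → Good F → ∀ x → F (q (p x)) ≡ F x
    qp {F} g x = trans (cong F (trans (shift-+ i _ 1 x) (cong (λ k → shift i k x) (trans (ℕ.+-comm _ 1) suc-pred))))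
        (Good-periodic g i x)
      where
      suc-pred : suc (ℕ.pred (period i)) ≡ period i
      suc-pred with period i | period-pair s r | 2≤modulus (m s r)
      ... | suc k | _ | _ = refl
      ... | zero | e | 2≤ = contradiction (subst (2 ℕ.≤_) (sym e) 2≤) λ ()

    module Orbit (v : Config) (good : ∀ c → Good (v c)) where
      X Y : Point → ℤ
      X x = - rest s r v x
      Y x = - rest r s v x

      ξ η : ℕ → Point → ℤ
      ξ j = iterate j v s
      η j = iterate j v r

      rest-iterateˡ : ∀ j x → rest s r (iterate j v) x ≡ rest s r v x
      rest-iterateˡ zero x = refl
      rest-iterateˡ (suc j) x =
        trans (rest-σˡ s r _ x s≢r) (trans (rest-σʳ s r _ x s≢r) (rest-iterateˡ j x))

      rest-iterateʳ : ∀ j x → rest r s (iterate j v) x ≡ rest r s v x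
      rest-iterateʳ zero x = refl
      rest-iterateʳ (suc j) x =
        trans (rest-σʳ r s _ x (s≢r ∘ sym)) (trans (rest-σˡ r s _ x (s≢r ∘ sym)) (rest-iterateʳ j x))

      η-step : ∀ j x → η (suc j) x ≡ - η j x + (ξ j x + ξ j (q x)) + Y x
      η-step j x = trans (σ-other _ x s≢r) (trans (σ-rest r s (iterate j v) x)
        (cong₂ (λ a b → - η j x + a - b) (trans (cong -_ (coupling-> r s (ξ j) x s<r)) (ℤ.neg-involutive _))
            (rest-iterateʳ j x)))

      ξ-step : ∀ j x → ξ (suc j) x ≡ - ξ j x + (η (suc j) x + η (suc j) (p x)) + X x
      ξ-step j x = trans (σ-rest s r (σ r (iterate j v)) x)
        (cong₂ _-_ (cong₂ (λ a b → - a + b) (σ-other _ x (s≢r ∘ sym))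
            (trans (cong -_ (trans (coupling-< s r _ x s<r)
                (cong -_ (cong₂ _+_ (sym (σ-other _ x s≢r)) (sym (σ-other _ (p x) s≢r))))))
              (ℤ.neg-involutive _)))
          (trans (rest-σʳ s r _ x s≢r) (rest-iterateˡ j x)))

      -- ξ - p η and η - ξ are eigenvectors of the product of the two reflections, up to constants.
      Z E : Point → ℤ
      Z x = X x + Y x
      E x = X x + Y (p x)

      -- The eigenvalue is p⁻¹ here and p in `eigen₂`, where p F stands for F ∘ p.
      eigen₁ : ∀ j x → ξ (suc j) (p x) - η (suc j) (p (p x)) ≡ ξ j x - η j (p x) + Z (p x)
      eigen₁ j x = trans (cong (_- η (suc j) (p (p x))) (ξ-step j (p x)))
        (trans (cancel (ξ j (p x)) (η (suc j) (p x)) (η (suc j) (p (p x))) (X (p x)))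
            (trans (cong (λ z → - ξ j (p x) + z + X (p x)) (η-step j (p x)))
          (trans (collect (ξ j (p x)) (η j (p x)) (ξ j (q (p x))) (X (p x)) (Y (p x)))
            (cong (λ z → z - η j (p x) + Z (p x)) (qp (iterate-Good j good s) x)))))
        where
        cancel : ∀ a b c d → - a + (b + c) + d - c ≡ - a + b + d
        cancel = solve-∀
        collect : ∀ a b c d e → - a + (- b + (a + c) + e) + d ≡ c - b + (d + e)
        collect = solve-∀

      eigen₂ : ∀ j x → η (suc j) x - ξ (suc j) x ≡ η j (p x) - ξ j (p x) - E x
      eigen₂ j x = trans (cong (_-_ (η (suc j) x)) (ξ-step j x))
        (trans (cancel (ξ j x) (η (suc j) x) (η (suc j) (p x)) (X x)) (trans (cong (λ z → ξ j x - z - X x) (η-step j (p x)))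
          (trans (cong (λ z → ξ j x - (- η j (p x) + (ξ j (p x) + z) + Y (p x)) - X x) (qp (iterate-Good j good s) x))
            (collect (ξ j x) (η j (p x)) (ξ j (p x)) (X x) (Y (p x))))))
        where
        cancel : ∀ a b c d → b - (- a + (b + c) + d) ≡ a - c - d
        cancel = solve-∀
        collect : ∀ a b c d e → a - (- b + (c + a) + e) - d ≡ b - c - (d + e)
        collect = solve-∀

      p^ : ℕ → Point → Point
      p^ = shift i

      p-p^ : ∀ j x → p^ j (p x) ≡ p^ (suc j) x
      p-p^ j x = trans (shift-+ i j 1 x) (cong (λ k → p^ k x) (ℕ.+-comm j 1))

      p^-p : ∀ j x → p (p^ j x) ≡ p^ (suc j) x
      p^-p j x = shift-+ i 1 j x

      orbit₁ : ∀ j x → ξ j (p^ j x) - η j (p (p^ j x)) ≡ ξ 0 x - η 0 (p x) + ∑< j (λ t → Z (p^ (suc t) x))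
      orbit₁ zero x = trans (cong (λ y → ξ 0 y - η 0 (p y)) (shift-0 i x)) (sym (ℤ.+-identityʳ _))
      orbit₁ (suc j) x = trans (cong (λ y → ξ (suc j) y - η (suc j) (p y)) (sym (p^-p j x)))
        (trans (eigen₁ j (p^ j x)) (trans (cong₂ _+_ (orbit₁ j x) (cong Z (p^-p j x)))
          (trans (ℤ.+-assoc (ξ 0 x - η 0 (p x)) _ _) (cong (_+_ (ξ 0 x - η 0 (p x))) (snoc j (λ t → Z (p^ (suc t) x)))))))
        where
        snoc : ∀ k f → ∑< k f + f k ≡ ∑< (suc k) f
        snoc k f = trans (solve-for (∑< k f) (f k) (f 0)) (trans (cong (_+_ (f 0)) (sym (∑<-shift k f))) refl)
          where
          solve-for : ∀ a b c → a + b ≡ c + (a + b - c)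
          solve-for = solve-∀

      orbit₂ : ∀ j x → η j x - ξ j x ≡ η 0 (p^ j x) - ξ 0 (p^ j x) - ∑< j (λ t → E (p^ t x))
      orbit₂ zero x = trans (cong (λ y → η 0 y - ξ 0 y) (sym (shift-0 i x))) (sym (ℤ.+-identityʳ _))
      orbit₂ (suc j) x = trans (eigen₂ j x) (trans (cong (_- E x) (orbit₂ j (p x)))
        (trans (cong₂ (λ y z → η 0 y - ξ 0 y - z - E x) (p-p^ j x) (sum-cong-≗ {j} λ t → cong E (p-p^ (toℕ t) x)))
          (trans (collect (η 0 (p^ (suc j) x) - ξ 0 (p^ (suc j) x)) (∑< j (λ t → E (p^ (suc t) x))) (E x))
              (cong (λ y → η 0 (p^ (suc j) x) - ξ 0 (p^ (suc j) x) - (E y + ∑< j (λ t → E (p^ (suc t) x))))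
              (sym (shift-0 i x))))))
        where
        collect : ∀ a b c → a - b - c ≡ a - (c + b)
        collect = solve-∀

      X-Good : Good X
      X-Good = Good-neg (Good-+ (Good-+ (Good-sum λ d → coupling-Good s d (good d)) (Good-neg (coupling-Good s s (good s))))
        (Good-neg (coupling-Good s r (good r))))

      Y-Good : Good Y
      Y-Good = Good-neg (Good-+ (Good-+ (Good-sum λ d → coupling-Good r d (good d)) (Good-neg (coupling-Good r r (good r))))
        (Good-neg (coupling-Good r s (good s))))

      k = period i

      G : Point → ℤ
      G x = η k x - η 0 x

      G-Good : Good G
      G-Good = Good-+ (iterate-Good k good r) (Good-neg (good r))

      -- After k steps the eigenvalues have become p^(-k) = p^k = 1, and the constants have been
      -- summed over a full period, so that they vanish. Each eigenvector therefore returns, and the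
      -- two of them express ξ k - ξ 0 once as G ∘ p and once as G.
      ξ-return₁ : ∀ x → ξ k x - ξ 0 x ≡ G (p x)
      ξ-return₁ x = solve-for (ξ k x) (η k (p x)) (ξ 0 x) (η 0 (p x))
          (trans (cong₂ _-_ (sym (Good-periodic (iterate-Good k good s) i x))
          (sym (trans (cong (η k) (trans (p^-p k x) (sym (p-p^ k x)))) (Good-periodic (iterate-Good k good r) i (p x)))))
        (trans (orbit₁ k x) (trans (cong (_+_ (ξ 0 x - η 0 (p x))) sum≡0) (ℤ.+-identityʳ _))))
        where
        sum≡0 : ∑< k (λ t → Z (p^ (suc t) x)) ≡ 0ℤ
        sum≡0 = trans (sum-cong-≗ {k} λ t → cong Z (sym (p-p^ (toℕ t) x))) (sum-zero-along (Good-+ X-Good Y-Good) i (p x))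
        solve-for : ∀ a b c d → a - b ≡ c - d → a - c ≡ b - d
        solve-for a b c d e = trans (split a b c) (trans (cong (_+ (b - c)) e) (unsplit b c d))
          where
          split : ∀ a b c → a - c ≡ a - b + (b - c)
          split = solve-∀
          unsplit : ∀ b c d → c - d + (b - c) ≡ b - d
          unsplit = solve-∀

      ξ-return₂ : ∀ x → ξ k x - ξ 0 x ≡ G x
      ξ-return₂ x = solve-for (η k x) (ξ k x) (η 0 x) (ξ 0 x)
          (trans (orbit₂ k x) (trans (cong₂ _-_ (cong₂ _-_ (Good-periodic (good r) i x) (Good-periodic (good s) i x)) sum≡0)
          (ℤ.+-identityʳ _)))
        where
        sum≡0 : ∑< k (λ t → E (p^ t x)) ≡ 0ℤ
        sum≡0 = sum-zero-along (Good-+ X-Good (Good-shift Y-Good i 1)) i x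
        solve-for : ∀ a b c d → a - b ≡ c - d → b - d ≡ a - c
        solve-for a b c d e = trans (split a b d) (trans (cong (λ z → a - z - d) e) (unsplit a c d))
          where
          split : ∀ a b d → b - d ≡ a - (a - b) - d
          split = solve-∀
          unsplit : ∀ a c d → a - (c - d) - d ≡ a - c
          unsplit = solve-∀

      -- G is p-invariant, hence killed by k = 1 + p + ⋯ + p^(k-1).
      G≡0 : ∀ x → G x ≡ 0ℤ
      G≡0 x = [ (λ k≡0 → contradiction (trans (sym (period-pair s r)) (ℤ.+-injective k≡0)) nonzero) , id ]′
        (ℤ.i*j≡0⇒i≡0∨j≡0 (+ k) (trans (sym (∑<-const k (G x)))
          (trans (sum-cong-≗ {k} λ t → invariant (toℕ t)) (sum-zero-along G-Good i x))))
        where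
        nonzero : modulus (m s r) ≢ 0
        nonzero e with modulus (m s r) | 2≤modulus (m s r)
        nonzero refl | _ | ()
        invariant : ∀ t → G x ≡ G (p^ t x)
        invariant zero = cong G (sym (shift-0 i x))
        invariant (suc t) = trans (invariant t) (trans (sym (ξ-return₂ _)) (trans (ξ-return₁ _) (cong G (p^-p t x))))

      iterate-period : iterate k v ≐ v
      iterate-period c x with s Fin.≟ c | r Fin.≟ c
      ... | yes refl | _ = ℤ.i-j≡0⇒i≡j _ _ (trans (ξ-return₂ x) (G≡0 x))
      ... | no _ | yes refl = ℤ.i-j≡0⇒i≡j _ _ (G≡0 x)
      ... | no s≢c | no r≢c = iterate-other k v x s≢c r≢c

-- Periodic functions that detect shifts

bump : ℕ → ℕ → ℤ
bump m k with m ∣? k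
... | yes _ = 1ℤ
... | no _ = 0ℤ

bump-nonneg : ∀ m k → 0ℤ ≤ bump m k
bump-nonneg m k with m ∣? k
... | yes _ = +≤+ z≤n
... | no _ = +≤+ z≤n

bump-yes : ∀ {m k} → m ∣ k → bump m k ≡ 1ℤ
bump-yes {m} {k} d with m ∣? k
... | yes _ = refl
... | no ¬d = contradiction d ¬d

bump-no : ∀ {m k} → 0 ℕ.< k → k ℕ.< m → bump m k ≡ 0ℤ
bump-no {m} {suc k} _ k<m with m ∣? suc k
... | yes d = contradiction (∣⇒≤ d) (ℕ.<⇒≱ k<m)
... | no _ = refl

bump-periodic : ∀ m k → bump m (m ℕ.+ k) ≡ bump m k
bump-periodic m k with m ∣? k
... | yes d = bump-yes (∣m∣n⇒∣m+n ∣-refl d)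
... | no ¬d with m ∣? (m ℕ.+ k)
...   | yes d = contradiction (∣m+n∣m⇒∣n d ∣-refl) ¬d
...   | no _ = refl

-- For m ≥ 2 it is 1 at the multiples of m, -1 just before them and 0 elsewhere. It sums to zero
-- over a period and yet separates 0 from all k with 0 < k < m.
wave : ℕ → ℕ → ℤ
wave m k = bump m k - bump m (suc k)

wave-sum : ∀ m k → ∑< m (λ t → wave m (t ℕ.+ k)) ≡ 0ℤ
wave-sum m k = trans (sum-- {m} (λ t → b (toℕ t)) (λ t → b (suc (toℕ t))))
  (trans (cong (_-_ (∑< m b)) (∑<-shift m b))
    (trans (cancel (∑< m b) (b m) (b 0)) (trans (cong (_-_ (b 0)) (bump-periodic m k)) (ℤ.+-inverseʳ (b 0)))))
  where
  b : ℕ → ℤ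
  b t = bump m (t ℕ.+ k)
  cancel : ∀ a b c → a - (a + b - c) ≡ c - b
  cancel = solve-∀

wave-0 : ∀ {m} → 2 ℕ.≤ m → wave m 0 ≡ 1ℤ
wave-0 {m} 2≤m = cong₂ _-_ (bump-yes {m} {0} (divides 0 refl)) (bump-no {m} {1} (s≤s z≤n) 2≤m)

wave-≢1 : ∀ {m k} → 0 ℕ.< k → k ℕ.< m → wave m k ≢ 1ℤ
wave-≢1 {m} {k} 0<k k<m e with bump m (suc k) | bump-nonneg m (suc k) | trans
    (sym (cong (_- bump m (suc k)) (bump-no 0<k k<m))) e
... | + zero | _ | ()
... | + suc _ | _ | ()

-- A product over the coordinates, so that the sum over a period vanishes along each of them
-- separately.
waves : ∀ {l} → (Fin l → ℕ) → Vec ℕ l → ℤ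
waves μ Vec.[] = 1ℤ
waves μ (k Vec.∷ x) = wave (μ zero) k * waves (μ ∘ suc) x

waves-sum : ∀ {l} (μ : Fin l → ℕ) i x → ∑< (μ i) (λ t → waves μ (Vec.updateAt x i (t ℕ.+_))) ≡ 0ℤ
waves-sum μ zero (k Vec.∷ x) = begin
  ∑< (μ zero) (λ t → wave (μ zero) (t ℕ.+ k) * waves (μ ∘ suc) x)
    ≡⟨ *-distribʳ-sum {μ zero} (waves (μ ∘ suc) x) (λ t → wave (μ zero) (toℕ t ℕ.+ k)) ⟨
  ∑< (μ zero) (λ t → wave (μ zero) (t ℕ.+ k)) * waves (μ ∘ suc) x
    ≡⟨ cong (_* waves (μ ∘ suc) x) (wave-sum (μ zero) k) ⟩
  0ℤ ∎
  where open ≡-Reasoning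
waves-sum μ (suc i) (k Vec.∷ x) = begin
  ∑< (μ (suc i)) (λ t → wave (μ zero) k * waves (μ ∘ suc) (Vec.updateAt x i (t ℕ.+_)))
    ≡⟨ *-distribˡ-sum {μ (suc i)} (wave (μ zero) k) (λ t → waves (μ ∘ suc) (Vec.updateAt x i (toℕ t ℕ.+_))) ⟨
  wave (μ zero) k * ∑< (μ (suc i)) (λ t → waves (μ ∘ suc) (Vec.updateAt x i (t ℕ.+_)))
    ≡⟨ cong (_*_ (wave (μ zero) k)) (waves-sum (μ ∘ suc) i x) ⟩
  wave (μ zero) k * 0ℤ
    ≡⟨ ℤ.*-zeroʳ (wave (μ zero) k) ⟩
  0ℤ ∎
  where open ≡-Reasoning

waves-0 : ∀ {l} (μ : Fin l → ℕ) → (∀ i → 2 ℕ.≤ μ i) → waves μ (Vec.replicate l 0) ≡ 1ℤ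
waves-0 {zero} μ h = refl
waves-0 {suc l} μ h = cong₂ _*_ (wave-0 (h zero)) (waves-0 (μ ∘ suc) (h ∘ suc))

waves-updateAt : ∀ {l} (μ : Fin l → ℕ) → (∀ i → 2 ℕ.≤ μ i) → ∀ i k →
  waves μ (Vec.updateAt (Vec.replicate l 0) i (k ℕ.+_)) ≡ wave (μ i) k
waves-updateAt μ h zero k = trans (cong₂ _*_ (cong (wave (μ zero)) (ℕ.+-identityʳ k)) (waves-0 (μ ∘ suc) (h ∘ suc)))
  (ℤ.*-identityʳ (wave (μ zero) k))
waves-updateAt μ h (suc i) k = trans (cong₂ _*_ (wave-0 (h zero)) (waves-updateAt (μ ∘ suc) (h ∘ suc) i k))
  (ℤ.*-identityˡ (wave (μ (suc i)) k))

module Order {n : ℕ} (M : CoxeterMatrix n) where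
  open Words M
  open Deformation M

  acts : Word → Config → Config
  acts w v = List.foldr σ v w

  AllGood : Config → Set
  AllGood v = ∀ c → Good (v c)

  acts-Good : ∀ w {v} → AllGood v → AllGood (acts w v)
  acts-Good [] g = g
  acts-Good (s ∷ w) g = σ-Good s (acts-Good w g)

  acts-cong : ∀ w {v v'} → v ≐ v' → acts w v ≐ acts w v'
  acts-cong [] h = h
  acts-cong (s ∷ w) h = σ-cong s (acts-cong w h)

  acts-++ : ∀ u w v c x → acts (u ++ w) v c x ≡ acts u (acts w v) c x
  acts-++ u w v c x = cong (λ f → f c x) (List.foldr-++ σ v u w)

  alt-∷ʳ : ∀ s r k → s ∷ alt r s k ≡ alt s r k ++ s ∷ []
  alt-∷ʳ s r zero = refl
  alt-∷ʳ s r (suc k) = cong (λ w → s ∷ r ∷ w) (alt-∷ʳ s r k)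

  iterate-acts : ∀ {s r} (s<r : s Fin.< r) j v → Braid.iterate s<r j v ≡ acts (alt s r j) v
  iterate-acts s<r zero v = refl
  iterate-acts {s} {r} s<r (suc j) v = cong (σ s ∘ σ r) (iterate-acts s<r j v)

  alt-acts-< : ∀ {s r} k → s Fin.< r → m s r ≡ just k → ∀ {v} → AllGood v → acts (alt s r k) v ≐ v
  alt-acts-< {s} {r} k s<r e {v} g c x =
    trans (cong (λ f → f c x) (trans (sym (iterate-acts s<r k v)) (cong (λ j → Braid.iterate s<r j v) (sym period≡k))))
      (Braid.Orbit.iterate-period s<r v g c x)
    where
    modulus-just : ∀ k → 2 ℕ.≤ k → modulus (just k) ≡ k
    modulus-just (suc (suc k)) _ = refl
    modulus-just (suc zero) (s≤s ())
    period≡k : period (pair s r) ≡ k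
    period≡k = trans (period-pair s r) (trans (cong modulus e)
      (modulus-just k (offd s r (λ s≡r → Fin.<-irrefl s≡r s<r) k e)))

  alt-acts : ∀ s r k → m s r ≡ just k → ∀ {v} → AllGood v → acts (alt s r k) v ≐ v
  alt-acts s r k e {v} g c x with Fin.<-cmp s r
  ... | tri< s<r _ _ = alt-acts-< k s<r e g c x
  ... | tri≈ _ refl _ with refl ← trans (sym e) (diag s) = σ-involutive s v c x
  -- The case r < s is reduced to the other one by (s r)^k = s (r s)^k s.
  ... | tri> _ _ r<s = begin
    acts (alt s r k) v c x                    ≡⟨ acts-cong (alt s r k) (σ-involutive s v) c x ⟨
    acts (alt s r k) (σ s (σ s v)) c x        ≡⟨ acts-++ (alt s r k) (s ∷ []) (σ s v) c x ⟨
    acts (alt s r k ++ s ∷ []) (σ s v) c x    ≡⟨ cong (λ w → acts w (σ s v) c x) (alt-∷ʳ s r k) ⟨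
    σ s (acts (alt r s k) (σ s v)) c x        ≡⟨ σ-cong s (alt-acts-< k r<s (trans (symm r s) e) (σ-Good s g)) c x ⟩
    σ s (σ s v) c x                           ≡⟨ σ-involutive s v c x ⟩
    v c x                                     ∎
    where open ≡-Reasoning

  acts-respects-~ : ∀ {w w'} → w ~ w' → ∀ {v} → AllGood v → acts w v ≐ acts w' v
  acts-respects-~ ~refl g c x = refl
  acts-respects-~ (~sym p) g c x = sym (acts-respects-~ p g c x)
  acts-respects-~ (~trans p q) g c x = trans (acts-respects-~ p g c x) (acts-respects-~ q g c x)
  acts-respects-~ (~rel u w s r k e) {v} g c x = begin
    acts (u ++ alt s r k ++ w) v c x            ≡⟨ acts-++ u _ v c x ⟩
    acts u (acts (alt s r k ++ w) v) c x        ≡⟨ acts-cong u (acts-++ (alt s r k) w v) c x ⟩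
    acts u (acts (alt s r k) (acts w v)) c x    ≡⟨ acts-cong u (alt-acts s r k e (acts-Good w g)) c x ⟩
    acts u (acts w v) c x                       ≡⟨ acts-++ u w v c x ⟨
    acts (u ++ w) v c x                         ∎
    where open ≡-Reasoning

  F₀ : Point → ℤ
  F₀ = waves period

  F₀-Good : Good F₀
  F₀-Good = mkGood (waves-sum period)

  supported-at : Fin n → Config
  supported-at s c x with s Fin.≟ c
  ... | yes _ = F₀ x
  ... | no _ = 0ℤ

  supported-same : ∀ s x → supported-at s s x ≡ F₀ x
  supported-same s x with s Fin.≟ s
  ... | yes _ = refl
  ... | no s≢s = contradiction refl s≢s

  supported-other : ∀ {s c} x → s ≢ c → supported-at s c x ≡ 0ℤ
  supported-other {s} {c} x s≢c with s Fin.≟ c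
  ... | yes s≡c = contradiction s≡c s≢c
  ... | no _ = refl

  supported-Good : ∀ s → AllGood (supported-at s)
  supported-Good s c with s Fin.≟ c
  ... | yes _ = F₀-Good
  ... | no _ = mkGood λ i x → sum-zero {period i} λ _ → refl

  -- (s r)^j is applied to the configuration that is `F₀` at s and zero elsewhere. Its inhomogeneous
  -- terms vanish, so by `orbit₁` the eigenvector ξ - pη is merely shifted j times, and the value of
  -- `F₀` at the origin notices this.
  order-< : ∀ {s r} j → s Fin.< r → 0 ℕ.< j → j ℕ.< modulus (m s r) → ¬ alt s r j ~ []
  order-< {s} {r} j s<r 0<j j<m p =
    wave-≢1 0<j (subst (j ℕ.<_) (sym (period-pair s r)) j<m)
      (trans (sym (waves-updateAt period 2≤period i j)) (trans fixed (waves-0 period 2≤period)))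
    where
    i = pair s r
    v = supported-at s
    s≢r : s ≢ r
    s≢r s≡r = Fin.<-irrefl s≡r s<r
    open Braid.Orbit s<r v (supported-Good s)
    2≤period : ∀ i → 2 ℕ.≤ period i
    2≤period i = 2≤modulus _
    x₀ : Point
    x₀ = Vec.replicate N 0
    stays : ∀ c x → Braid.iterate s<r j v c x ≡ v c x
    stays c x = trans (cong (λ f → f c x) (iterate-acts s<r j v)) (acts-respects-~ p (supported-Good s) c x)
    coupling-sum : ∀ a x → sum (λ d → coupling a d (v d) x) ≡ coupling a s (v s) x
    coupling-sum a x = sum-single s _ λ d s≢d → coupling-zero a d (λ y → supported-other y s≢d) x
    X≡0 : ∀ x → X x ≡ 0ℤ
    X≡0 x = cong -_ (trans (cong₂ (λ a b → a - coupling s s (v s) x - b) (coupling-sum s x)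
      (coupling-zero s r (λ y → supported-other y s≢r) x)) (vanish (coupling s s (v s) x)))
      where
      vanish : ∀ a → a - a - 0ℤ ≡ 0ℤ
      vanish = solve-∀
    Y≡0 : ∀ x → Y x ≡ 0ℤ
    Y≡0 x = cong -_ (trans (cong₂ (λ a b → a - b - coupling r s (v s) x) (coupling-sum r x)
      (coupling-zero r r (λ y → supported-other y s≢r) x)) (vanish (coupling r s (v s) x)))
      where
      vanish : ∀ a → a - 0ℤ - a ≡ 0ℤ
      vanish = solve-∀
    fixed : F₀ (shift i j x₀) ≡ F₀ x₀
    fixed = begin
      F₀ (p^ j x₀)                                      ≡⟨ supported-same s _ ⟨
      v s (p^ j x₀)                                     ≡⟨ ℤ.+-identityʳ _ ⟨
      v s (p^ j x₀) - 0ℤ                                ≡⟨ cong₂ _-_ (stays s _)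
          (trans (stays r _) (supported-other _ s≢r)) ⟨
      ξ j (p^ j x₀) - η j (shift i 1 (p^ j x₀))         ≡⟨ orbit₁ j x₀ ⟩
      ξ 0 x₀ - η 0 (shift i 1 x₀) + ∑< j (λ t → Z (p^ (suc t) x₀))
        ≡⟨ cong₂ _+_ (cong₂ _-_ (supported-same s x₀) (supported-other _ s≢r))
             (sum-zero {j} λ t → cong₂ _+_ (X≡0 _) (Y≡0 _)) ⟩
      F₀ x₀ - 0ℤ + 0ℤ                                   ≡⟨ trans (ℤ.+-identityʳ _) (ℤ.+-identityʳ _) ⟩
      F₀ x₀                                             ∎
      where open ≡-Reasoning

  order : ∀ {s r} j → s ≢ r → 0 ℕ.< j → j ℕ.< modulus (m s r) → ¬ alt s r j ~ []
  order {s} {r} j s≢r 0<j j<m p with Fin.<-cmp s r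
  ... | tri< s<r _ _ = order-< j s<r 0<j j<m p
  ... | tri≈ _ s≡r _ = s≢r s≡r
  ... | tri> _ _ r<s = order-< j r<s 0<j (subst (λ e → j ℕ.< modulus e) (symm s r) j<m)
    (∙-cancelʳ (r ∷ []) (alt r s j) [] (~trans (~reflexive (sym (alt-∷ʳ r s j))) (++-congˡ (r ∷ []) p)))

  order⇒¬GLP : ∀ {s r} → s ≢ r → 4 ℕ.≤ modulus (m s r) → ¬ AllIntervalsGLP
  order⇒¬GLP {s} {r} s≢r 4≤ = LargeOrder.no-GLP M s r
    (order 1 s≢r (s≤s z≤n) (ℕ.≤-trans (s≤s (s≤s z≤n)) 4≤))
    (order 2 s≢r (s≤s z≤n) (ℕ.≤-trans (s≤s (s≤s (s≤s z≤n))) 4≤))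
    (order 3 s≢r (s≤s z≤n) 4≤)

  GLP⇒SimplyLaced : AllIntervalsGLP → SimplyLaced
  GLP⇒SimplyLaced glp s r = decide (m s r) refl
    where
    distinct : ∀ {e} → m s r ≡ e → e ≢ just 1 → s ≢ r
    distinct e ne refl = ne (trans (sym e) (diag s))
    decide : ∀ e → m s r ≡ e → ∃[ k ] (e ≡ just k × k ℕ.≤ 3)
    -- The value 4 chosen for m = ∞ just covers the exponents 1, 2, 3 that are needed.
    decide nothing e = contradiction glp (order⇒¬GLP (distinct e λ ()) (subst (λ e → 4 ℕ.≤ modulus e) (sym e) ℕ.≤-refl))
    decide (just 0) e = 0 , refl , z≤n
    decide (just 1) e = 1 , refl , s≤s z≤n
    decide (just 2) e = 2 , refl , s≤s (s≤s z≤n)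
    decide (just 3) e = 3 , refl , s≤s (s≤s (s≤s z≤n))
    decide (just (suc (suc (suc (suc k))))) e =
      contradiction glp (order⇒¬GLP (distinct e λ ()) (subst (λ e → 4 ℕ.≤ modulus e) (sym e) (s≤s (s≤s (s≤s (s≤s z≤n))))))

-- Roots and lengths in the simply-laced case

Vector : ℕ → Set
Vector n = Fin n → ℤ

axpy : ∀ {n} → Vector n → ℤ → Vector n → Vector n
axpy x c y j = x j + c * y j

unit : ∀ {n} → Fin n → Vector n
unit s j with s Fin.≟ j
... | yes _ = 1ℤ
... | no _ = 0ℤ

unit-same : ∀ {n} (s : Fin n) → unit s s ≡ 1ℤ
unit-same s with s Fin.≟ s
... | yes _ = refl
... | no s≢s = contradiction refl s≢s

unit-other : ∀ {n} {s j : Fin n} → s ≢ j → unit s j ≡ 0ℤ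
unit-other {s = s} {j} s≢j with s Fin.≟ j
... | yes s≡j = contradiction s≡j s≢j
... | no _ = refl

sum-unit : ∀ {n} (f : Fin n → ℤ) s → sum (λ j → f j * unit s j) ≡ f s
sum-unit f s = trans (sum-single s _ λ j s≢j → trans (cong (_*_ (f j)) (unit-other s≢j)) (ℤ.*-zeroʳ (f j)))
  (trans (cong (_*_ (f s)) (unit-same s)) (ℤ.*-identityʳ (f s)))

sum-axpy : ∀ {n} (f g : Fin n → ℤ) c → sum (λ j → f j + c * g j) ≡ sum f + c * sum g
sum-axpy f g c = trans (∑-distrib-+ f (λ j → c * g j)) (cong (_+_ (sum f)) (sym (*-distribˡ-sum c g)))

ht : ∀ {n} → Vector n → ℤ
ht x = sum x

module Form {n : ℕ} (B : Fin n → Fin n → ℤ) (B-sym : ∀ i j → B i j ≡ B j i) where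

  pair : Vector n → Fin n → ℤ
  pair x s = sum (λ j → B s j * x j)

  pair-cong : ∀ {x y} → x ≗ y → ∀ s → pair x s ≡ pair y s
  pair-cong h s = sum-cong-≗ λ j → cong (_*_ (B s j)) (h j)

  pair-axpy : ∀ x c y s → pair (axpy x c y) s ≡ pair x s + c * pair y s
  pair-axpy x c y s = trans (sum-cong-≗ λ j → distribute (B s j) (x j) c (y j))
      (sum-axpy (λ j → B s j * x j) (λ j → B s j * y j) c)
    where
    distribute : ∀ b x c y → b * (x + c * y) ≡ b * x + c * (b * y)
    distribute = solve-∀

  pair-unit : ∀ r s → pair (unit r) s ≡ B s r
  pair-unit r s = sum-unit (B s) r

  form : Vector n → Vector n → ℤ
  form x y = sum (λ i → x i * pair y i)

  form-cong : ∀ {x x' y y'} → x ≗ x' → y ≗ y' → form x y ≡ form x' y'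
  form-cong h k = sum-cong-≗ λ i → cong₂ _*_ (h i) (pair-cong k i)

  form-sym : ∀ x y → form x y ≡ form y x
  form-sym x y = begin
    sum (λ i → x i * sum (λ j → B i j * y j))
      ≡⟨ sum-cong-≗ (λ i → *-distribˡ-sum (x i) (λ j → B i j * y j)) ⟩
    sum (λ i → sum (λ j → x i * (B i j * y j)))
      ≡⟨ ∑-comm (λ i j → x i * (B i j * y j)) ⟩
    sum (λ j → sum (λ i → x i * (B i j * y j)))
      ≡⟨ sum-cong-≗ (λ j → sum-cong-≗ λ i → trans (cong (λ b → x i * (b * y j)) (B-sym i j)) (swap (x i) (B j i) (y j))) ⟩
    sum (λ j → sum (λ i → y j * (B j i * x i)))
      ≡⟨ sum-cong-≗ (λ j → *-distribˡ-sum (y j) (λ i → B j i * x i)) ⟨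
    sum (λ j → y j * sum (λ i → B j i * x i)) ∎
    where
    open ≡-Reasoning
    swap : ∀ a b c → a * (b * c) ≡ c * (b * a)
    swap = solve-∀

  form-axpyˡ : ∀ x c y z → form (axpy x c y) z ≡ form x z + c * form y z
  form-axpyˡ x c y z = trans (sum-cong-≗ λ i → distribute (pair z i) (x i) c (y i))
      (sum-axpy (λ i → x i * pair z i) (λ i → y i * pair z i) c)
    where
    distribute : ∀ b x c y → (x + c * y) * b ≡ x * b + c * (y * b)
    distribute = solve-∀

  form-axpyʳ : ∀ z x c y → form z (axpy x c y) ≡ form z x + c * form z y
  form-axpyʳ z x c y = trans (form-sym z _) (trans (form-axpyˡ x c y z)
    (cong₂ (λ a b → a + c * b) (form-sym x z) (form-sym y z)))

  form-axpy² : ∀ x c y → form (axpy x c y) (axpy x c y) ≡ form x x + c * (form x y + form x y) + c * c * form y y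
  form-axpy² x c y = trans (form-axpyˡ x c y _) (trans (cong₂ (λ a b → a + c * b) (form-axpyʳ x x c y) (form-axpyʳ y x c y))
    (trans (cong (λ b → form x x + c * form x y + c * (b + c * form y y)) (form-sym y x))
        (expand (form x x) (form x y) (form y y) c)))
    where
    expand : ∀ p q r c → p + c * q + c * (q + c * r) ≡ p + c * (q + q) + c * c * r
    expand = solve-∀

  form-unitʳ : ∀ x s → form x (unit s) ≡ pair x s
  form-unitʳ x s = trans (sum-cong-≗ λ i → trans (cong (_*_ (x i)) (trans (pair-unit s i) (B-sym i s)))
      (ℤ.*-comm (x i) (B s i))) refl

  form-unitˡ : ∀ s x → form (unit s) x ≡ pair x s
  form-unitˡ s x = trans (form-sym (unit s) x) (form-unitʳ x s)

0ᵛ : ∀ {n} → Vector n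
0ᵛ _ = 0ℤ

axpy-0 : ∀ {n} (x y : Vector n) {c} → c ≡ 0ℤ → axpy x c y ≗ x
axpy-0 x y refl j = ℤ.+-identityʳ (x j)

-- Twice the Tits form, which makes it integral and gives simple roots norm 2.
entry : Maybe ℕ → ℤ
entry (just 1) = + 2
entry (just 3) = -1ℤ
entry _ = 0ℤ

module Geometry {n : ℕ} (M : CoxeterMatrix n) (simply-laced : Coxeter.SimplyLaced M) where
  open Words M public

  B : Fin n → Fin n → ℤ
  B s r = entry (m s r)

  B-sym : ∀ s r → B s r ≡ B r s
  B-sym s r = cong entry (symm s r)

  open Form B B-sym public

  B-diag : ∀ s → B s s ≡ + 2
  B-diag s = cong entry (diag s)

  data Bond (s r : Fin n) : Set where
    equal : s ≡ r → Bond s r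
    commute : s ≢ r → m s r ≡ just 2 → Bond s r
    braid : s ≢ r → m s r ≡ just 3 → Bond s r

  bond : ∀ s r → Bond s r
  bond s r with s Fin.≟ r | simply-laced s r
  ... | yes s≡r | _ = equal s≡r
  ... | no s≢r | k , e , k≤3 with offd s r s≢r k e
  bond s r | no s≢r | 2 , e , k≤3 | _ = commute s≢r e
  bond s r | no s≢r | 3 , e , k≤3 | _ = braid s≢r e
  bond s r | no s≢r | 1 , e , k≤3 | s≤s ()
  bond s r | no s≢r | suc (suc (suc (suc k))) , e , s≤s (s≤s (s≤s ())) | _

  relation : ∀ s r k → m s r ≡ just k → ∀ w → (alt s r k ++ w) ~ w
  relation s r k e w = ~rel [] w s r k e

  commutes : ∀ {s r} → m s r ≡ just 2 → ∀ w → (s ∷ r ∷ w) ~ (r ∷ s ∷ w)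
  commutes {s} {r} e w = ~trans (~sym (relation r s 2 (trans (symm r s) e) _))
    (++-congˡ (r ∷ s ∷ []) (~trans (++-congˡ (r ∷ []) (square s _)) (square r w)))

  braids : ∀ {s r} → m s r ≡ just 3 → ∀ w → (s ∷ r ∷ s ∷ w) ~ (r ∷ s ∷ r ∷ w)
  braids {s} {r} e w = ~trans (~sym (relation r s 3 (trans (symm r s) e) _))
    (++-congˡ (r ∷ s ∷ r ∷ []) (~trans (++-congˡ (s ∷ r ∷ []) (square s _))
        (~trans (++-congˡ (s ∷ []) (square r _)) (square s w))))

  reflect : Fin n → Vector n → Vector n
  reflect s x = axpy x (- pair x s) (unit s)

  reflect-cong : ∀ s {x y} → x ≗ y → reflect s x ≗ reflect s y
  reflect-cong s h j = cong₂ (λ a b → a + - b * unit s j) (h j) (pair-cong h s)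

  reflect-other : ∀ {s} x {j} → s ≢ j → reflect s x j ≡ x j
  reflect-other {s} x {j} s≢j = trans (cong (λ u → x j + - pair x s * u) (unit-other s≢j))
    (trans (cong (_+_ (x j)) (ℤ.*-zeroʳ (- pair x s))) (ℤ.+-identityʳ (x j)))

  reflect-axpy : ∀ s x c y → reflect s (axpy x c y) ≗ axpy (reflect s x) c (reflect s y)
  reflect-axpy s x c y j = trans (cong (λ p → x j + c * y j + - p * unit s j) (pair-axpy x c y s))
    (expand (x j) c (y j) (pair x s) (pair y s) (unit s j))
    where
    expand : ∀ x c y p q u → x + c * y + - (p + c * q) * u ≡ x + - p * u + c * (y + - q * u)
    expand = solve-∀

  comb : Vector n → Fin n → Fin n → ℤ → ℤ → Vector n
  comb x s r a b = axpy (axpy x a (unit s)) b (unit r)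

  pair-comb : ∀ x s r a b q → pair (comb x s r a b) q ≡ pair x q + a * B q s + b * B q r
  pair-comb x s r a b q = trans (pair-axpy _ b _ q)
    (cong₂ (λ p u → p + b * u) (trans (pair-axpy x a _ q) (cong (λ u → pair x q + a * u) (pair-unit s q))) (pair-unit r q))

  -- A record and not a bare equation, so that unification finds the two coefficients when
  -- reflections are composed.
  record IsComb (x : Vector n) (s r : Fin n) (a b : ℤ) (y : Vector n) : Set where
    constructor isComb
    field
      at : y ≗ comb x s r a b
  open IsComb

  stepˡ : ∀ {x s r a b a' c p y} → B s r ≡ c → pair x s ≡ p → - a - p - b * c ≡ a' →
          IsComb x s r a b y → IsComb x s r a' b (reflect s y)
  stepˡ {x} {s} {r} {a} {b} refl refl refl (isComb h) .at j = trans (reflect-cong s h j) (trans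
    (cong (λ p → comb x s r a b j + - p * unit s j)
        (trans (pair-comb x s r a b s) (cong (λ d → pair x s + a * d + b * B s r) (B-diag s))))
    (expand (x j) a b (unit s j) (unit r j) (pair x s) (B s r)))
    where
    expand : ∀ x a b u v p c → x + a * u + b * v + - (p + a * + 2 + b * c) * u ≡ x + (- a - p - b * c) * u + b * v
    expand = solve-∀

  stepʳ : ∀ {x s r a b b' c p y} → B s r ≡ c → pair x r ≡ p → - b - p - a * c ≡ b' →
          IsComb x s r a b y → IsComb x s r a b' (reflect r y)
  stepʳ {x} {s} {r} {a} {b} refl refl refl (isComb h) .at j = trans (reflect-cong r h j) (trans
    (cong (λ p → comb x s r a b j + - p * unit r j)
      (trans (pair-comb x s r a b r) (cong₂ (λ c d → pair x r + a * c + b * d) (B-sym r s) (B-diag r))))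
    (expand (x j) a b (unit s j) (unit r j) (pair x r) (B s r)))
    where
    expand : ∀ x a b u v p c → x + a * u + b * v + - (p + a * c + b * + 2) * v ≡ x + a * u + (- b - p - a * c) * v
    expand = solve-∀

  comb-0 : ∀ x s r {a b} → a ≡ 0ℤ → b ≡ 0ℤ → comb x s r a b ≗ x
  comb-0 x s r refl refl j = trans (ℤ.+-identityʳ _) (ℤ.+-identityʳ (x j))

  act : Word → Vector n → Vector n
  act w x = List.foldr reflect x w

  act-cong : ∀ w {x y} → x ≗ y → act w x ≗ act w y
  act-cong [] h = h
  act-cong (s ∷ w) h = reflect-cong s (act-cong w h)

  act-++ : ∀ u w x → act (u ++ w) x ≡ act u (act w x)
  act-++ u w x = List.foldr-++ reflect x u w

  act-axpy : ∀ w x c y → act w (axpy x c y) ≗ axpy (act w x) c (act w y)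
  act-axpy [] x c y j = refl
  act-axpy (s ∷ w) x c y j = trans (reflect-cong s (act-axpy w x c y) j) (reflect-axpy s (act w x) c (act w y) j)

  reflect-involutive : ∀ s x → reflect s (reflect s x) ≗ x
  reflect-involutive s x j = trans (cong (λ p → reflect s x j + - p * unit s j)
      (trans (pair-axpy x (- pair x s) (unit s) s) (cong (λ u → pair x s + - pair x s * u)
          (trans (pair-unit s s) (B-diag s)))))
    (expand (x j) (pair x s) (unit s j))
    where
    expand : ∀ x p u → x + - p * u + - (p + - p * + 2) * u ≡ x
    expand = solve-∀

  -- For s ≠ r, all 2k intermediate vectors have the form x + a α_s + b α_r. Only a and b are
  -- followed, and they come back to zero.
  alt-act : ∀ s r k → m s r ≡ just k → ∀ x → act (alt s r k) x ≗ x
  alt-act s r k e x with bond s r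
  ... | equal refl with refl ← trans (sym e) (diag s) = reflect-involutive s x
  alt-act s r k e x | commute _ e' with refl ← trans (sym e) e' =
    λ j → trans (at (stepˡ B≡ refl (e₄ p) (stepʳ B≡ refl (e₃ p q) (stepˡ B≡ refl (e₂ p q) (stepʳ B≡ refl (e₁ q) start)))) j)
      (comb-0 x s r refl refl j)
    where
    p = pair x s
    q = pair x r
    B≡ = cong entry e
    start : IsComb x s r 0ℤ 0ℤ x
    start .at j = sym (comb-0 x s r refl refl j)
    e₁ : ∀ q → - 0ℤ - q - 0ℤ * 0ℤ ≡ - q
    e₁ = solve-∀
    e₂ : ∀ p q → - 0ℤ - p - - q * 0ℤ ≡ - p
    e₂ = solve-∀
    e₃ : ∀ p q → - - q - q - - p * 0ℤ ≡ 0ℤ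
    e₃ = solve-∀
    e₄ : ∀ p → - - p - p - 0ℤ * 0ℤ ≡ 0ℤ
    e₄ = solve-∀
  alt-act s r k e x | braid _ e' with refl ← trans (sym e) e' =
    λ j → trans (at (stepˡ B≡ refl (e₆ p) (stepʳ B≡ refl (e₅ p q) (stepˡ B≡ refl (e₄ p q)
        (stepʳ B≡ refl (e₃ p q) (stepˡ B≡ refl (e₂ p q) (stepʳ B≡ refl (e₁ q) start)))))) j)
      (comb-0 x s r refl refl j)
    where
    p = pair x s
    q = pair x r
    B≡ = cong entry e
    start : IsComb x s r 0ℤ 0ℤ x
    start .at j = sym (comb-0 x s r refl refl j)
    e₁ : ∀ q → - 0ℤ - q - 0ℤ * -1ℤ ≡ - q
    e₁ = solve-∀
    e₂ : ∀ p q → - 0ℤ - p - - q * -1ℤ ≡ - p - q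
    e₂ = solve-∀
    e₃ : ∀ p q → - - q - q - (- p - q) * -1ℤ ≡ - p - q
    e₃ = solve-∀
    e₄ : ∀ p q → - (- p - q) - p - (- p - q) * -1ℤ ≡ - p
    e₄ = solve-∀
    e₅ : ∀ p q → - (- p - q) - q - - p * -1ℤ ≡ 0ℤ
    e₅ = solve-∀
    e₆ : ∀ p → - - p - p - 0ℤ * -1ℤ ≡ 0ℤ
    e₆ = solve-∀

  act-respects-~ : ∀ {w w'} → w ~ w' → ∀ x → act w x ≗ act w' x
  act-respects-~ ~refl x j = refl
  act-respects-~ (~sym p) x j = sym (act-respects-~ p x j)
  act-respects-~ (~trans p q) x j = trans (act-respects-~ p x j) (act-respects-~ q x j)
  act-respects-~ (~rel u w s r k e) x j = begin
    act (u ++ alt s r k ++ w) x j          ≡⟨ cong (λ f → f j) (act-++ u _ x) ⟩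
    act u (act (alt s r k ++ w) x) j       ≡⟨ cong (λ f → act u f j) (act-++ (alt s r k) w x) ⟩
    act u (act (alt s r k) (act w x)) j    ≡⟨ act-cong u (alt-act s r k e (act w x)) j ⟩
    act u (act w x) j                      ≡⟨ cong (λ f → f j) (act-++ u w x) ⟨
    act (u ++ w) x j                       ∎
    where open ≡-Reasoning

  -- The action of w⁻¹.
  iact : Word → Vector n → Vector n
  iact w x = List.foldl (λ y s → reflect s y) x w

  iact-reverse : ∀ w x → iact w x ≡ act (reverse w) x
  iact-reverse w x = sym (List.reverse-foldr reflect x w)

  iact-reverse′ : ∀ w x → iact (reverse w) x ≡ act w x
  iact-reverse′ w x = trans (iact-reverse (reverse w) x) (cong (λ v → act v x) (List.reverse-involutive w))

  iact-cong : ∀ w {x y} → x ≗ y → iact w x ≗ iact w y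
  iact-cong [] h = h
  iact-cong (s ∷ w) h = iact-cong w (reflect-cong s h)

  iact-++ : ∀ u w x → iact (u ++ w) x ≡ iact w (iact u x)
  iact-++ u w x = List.foldl-++ (λ y s → reflect s y) x u w

  iact-axpy : ∀ w x c y → iact w (axpy x c y) ≗ axpy (iact w x) c (iact w y)
  iact-axpy w x c y j rewrite iact-reverse w (axpy x c y) | iact-reverse w x | iact-reverse w y = act-axpy
      (reverse w) x c y j

  iact-respects-~ : ∀ {w w'} → w ~ w' → ∀ x → iact w x ≗ iact w' x
  iact-respects-~ {w} {w'} p x j rewrite iact-reverse w x | iact-reverse w' x = act-respects-~ (reverse-cong p) x j

  act-iact : ∀ w x → act w (iact w x) ≗ x
  act-iact w x j = trans (cong (λ y → act w y j) (iact-reverse w x))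
    (trans (cong (λ f → f j) (sym (act-++ w (reverse w) x))) (act-respects-~ (inverseʳ w) x j))

  iact-act : ∀ w x → iact w (act w x) ≗ x
  iact-act w x j = trans (cong (λ f → f j) (iact-reverse w (act w x)))
    (trans (cong (λ f → f j) (sym (act-++ (reverse w) w x))) (act-respects-~ (inverseˡ w) x j))

  pair-0 : ∀ s → pair 0ᵛ s ≡ 0ℤ
  pair-0 s = sum-zero λ j → ℤ.*-zeroʳ (B s j)

  neg : Vector n → Vector n
  neg x j = - x j

  reflect-unit : ∀ s → reflect s (unit s) ≗ neg (unit s)
  reflect-unit s j = trans (cong (λ p → unit s j + - p * unit s j) (trans (pair-unit s s) (B-diag s))) (lemma (unit s j))
    where
    lemma : ∀ u → u + - (+ 2) * u ≡ - u
    lemma = solve-∀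

  neg-axpy : ∀ x → neg x ≗ axpy 0ᵛ -1ℤ x
  neg-axpy x j = sym (trans (ℤ.+-identityˡ _) (ℤ.-1*i≡-i (x j)))

  act-0 : ∀ w → act w 0ᵛ ≗ 0ᵛ
  act-0 [] j = refl
  act-0 (s ∷ w) j = trans (reflect-cong s (act-0 w) j) (trans (cong (λ p → 0ℤ + - p * unit s j) (pair-0 s)) refl)

  act-neg : ∀ w x → act w (neg x) ≗ neg (act w x)
  act-neg w x j = trans (act-cong w (neg-axpy x) j) (trans (act-axpy w 0ᵛ -1ℤ x j)
    (trans (cong (_+ -1ℤ * act w x j) (act-0 w j)) (sym (neg-axpy (act w x) j))))

  iact-neg : ∀ w x → iact w (neg x) ≗ neg (iact w x)
  iact-neg w x j rewrite iact-reverse w (neg x) | iact-reverse w x = act-neg (reverse w) x j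

  reflect-form : ∀ s x y → form (reflect s x) (reflect s y) ≡ form x y
  reflect-form s x y = trans (form-axpyˡ x (- p) (unit s) _)
    (trans (cong₂ (λ a b → a + - p * b) (form-axpyʳ x x' (- q) (unit s)) (form-axpyʳ (unit s) y (- q) (unit s)))
      (trans (cong₂ (λ a b → form x y + - q * a + - p * (b + - q * form (unit s) (unit s))) (form-unitʳ x s)
          (form-unitˡ s y))
        (trans (cong (λ d → form x y + - q * p + - p * (q + - q * d))
            (trans (form-unitʳ (unit s) s) (trans (pair-unit s s) (B-diag s))))
          (expand (form x y) p q))))
    where
    x' = y
    p = pair x s
    q = pair y s
    expand : ∀ f p q → f + - q * p + - p * (q + - q * + 2) ≡ f
    expand = solve-∀

  act-form : ∀ w x y → form (act w x) (act w y) ≡ form x y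
  act-form [] x y = refl
  act-form (s ∷ w) x y = trans (reflect-form s (act w x) (act w y)) (act-form w x y)

-- Positive and negative roots, and a computable length

sum-nonneg : ∀ {n} (f : Fin n → ℤ) → (∀ i → 0ℤ ≤ f i) → 0ℤ ≤ sum f
sum-nonneg {zero} f h = ℤ.≤-refl
sum-nonneg {suc n} f h = ℤ.+-mono-≤ (h zero) (sum-nonneg (f ∘ suc) (h ∘ suc))

≤-sum : ∀ {n} (f : Fin n → ℤ) → (∀ i → 0ℤ ≤ f i) → ∀ i → f i ≤ sum f
≤-sum {suc n} f h zero =
  subst (_≤ sum f) (ℤ.+-identityʳ (f zero)) (ℤ.+-monoʳ-≤ (f zero) (sum-nonneg (f ∘ suc) (h ∘ suc)))
≤-sum {suc n} f h (suc i) =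
  subst (_≤ sum f) (ℤ.+-identityˡ (f (suc i))) (ℤ.+-mono-≤ (h zero) (≤-sum (f ∘ suc) (h ∘ suc) i))

sgn : ℤ → ℤ
sgn (+ 0) = 0ℤ
sgn (+ suc _) = 1ℤ
sgn -[1+ _ ] = -1ℤ

sgn-neg : ∀ i → sgn (- i) ≡ - sgn i
sgn-neg (+ 0) = refl
sgn-neg (+ suc _) = refl
sgn-neg -[1+ _ ] = refl

sgn-pos : ∀ {i} → 0ℤ < i → sgn i ≡ 1ℤ
sgn-pos {+ suc _} _ = refl
sgn-pos {+ 0} (+<+ ())

sgn-≤1 : ∀ i → sgn i ≤ 1ℤ
sgn-≤1 (+ 0) = +≤+ z≤n
sgn-≤1 (+ suc _) = +≤+ (s≤s z≤n)
sgn-≤1 -[1+ _ ] = -≤+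

ht-unit : ∀ {n} (s : Fin n) → ht (unit s) ≡ 1ℤ
ht-unit s = trans (sum-cong-≗ λ j → sym (ℤ.*-identityˡ (unit s j))) (sum-unit (λ _ → 1ℤ) s)

ht-neg : ∀ {n} {x y : Vector n} → x ≗ (λ j → - y j) → ht x ≡ - ht y
ht-neg {y = y} h = trans (sum-cong-≗ h) (sum-neg y)

Pos : ∀ {n} → Vector n → Set
Pos x = ∀ j → 0ℤ ≤ x j

Neg : ∀ {n} → Vector n → Set
Neg x = ∀ j → x j ≤ 0ℤ

Pos-resp : ∀ {n} {x y : Vector n} → x ≗ y → Pos x → Pos y
Pos-resp h p j = subst (0ℤ ≤_) (h j) (p j)

Neg-resp : ∀ {n} {x y : Vector n} → x ≗ y → Neg x → Neg y
Neg-resp h p j = subst (_≤ 0ℤ) (h j) (p j)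

Pos⇒Neg : ∀ {n} {x y : Vector n} → x ≗ (λ j → - y j) → Pos y → Neg x
Pos⇒Neg h p j = subst (_≤ 0ℤ) (sym (h j)) (ℤ.neg-mono-≤ (p j))

Neg⇒Pos : ∀ {n} {x y : Vector n} → x ≗ (λ j → - y j) → Neg y → Pos x
Neg⇒Pos h p j = subst (0ℤ ≤_) (sym (h j)) (ℤ.neg-mono-≤ (p j))

unit-Pos : ∀ {n} (s : Fin n) → Pos (unit s)
unit-Pos s j with s Fin.≟ j
... | yes _ = +≤+ z≤n
... | no _ = +≤+ z≤n

module Roots {n : ℕ} (M : CoxeterMatrix n) (simply-laced : Coxeter.SimplyLaced M) where
  open Geometry M simply-laced public

  reflect-unit-commute : ∀ {s r} → s ≢ r → m s r ≡ just 2 → reflect r (unit s) ≗ unit s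
  reflect-unit-commute {s} {r} s≢r e = axpy-0 (unit s) (unit r)
    (cong -_ (trans (pair-unit s r) (trans (B-sym r s) (cong entry e))))

  reflect-unit-braid : ∀ {s r} → s ≢ r → m s r ≡ just 3 → reflect r (unit s) ≗ axpy (unit s) 1ℤ (unit r)
  reflect-unit-braid {s} {r} s≢r e j =
    cong (λ c → unit s j + - c * unit r j) (trans (pair-unit s r) (trans (B-sym r s) (cong entry e)))

  -- Strip the first letter r of w and argue inside the subgroup generated by s and r, which has type A₁ × A₁ or A₂.
  descend : ∀ k w s → length w ℕ.≤ k → Pos (iact w (unit s)) ⊎ ∃[ w' ] (w' ~ (s ∷ w) × length w' ℕ.< length w)
  descend k [] s _ = inj₁ (unit-Pos s)
  descend (suc k) (r ∷ w) s (s≤s w≤k) with bond s r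
  ... | equal refl = inj₂ (w , ~sym (square s w) , ℕ.≤-refl)
  ... | commute s≢r e with descend k w s w≤k
  ...   | inj₁ p = inj₁ (Pos-resp (iact-cong w (λ j → sym (reflect-unit-commute s≢r e j))) p)
  ...   | inj₂ (w' , p , w'<w) = inj₂ (r ∷ w' , ~trans (++-congˡ (r ∷ []) p) (~sym (commutes e w)) , s≤s w'<w)
  descend (suc k) (r ∷ w) s (s≤s w≤k) | braid s≢r e with descend k w s w≤k
  ... | inj₂ (w' , p , w'<w) = shorter (descend k w' r (ℕ.≤-trans (ℕ.<⇒≤ w'<w) w≤k))
    where
    w~ : (r ∷ w) ~ (r ∷ s ∷ w')
    w~ = ++-congˡ (r ∷ []) (~trans (~sym (square s w)) (++-congˡ (s ∷ []) (~sym p)))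
    -- In type A₂ the element s r sends α_s to α_r, which turns the question about r w and s into
    -- one about the shorter w' and r.
    to-r : reflect s (reflect r (unit s)) ≗ unit r
    to-r j = trans (reflect-cong s (λ i → trans (reflect-unit-braid s≢r e i) (swap (unit s i) (unit r i))) j)
      (trans (reflect-cong s (λ i → sym (reflect-unit-braid (s≢r ∘ sym) (trans (symm r s) e) i)) j)
        (reflect-involutive s (unit r) j))
      where
      swap : ∀ a b → a + 1ℤ * b ≡ b + 1ℤ * a
      swap = solve-∀
    shorter : Pos (iact w' (unit r)) ⊎ ∃[ w'' ] (w'' ~ (r ∷ w') × length w'' ℕ.< length w') → _
    shorter (inj₁ p) = inj₁ (Pos-resp (λ j → trans (iact-cong w' (λ i → sym (to-r i)) j)
        (sym (iact-respects-~ w~ (unit s) j))) p)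
    shorter (inj₂ (w'' , q , w''<w')) = inj₂ (r ∷ s ∷ w'' ,
      ~trans (++-congˡ (r ∷ s ∷ []) q) (~trans (~sym (braids e w'))
          (++-congˡ (s ∷ r ∷ []) (~trans (++-congˡ (s ∷ []) p) (square s w)))) ,
      s≤s (ℕ.≤-trans (s≤s w''<w') w'<w))
  ... | inj₁ p with descend k w r w≤k
  ...   | inj₁ q = inj₁ (Pos-resp (λ j → sym (trans (iact-cong w (reflect-unit-braid s≢r e) j)
      (iact-axpy w (unit s) 1ℤ (unit r) j)))
                    λ j → ℤ.+-mono-≤ (p j) (subst (0ℤ ≤_) (sym (ℤ.*-identityˡ _)) (q j)))
  ...   | inj₂ (w' , q , w'<w) with descend k w' s (ℕ.≤-trans (ℕ.<⇒≤ w'<w) w≤k)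
  ...     | inj₁ p' = inj₁ (Pos-resp (iact-respects-~ q (unit s)) p')
  ...     | inj₂ (w'' , q' , w''<w') = inj₂ (w'' , ~trans q' (++-congˡ (s ∷ []) q) , ℕ.<-trans w''<w' (ℕ.m<n⇒m<1+n w'<w))

  -- If positivity fails, s w has a word w' shorter than w. Either w'⁻¹α_s = - w⁻¹α_s is positive,
  -- or s w' = w has a word shorter by at least two letters, to which induction applies.
  sign-of : ∀ k w s → length w ℕ.≤ k → Pos (iact w (unit s)) ⊎ Neg (iact w (unit s))
  sign-of k w s w≤k with descend k w s w≤k
  ... | inj₁ p = inj₁ p
  sign-of (suc k) w@(_ ∷ _) s w≤k | inj₂ (w' , p , w'<w) with descend (length w') w' s ℕ.≤-refl
  ...   | inj₁ q = inj₂ (Pos⇒Neg (λ j → trans (sym (ℤ.neg-involutive _)) (cong -_ (sym (flip j)))) q)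
    where
    flip : iact w' (unit s) ≗ neg (iact w (unit s))
    flip j = trans (iact-respects-~ p (unit s) j) (trans (iact-cong w (reflect-unit s) j) (iact-neg w (unit s) j))
  ...   | inj₂ (w'' , q , w''<w') =
    [ inj₁ ∘ Pos-resp w''≗w , inj₂ ∘ Neg-resp w''≗w ]′
      (sign-of k w'' s (ℕ.s≤s⁻¹ (ℕ.≤-trans (s≤s (ℕ.<⇒≤ w''<w')) (ℕ.≤-trans w'<w w≤k))))
    where
    w''≗w : iact w'' (unit s) ≗ iact w (unit s)
    w''≗w = iact-respects-~ (~trans q (~trans (++-congˡ (s ∷ []) p) (square s w))) (unit s)

  record Root (x : Vector n) : Set where
    constructor root
    field
      word : Word
      letter : Fin n
      equation : x ≗ act word (unit letter)

  Root-resp : ∀ {x y} → x ≗ y → Root x → Root y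
  Root-resp h (root w s e) = root w s λ j → trans (sym (h j)) (e j)

  Root-unit : ∀ s → Root (unit s)
  Root-unit s = root [] s λ _ → refl

  Root-reflect : ∀ {x} s → Root x → Root (reflect s x)
  Root-reflect s (root w r e) = root (s ∷ w) r (reflect-cong s e)

  Root-act : ∀ {x} w → Root x → Root (act w x)
  Root-act [] h = h
  Root-act (s ∷ w) h = Root-reflect s (Root-act w h)

  Root-iact : ∀ {x} w → Root x → Root (iact w x)
  Root-iact [] h = h
  Root-iact (s ∷ w) h = Root-iact w (Root-reflect s h)

  Root-neg : ∀ {x} → Root x → Root (neg x)
  Root-neg (root w s e) = root (w ++ s ∷ []) s λ j → trans (cong -_ (e j)) (trans (sym (act-neg w (unit s) j))
    (trans (act-cong w (λ i → sym (reflect-unit s i)) j) (cong (λ f → f j) (sym (act-++ w (s ∷ []) (unit s))))))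

  form-unit : ∀ s → form (unit s) (unit s) ≡ + 2
  form-unit s = trans (form-unitʳ (unit s) s) (trans (pair-unit s s) (B-diag s))

  Root-norm : ∀ {x} → Root x → form x x ≡ + 2
  Root-norm (root w s e) = trans (form-cong e e) (trans (act-form w (unit s) (unit s)) (form-unit s))

  Root-sign : ∀ {x} → Root x → Pos x ⊎ Neg x
  Root-sign (root w s e) = [ inj₁ ∘ Pos-resp back , inj₂ ∘ Neg-resp back ]′
      (sign-of (length (reverse w)) (reverse w) s ℕ.≤-refl)
    where
    back : iact (reverse w) (unit s) ≗ _
    back j = trans (cong (λ f → f j) (iact-reverse′ w (unit s))) (sym (e j))

  zero-norm : ∀ {x} → x ≗ 0ᵛ → form x x ≡ 0ℤ
  zero-norm {x} h = sum-zero λ i → trans (cong (_* pair x i) (h i)) (ℤ.*-zeroˡ (pair x i))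

  Root-nonzero : ∀ {x} → Root x → ¬ x ≗ 0ᵛ
  Root-nonzero ρ h = contradiction (trans (sym (Root-norm ρ)) (zero-norm h)) λ ()

  ht-positive : ∀ {x} → Root x → Pos x → 0ℤ < ht x
  ht-positive {x} ρ p = ℤ.≰⇒> λ ht≤0 → Root-nonzero ρ λ j → ℤ.≤-antisym (ℤ.≤-trans (≤-sum x p j) ht≤0) (p j)

  ht-negative : ∀ {x} → Root x → Neg x → sgn (ht x) ≡ -1ℤ
  ht-negative {x} ρ p = trans (cong sgn (ht-neg {x = x} {neg x} λ j → sym (ℤ.neg-involutive (x j))))
    (trans (sgn-neg (ht (neg x))) (cong -_ (sgn-pos (ht-positive (Root-neg ρ) (Neg⇒Pos (λ _ → refl) p)))))

  Pos-Neg : ∀ {x} → Root x → Pos x → ¬ Neg x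
  Pos-Neg ρ p q = Root-nonzero ρ λ j → ℤ.≤-antisym (q j) (p j)

  -- Each letter counts +1 or -1 according to the sign of w⁻¹α_s, which the height detects because a
  -- root never has height zero. This makes sense on words that are not reduced, and invariance and
  -- agreement with the length are proved afterwards.
  ℓ : Word → ℤ
  ℓ [] = 0ℤ
  ℓ (s ∷ w) = ℓ w + sgn (ht (iact w (unit s)))

  ℓ-ascent : ∀ s w → Pos (iact w (unit s)) → ℓ (s ∷ w) ≡ ℓ w + 1ℤ
  ℓ-ascent s w p = cong (_+_ (ℓ w)) (sgn-pos (ht-positive (Root-iact w (Root-unit s)) p))

  ℓ-descent : ∀ s w → Neg (iact w (unit s)) → ℓ (s ∷ w) ≡ ℓ w - 1ℤ
  ℓ-descent s w p = cong (_+_ (ℓ w)) (ht-negative (Root-iact w (Root-unit s)) p)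

  ℓ-prefix : ∀ u {w w'} → w ~ w' → ℓ w ≡ ℓ w' → ℓ (u ++ w) ≡ ℓ (u ++ w')
  ℓ-prefix [] p e = e
  ℓ-prefix (s ∷ u) {w} {w'} p e =
    cong₂ (λ a b → a + sgn b) (ℓ-prefix u p e) (sum-cong-≗ (iact-respects-~ (++-congˡ u p) (unit s)))

  -- The heights picked up along (s r)^m and its second half are opposite to each other.
  ℓ-alt : ∀ s r k → m s r ≡ just k → ∀ w → ℓ (alt s r k ++ w) ≡ ℓ w
  ℓ-alt s r k e w = go (bond s r)
    where
    h : Vector n → ℤ
    h x = ht (iact w x)
    a = h (unit s)
    b = h (unit r)
    h-comb : ∀ c d {x} → IsComb 0ᵛ s r c d x → h x ≡ c * a + d * b
    h-comb c d (isComb e) = begin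
      h _                                   ≡⟨ sum-cong-≗ (iact-cong w e) ⟩
      h (comb 0ᵛ s r c d)                   ≡⟨ h-axpy (axpy 0ᵛ c (unit s)) d (unit r) ⟩
      h (axpy 0ᵛ c (unit s)) + d * b        ≡⟨ cong (_+ d * b) (h-axpy 0ᵛ c (unit s)) ⟩
      h 0ᵛ + c * a + d * b                  ≡⟨ cong (λ z → z + c * a + d * b) h-0 ⟩
      0ℤ + c * a + d * b                    ≡⟨ cong (_+ d * b) (ℤ.+-identityˡ (c * a)) ⟩
      c * a + d * b                         ∎
      where
      open ≡-Reasoning
      h-axpy : ∀ x c y → h (axpy x c y) ≡ h x + c * h y
      h-axpy x c y = trans (sum-cong-≗ (iact-axpy w x c y)) (sum-axpy (iact w x) (iact w y) c)
      h-0 : h 0ᵛ ≡ 0ℤ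
      h-0 = sum-zero λ j → trans (cong (λ f → f j) (iact-reverse w 0ᵛ)) (act-0 (reverse w) j)
    startˡ : IsComb 0ᵛ s r 1ℤ 0ℤ (unit s)
    startˡ = isComb λ j → sym (trans (ℤ.+-identityʳ _) (trans (ℤ.+-identityˡ _) (ℤ.*-identityˡ _)))
    startʳ : IsComb 0ᵛ s r 0ℤ 1ℤ (unit r)
    startʳ = isComb λ j → sym (trans (ℤ.+-identityˡ _) (ℤ.*-identityˡ _))
    V : ℤ → ℤ → ℤ
    V c d = sgn (c * a + d * b)
    V-neg : ∀ c d → V (- c) (- d) ≡ - V c d
    V-neg c d = trans (cong sgn (negate c a d b)) (sgn-neg (c * a + d * b))
      where
      negate : ∀ c a d b → - c * a + - d * b ≡ - (c * a + d * b)
      negate = solve-∀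
    go : Bond s r → ℓ (alt s r k ++ w) ≡ ℓ w
    go (equal refl) with refl ← trans (sym e) (diag s) =
      trans (cong (λ z → ℓ w + sgn a + sgn z) (ht-neg
          (λ j → trans (iact-cong w (reflect-unit s) j) (iact-neg w (unit s) j))))
        (trans (cong (_+_ (ℓ w + sgn a)) (sgn-neg a)) (cancel (ℓ w) (sgn a)))
      where
      cancel : ∀ l x → l + x + - x ≡ l
      cancel = solve-∀
    go (commute _ e') with refl ← trans (sym e) e' =
      trans (cong₂ (λ x y → x + sgn y) (cong₂ (λ x y → x + sgn y) (cong₂ (λ x y → ℓ w + sgn x + sgn y)
          (h-comb 0ℤ 1ℤ startʳ)
          (h-comb 1ℤ 0ℤ (r′ refl startˡ)))
          (h-comb 0ℤ -1ℤ (r′ refl (s′ refl startʳ))))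
          (h-comb -1ℤ 0ℤ (r′ refl (s′ refl (r′ refl startˡ)))))
        (trans (cong₂ (λ x y → ℓ w + V 0ℤ 1ℤ + V 1ℤ 0ℤ + x + y) (V-neg 0ℤ 1ℤ) (V-neg 1ℤ 0ℤ))
            (cancel (ℓ w) (V 0ℤ 1ℤ) (V 1ℤ 0ℤ)))
      where
      r′ : ∀ {a b b' y} → - b - 0ℤ - a * 0ℤ ≡ b' → IsComb 0ᵛ s r a b y → IsComb 0ᵛ s r a b' (reflect r y)
      r′ = stepʳ (cong entry e) (pair-0 r)
      s′ : ∀ {a b a' y} → - a - 0ℤ - b * 0ℤ ≡ a' → IsComb 0ᵛ s r a b y → IsComb 0ᵛ s r a' b (reflect s y)
      s′ = stepˡ (cong entry e) (pair-0 s)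
      cancel : ∀ l x y → l + x + y + - x + - y ≡ l
      cancel = solve-∀
    go (braid _ e') with refl ← trans (sym e) e' =
      trans (cong₂ (λ x y → x + sgn y) (cong₂ (λ x y → x + sgn y)
          (cong₂ (λ x y → x + sgn y) (cong₂ (λ x y → x + sgn y) (cong₂ (λ x y → ℓ w + sgn x + sgn y)
          (h-comb 0ℤ 1ℤ startʳ)
          (h-comb 1ℤ 1ℤ (r′ refl startˡ)))
          (h-comb 1ℤ 0ℤ (r′ refl (s′ refl startʳ))))
          (h-comb 0ℤ -1ℤ (r′ refl (s′ refl (r′ refl startˡ)))))
          (h-comb -1ℤ -1ℤ (r′ refl (s′ refl (r′ refl (s′ refl startʳ))))))
          (h-comb -1ℤ 0ℤ (r′ refl (s′ refl (r′ refl (s′ refl (r′ refl startˡ)))))))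
        (trans (cong₂ (λ x y → x + y) (cong₂ (λ x y → ℓ w + V 0ℤ 1ℤ + V 1ℤ 1ℤ + V 1ℤ 0ℤ + x + y) (V-neg 0ℤ 1ℤ) (V-neg 1ℤ 1ℤ))
            (V-neg 1ℤ 0ℤ))
          (cancel (ℓ w) (V 0ℤ 1ℤ) (V 1ℤ 1ℤ) (V 1ℤ 0ℤ)))
      where
      r′ : ∀ {a b b' y} → - b - 0ℤ - a * -1ℤ ≡ b' → IsComb 0ᵛ s r a b y → IsComb 0ᵛ s r a b' (reflect r y)
      r′ = stepʳ (cong entry e) (pair-0 r)
      s′ : ∀ {a b a' y} → - a - 0ℤ - b * -1ℤ ≡ a' → IsComb 0ᵛ s r a b y → IsComb 0ᵛ s r a' b (reflect s y)
      s′ = stepˡ (cong entry e) (pair-0 s)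
      cancel : ∀ l x y z → l + x + y + z + - x + - y + - z ≡ l
      cancel = solve-∀

  ℓ-respects-~ : ∀ {w w'} → w ~ w' → ℓ w ≡ ℓ w'
  ℓ-respects-~ ~refl = refl
  ℓ-respects-~ (~sym p) = sym (ℓ-respects-~ p)
  ℓ-respects-~ (~trans p q) = trans (ℓ-respects-~ p) (ℓ-respects-~ q)
  ℓ-respects-~ (~rel u w s r k e) = ℓ-prefix u (relation s r k e w) (ℓ-alt s r k e w)

  ℓ-≤-length : ∀ w → ℓ w ≤ + length w
  ℓ-≤-length [] = ℤ.≤-refl
  ℓ-≤-length (s ∷ w) = subst (ℓ (s ∷ w) ≤_) (ℤ.+-comm (+ length w) 1ℤ)
    (ℤ.+-mono-≤ (ℓ-≤-length w) (sgn-≤1 (ht (iact w (unit s)))))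

  Reduced : Word → Set
  Reduced w = ℓ w ≡ + length w

  reduce′ : ∀ k w → length w ℕ.≤ k → ∃[ w' ] (w' ~ w × Reduced w' × length w' ℕ.≤ length w)
  reduce′ k [] _ = [] , ~refl , refl , z≤n
  reduce′ (suc k) (s ∷ w) (s≤s w≤k) with reduce′ k w w≤k
  ... | v , v~w , v-red , v≤w with descend (length v) v s ℕ.≤-refl
  ...   | inj₁ p = s ∷ v , ++-congˡ (s ∷ []) v~w ,
      trans (ℓ-ascent s v p) (trans (cong (_+ 1ℤ) v-red) (ℤ.+-comm (+ length v) 1ℤ)) , s≤s v≤w
  ...   | inj₂ (v' , p , v'<v) with reduce′ k v' (ℕ.≤-trans (ℕ.<⇒≤ v'<v) (ℕ.≤-trans v≤w w≤k))
  ...     | x , x~v' , x-red , x≤v' = x , ~trans x~v' (~trans p (++-congˡ (s ∷ []) v~w)) , x-red ,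
      ℕ.≤-trans x≤v' (ℕ.≤-trans (ℕ.<⇒≤ v'<v) (ℕ.m≤n⇒m≤1+n v≤w))

  reduce : ∀ w → ∃[ w' ] (w' ~ w × Reduced w')
  reduce w with reduce′ (length w) w ℕ.≤-refl
  ... | w' , p , r , _ = w' , p , r

  ℓ⇒HasLength : ∀ {w k} → ℓ w ≡ + k → HasLength w k
  ℓ⇒HasLength {w} {k} e with reduce w
  ... | w' , p , r = (w' , p , ℤ.+-injective (trans (sym r) (trans (ℓ-respects-~ p) e))) ,
    λ x q → ℤ.drop‿+≤+ (subst (_≤ + length x) (trans (ℓ-respects-~ q) e) (ℓ-≤-length x))

  hasLength : ∀ w → ∃[ k ] (HasLength w k × ℓ w ≡ + k)
  hasLength w with reduce w
  ... | w' , p , r = length w' , ℓ⇒HasLength e , e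
    where e = trans (sym (ℓ-respects-~ p)) r

  HasLength⇒ℓ : ∀ {w k} → HasLength w k → ℓ w ≡ + k
  HasLength⇒ℓ {w} {k} ((x , p , refl) , h) with hasLength w
  ... | l , ((y , q , refl) , h') , e = trans e (cong +_ (ℕ.≤-antisym (h' x p) (h y q)))

  ℓ-reverse : ∀ w → ℓ (reverse w) ≡ ℓ w
  ℓ-reverse w = ℤ.≤-antisym (half w) (subst (λ v → ℓ v ≤ ℓ (reverse w)) (List.reverse-involutive w) (half (reverse w)))
    where
    half : ∀ w → ℓ (reverse w) ≤ ℓ w
    half w with reduce w
    ... | w' , p , r = begin
      ℓ (reverse w)            ≡⟨ ℓ-respects-~ (reverse-cong p) ⟨
      ℓ (reverse w')           ≤⟨ ℓ-≤-length (reverse w') ⟩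
      + length (reverse w')    ≡⟨ cong +_ (List.length-reverse w') ⟩
      + length w'              ≡⟨ r ⟨
      ℓ w'                     ≡⟨ ℓ-respects-~ p ⟩
      ℓ w                      ∎
      where open ℤ.≤-Reasoning

  -- A nonempty reduced word s v has v⁻¹α_s positive, and so its own inverse makes α_s negative.
  faithful : ∀ {w} → (∀ s → Pos (iact w (unit s))) → w ~ []
  faithful {w} h with reduce w
  ... | [] , p , _ = ~sym p
  ... | s ∷ v , p , r = contradiction (Pos⇒Neg flip (Pos-resp (λ j → sym (iact-respects-~ p (unit s) j)) (h s)))
      (Pos-Neg (Root-iact v (Root-unit s)) v-pos)
    where
    flip : iact v (unit s) ≗ neg (iact (s ∷ v) (unit s))
    flip j = sym (trans (cong -_ (trans (iact-cong v (reflect-unit s) j) (iact-neg v (unit s) j))) (ℤ.neg-involutive _))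
    v-pos : Pos (iact v (unit s))
    v-pos = [ id , (λ q → contradiction (ℤ.≤-trans (ℤ.≤-reflexive (trans (sym r) (ℓ-descent s v q)))
        (ℤ.+-monoˡ-≤ -1ℤ (ℓ-≤-length v))) (too-long (length v))) ]′
      (sign-of (length v) v s ℕ.≤-refl)
      where
      too-long : ∀ k → ¬ (+ suc k ≤ + k - 1ℤ)
      too-long (suc k) (+≤+ le) = ℕ.1+n≰n (ℕ.≤-trans (ℕ.n≤1+n _) le)

-- Reflections and the Bruhat order

module Bruhat {n : ℕ} (M : CoxeterMatrix n) (simply-laced : Coxeter.SimplyLaced M) where
  open Roots M simply-laced public

  -- The same w and s witness both the reflection w s w⁻¹ and its root w α_s; this ties t to β, and
  -- the root may have either sign.
  record ReflectionIn (β : Vector n) (t : Word) : Set where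
    constructor reflectionIn
    field
      word : Word
      letter : Fin n
      t~ : t ~ (word ++ letter ∷ reverse word)
      root-eq : β ≗ act word (unit letter)

    isReflection : IsReflection t
    isReflection = word , letter , t~

    isRoot : Root β
    isRoot = root word letter root-eq
  open ReflectionIn using (isReflection; isRoot)

  reflection-act : ∀ {β t} → ReflectionIn β t → ∀ y → act t y ≗ axpy y (- form y β) β
  reflection-act {β} {t} (reflectionIn x s p e) y j = begin
    act t y j                                        ≡⟨ act-respects-~ p y j ⟩
    act (x ++ s ∷ reverse x) y j                     ≡⟨ cong (λ f → f j) (act-++ x _ y) ⟩
    act x (reflect s y') j                           ≡⟨ act-axpy x y' (- pair y' s) (unit s) j ⟩
    act x y' j + - pair y' s * act x (unit s) j      ≡⟨ cong₂ (λ a b → a + - pair y' s * b) (back j) (sym (e j)) ⟩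
    y j + - pair y' s * β j                          ≡⟨ cong (λ c → y j + - c * β j) pairing ⟩
    y j + - form y β * β j                           ∎
    where
    open ≡-Reasoning
    y' = act (reverse x) y
    back : act x y' ≗ y
    back i = trans (cong (λ v → act x v i) (sym (iact-reverse x y))) (act-iact x y i)
    pairing : pair y' s ≡ form y β
    pairing = trans (sym (form-unitʳ y' s)) (trans (sym (act-form x y' (unit s))) (form-cong back (λ i → sym (e i))))

  reflection-iact : ∀ {β t} → ReflectionIn β t → ∀ y → iact t y ≗ act t y
  reflection-iact {t = t} ρ y j =
    trans (cong (λ f → f j) (iact-reverse t y)) (act-respects-~ (reflection-involutive (isReflection ρ)) y j)

  reflection-neg : ∀ {β t} → ReflectionIn β t → iact t β ≗ neg β
  reflection-neg {β} ρ j = trans (reflection-iact ρ β j) (trans (reflection-act ρ β j)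
    (trans (cong (λ c → β j + - c * β j) (Root-norm (isRoot ρ))) (flip (β j))))
    where
    flip : ∀ u → u + - (+ 2) * u ≡ - u
    flip = solve-∀

  reflection-square : ∀ {t} → IsReflection t → (t ++ t) ~ []
  reflection-square {t} h = ~trans (++-congʳ t (~sym (reflection-involutive h))) (inverseˡ t)

  -- The action of a reflection depends only on its root, so t t' acts trivially and `faithful`
  -- applies. This is how equations between vectors become equations in W.
  same-reflection : ∀ {β β' t t'} → β ≗ β' → ReflectionIn β t → ReflectionIn β' t' → t ~ t'
  same-reflection {β} {β'} {t} {t'} h ρ ρ' = ~trans (inverseˡ-unique t t' (faithful trivial))
      (reflection-involutive (isReflection ρ'))
    where
    same : ∀ y → act t y ≗ act t' y
    same y j = trans (reflection-act ρ y j)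
      (trans (cong₂ (λ a b → y j + - a * b) (form-cong {y} {y} (λ _ → refl) h) (h j)) (sym (reflection-act ρ' y j)))
    trivial : ∀ s → Pos (iact (t ++ t') (unit s))
    trivial s = Pos-resp (λ j → sym (trans (cong (λ f → f j) (iact-++ t t' (unit s)))
      (trans (iact-cong t' (λ i → trans (reflection-iact ρ (unit s) i) (same (unit s) i)) j) (iact-act t' (unit s) j))))
          (unit-Pos s)

  reflection-simple : ∀ s → ReflectionIn (unit s) (s ∷ [])
  reflection-simple s = reflectionIn [] s ~refl λ _ → refl

  reflection-conj : ∀ {β t} w → ReflectionIn β t → ReflectionIn (act w β) (w ++ t ++ reverse w)
  reflection-conj {β} {t} w (reflectionIn x s p e) = reflectionIn (w ++ x) s
    (~trans (++-congˡ w (++-congʳ (reverse w) p)) (~reflexive regroup))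
    (λ j → trans (act-cong w e j) (cong (λ f → f j) (sym (act-++ w x (unit s)))))
    where
    open ≡-Reasoning
    regroup : w ++ (x ++ s ∷ reverse x) ++ reverse w ≡ (w ++ x) ++ s ∷ reverse (w ++ x)
    regroup = begin
      w ++ (x ++ s ∷ reverse x) ++ reverse w    ≡⟨ cong (w ++_) (List.++-assoc x _ _) ⟩
      w ++ x ++ s ∷ reverse x ++ reverse w      ≡⟨ List.++-assoc w x _ ⟨
      (w ++ x) ++ s ∷ reverse x ++ reverse w    ≡⟨ cong (λ z → (w ++ x) ++ s ∷ z) (List.reverse-++ w x) ⟨
      (w ++ x) ++ s ∷ reverse (w ++ x)          ∎

  reflection-resp : ∀ {β t t'} → t ~ t' → ReflectionIn β t → ReflectionIn β t'
  reflection-resp p (reflectionIn x s q e) = reflectionIn x s (~trans (~sym p) q) e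

  reflection-resp-root : ∀ {β β' t} → β ≗ β' → ReflectionIn β t → ReflectionIn β' t
  reflection-resp-root h (reflectionIn x s q e) = reflectionIn x s q λ j → trans (sym (h j)) (e j)

  Root⇒reflection : ∀ {β} → Root β → ∃[ t ] ReflectionIn β t
  Root⇒reflection (root w s e) = (w ++ s ∷ reverse w) , reflectionIn w s ~refl e

  -- Conjugating t by itself gives t back, while its root becomes tβ = -β.
  reflection-neg-root : ∀ {β t} → ReflectionIn β t → ReflectionIn (neg β) t
  reflection-neg-root {β} {t} ρ = reflection-resp
      (~trans (++-congˡ t (++-congˡ t (reflection-involutive h)))
          (~trans (++-congˡ t (reflection-square h)) (~reflexive (List.++-identityʳ t))))
      (reflection-resp-root (λ j → trans (sym (reflection-iact ρ β j)) (reflection-neg ρ j)) (reflection-conj t ρ))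
    where h = isReflection ρ

  positive-root : ∀ {t} → IsReflection t → ∃[ β ] (ReflectionIn β t × Pos β)
  positive-root (x , s , p) = [ (λ pos → _ , ρ , pos) , (λ neg → _ , reflection-neg-root ρ , Neg⇒Pos (λ _ → refl) neg) ]′
    (Root-sign (isRoot ρ))
    where ρ = reflectionIn x s p (λ _ → refl)

  -- s changes the s-coordinate only, so any other nonzero coordinate stays positive and determines
  -- the sign. Without one, β = c α_s, and the norm forces c² = 1.
  reflect-Pos : ∀ s {β} → Root β → Pos β → β ≗ unit s ⊎ Pos (reflect s β)
  reflect-Pos s {β} ρ p with Fin.any? (λ j → ¬? (s Fin.≟ j) ×-dec ¬? (β j ℤ.≟ 0ℤ))
  ... | yes (j , s≢j , βj≢0) = inj₂ ([ id , (λ q → contradiction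
      (ℤ.≤-antisym (subst (_≤ 0ℤ) (reflect-other β s≢j) (q j)) (p j)) βj≢0) ]′
    (Root-sign (Root-reflect s ρ)))
  ... | no none = inj₁ λ j → trans (multiple j) (trans (cong (_* unit s j) c≡1) (ℤ.*-identityˡ (unit s j)))
    where
    c = β s
    multiple : ∀ j → β j ≡ c * unit s j
    multiple j with s Fin.≟ j
    ... | yes refl = sym (ℤ.*-identityʳ (β j))
    ... | no s≢j with β j ℤ.≟ 0ℤ
    ...   | yes e = trans e (sym (ℤ.*-zeroʳ c))
    ...   | no ne = contradiction (j , s≢j , ne) none
    norm : c * c * + 2 ≡ + 2
    norm = trans (sym (trans (form-cong mult mult)
        (trans (form-axpy² 0ᵛ c (unit s)) (trans (cong₂ (λ a b → a + c * (b + b) + c * c * form (unit s) (unit s))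
      (zero-norm {0ᵛ} λ _ → refl) (trans (form-unitʳ 0ᵛ s) (pair-0 s)))
          (trans (simplify c (form (unit s) (unit s))) (cong (_*_ (c * c)) (form-unit s)))))))
      (Root-norm ρ)
      where
      mult : β ≗ axpy 0ᵛ c (unit s)
      mult j = trans (multiple j) (sym (ℤ.+-identityˡ _))
      simplify : ∀ c f → 0ℤ + c * (0ℤ + 0ℤ) + c * c * f ≡ c * c * f
      simplify = solve-∀
    c≡1 : c ≡ 1ℤ
    c≡1 = unit-square c (p s) (ℤ.*-cancelʳ-≡ (c * c) 1ℤ (+ 2) norm)
      where
      unit-square : ∀ c → 0ℤ ≤ c → c * c ≡ 1ℤ → c ≡ 1ℤ
      unit-square (+ k) _ e = cong +_ (ℕ.m*n≡1⇒m≡1 k k (ℤ.+-injective (trans (ℤ.pos-* k k) e)))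

  -- While the letters of u are applied to β, its sign can change only at a letter whose simple root
  -- β has just become; that letter is deleted.
  strong-exchange : ∀ u {t β} → ReflectionIn β t → Pos β → Neg (iact u β) →
                    ∃[ u' ] (u' ~ (t ++ u) × length u' ℕ.< length u)
  strong-exchange [] ρ p q = contradiction q (Pos-Neg (isRoot ρ) p)
  strong-exchange (s ∷ u) {t} {β} ρ p q with reflect-Pos s (isRoot ρ) p
  ... | inj₁ e = u , ~trans (~sym (square s u)) (++-congʳ (s ∷ u)
      (same-reflection (λ j → sym (e j)) (reflection-simple s) ρ)) , ℕ.≤-refl
  ... | inj₂ p' with strong-exchange u (reflection-conj (s ∷ []) ρ) p' q
  ...   | u' , u'~ , u'<u = s ∷ u' , ~trans (++-congˡ (s ∷ []) u'~)
      (~trans (square s _) (~reflexive (List.++-assoc t (s ∷ []) u))) , s≤s u'<u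

  ℓ-downˡ : ∀ u {t β} → ReflectionIn β t → Pos β → Neg (iact u β) → ℓ (t ++ u) < ℓ u
  ℓ-downˡ u {t} {β} ρ p q with reduce u
  ... | v , v~u , v-red with strong-exchange v ρ p (Neg-resp (iact-respects-~ (~sym v~u) β) q)
  ...   | w , w~ , w<v = begin-strict
    ℓ (t ++ u)   ≡⟨ ℓ-respects-~ (++-congˡ t v~u) ⟨
    ℓ (t ++ v)   ≡⟨ ℓ-respects-~ w~ ⟨
    ℓ w          ≤⟨ ℓ-≤-length w ⟩
    + length w   <⟨ +<+ w<v ⟩
    + length v   ≡⟨ v-red ⟨
    ℓ v          ≡⟨ ℓ-respects-~ v~u ⟩
    ℓ u          ∎
    where open ℤ.≤-Reasoning

  ℓ-upˡ : ∀ u {t β} → ReflectionIn β t → Pos β → Pos (iact u β) → ℓ u < ℓ (t ++ u)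
  ℓ-upˡ u {t} {β} ρ p q = subst (_< ℓ (t ++ u)) (ℓ-respects-~ (~trans (~reflexive (sym (List.++-assoc t t u)))
      (++-congʳ u (reflection-square (isReflection ρ)))))
    (ℓ-downˡ (t ++ u) ρ p (Pos⇒Neg (λ j → trans (cong (λ f → f j) (iact-++ t u β))
      (trans (iact-cong u (reflection-neg ρ) j) (iact-neg u β j))) q))

  ℓ-reverse-++ : ∀ u {t} → IsReflection t → ℓ (t ++ reverse u) ≡ ℓ (u ++ t)
  ℓ-reverse-++ u {t} h = trans (ℓ-respects-~ (++-congʳ (reverse u) (~sym (reflection-involutive h))))
    (trans (cong ℓ (sym (List.reverse-++ u t))) (ℓ-reverse (u ++ t)))

  ℓ-down : ∀ u {t β} → ReflectionIn β t → Pos β → Neg (act u β) → ℓ (u ++ t) < ℓ u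
  ℓ-down u {t} {β} ρ p q = subst₂ _<_ (ℓ-reverse-++ u (isReflection ρ)) (ℓ-reverse u)
    (ℓ-downˡ (reverse u) ρ p (subst Neg (sym (iact-reverse′ u β)) q))

  ℓ-up : ∀ u {t β} → ReflectionIn β t → Pos β → Pos (act u β) → ℓ u < ℓ (u ++ t)
  ℓ-up u {t} {β} ρ p q = subst₂ _<_ (ℓ-reverse u) (ℓ-reverse-++ u (isReflection ρ))
    (ℓ-upˡ (reverse u) ρ p (subst Pos (sym (iact-reverse′ u β)) q))

  up⇒Pos : ∀ u {t β} → ReflectionIn β t → Pos β → ℓ u < ℓ (u ++ t) → Pos (act u β)
  up⇒Pos u ρ p h = [ id , (λ q → contradiction (ℓ-down u ρ p q) (ℤ.<-asym h)) ]′ (Root-sign (Root-act u (isRoot ρ)))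

  down⇒Neg : ∀ u {t β} → ReflectionIn β t → Pos β → ℓ (u ++ t) < ℓ u → Neg (act u β)
  down⇒Neg u ρ p h = [ (λ q → contradiction (ℓ-up u ρ p q) (ℤ.<-asym h)) , id ]′ (Root-sign (Root-act u (isRoot ρ)))

  ℓ-up-simple : ∀ u s → Pos (act u (unit s)) → ℓ (u ++ s ∷ []) ≡ ℓ u + 1ℤ
  ℓ-up-simple u s p = trans (sym (ℓ-reverse-++ u (isReflection (reflection-simple s))))
    (trans (ℓ-ascent s (reverse u) (subst Pos (sym (iact-reverse′ u (unit s))) p)) (cong (_+ 1ℤ) (ℓ-reverse u)))

  ℓ-down-simple : ∀ u s → Neg (act u (unit s)) → ℓ (u ++ s ∷ []) ≡ ℓ u - 1ℤ
  ℓ-down-simple u s p = trans (sym (ℓ-reverse-++ u (isReflection (reflection-simple s))))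
    (trans (ℓ-descent s (reverse u) (subst Neg (sym (iact-reverse′ u (unit s))) p)) (cong (_- 1ℤ) (ℓ-reverse u)))

  ℓ<⇒< : ∀ {u v} → ℓ u < ℓ v → u ℓ< v
  ℓ<⇒< {u} {v} h with hasLength u | hasLength v
  ... | k , hk , ek | l , hl , el = k , l , hk , hl , ℤ.drop‿+<+ (subst₂ _<_ ek el h)

  <⇒ℓ< : ∀ {u v} → u ℓ< v → ℓ u < ℓ v
  <⇒ℓ< (k , l , hk , hl , k<l) = subst₂ _<_ (sym (HasLength⇒ℓ hk)) (sym (HasLength⇒ℓ hl)) (+<+ k<l)

  step : ∀ {u t v} → IsReflection t → v ~ (u ++ t) → ℓ u < ℓ v → BStep u v
  step {t = t} h p l = t , h , p , ℓ<⇒< l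

  BStep⇒< : ∀ {u v} → BStep u v → ℓ u < ℓ v
  BStep⇒< (_ , _ , _ , l) = <⇒ℓ< l

  BStep-respʳ : ∀ {u v v'} → v ~ v' → BStep u v → BStep u v'
  BStep-respʳ p (t , h , q , l) = step h (~trans (~sym p) q) (subst (_ <_) (ℓ-respects-~ p) (<⇒ℓ< l))

  ≤B-reflexive : ∀ {u v} → u ~ v → u ≤B v
  ≤B-reflexive {v = v} p = v , p , ε

  ≤B-respˡ : ∀ {u u' v} → u ~ u' → u ≤B v → u' ≤B v
  ≤B-respˡ p (x , q , c) = x , ~trans (~sym p) q , c

  ≤B-cons : ∀ {u v w} → BStep u v → v ≤B w → u ≤B w
  ≤B-cons b (x , q , c) = _ , ~refl , BStep-respʳ q b ◅ c

  chain-respʳ : ∀ {u v v'} → v ~ v' → Star BStep u v → u ≤B v'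
  chain-respʳ p ε = ≤B-reflexive p
  chain-respʳ p (b ◅ c) = ≤B-cons b (chain-respʳ p c)

  ≤B-respʳ : ∀ {u v v'} → v ~ v' → u ≤B v → u ≤B v'
  ≤B-respʳ p (x , q , c) = ≤B-respˡ (~sym q) (chain-respʳ p c)

  chain-trans : ∀ {u v w} → Star BStep u v → v ≤B w → u ≤B w
  chain-trans ε q = q
  chain-trans (b ◅ c) q = ≤B-cons b (chain-trans c q)

  ≤B-trans : ∀ {u v w} → u ≤B v → v ≤B w → u ≤B w
  ≤B-trans (x , p , c) q = ≤B-respˡ (~sym p) (chain-trans c q)

  ≤B-step : ∀ {u v} → BStep u v → u ≤B v
  ≤B-step b = _ , ~refl , b ◅ ε

  cancel-letter : ∀ u s → ((u ++ s ∷ []) ++ s ∷ []) ~ u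
  cancel-letter u s = ~trans (~reflexive (List.++-assoc u (s ∷ []) (s ∷ [])))
      (~trans (++-congˡ u (square s [])) (~reflexive (List.++-identityʳ u)))

  simple-refl : ∀ s → IsReflection (s ∷ [])
  simple-refl s = isReflection (reflection-simple s)

  ≤B-up : ∀ u s → ℓ u < ℓ (u ++ s ∷ []) → u ≤B (u ++ s ∷ [])
  ≤B-up u s h = ≤B-step (step (simple-refl s) ~refl h)

  ≤B-down : ∀ u s → ℓ (u ++ s ∷ []) < ℓ u → (u ++ s ∷ []) ≤B u
  ≤B-down u s h = ≤B-step (step (simple-refl s) (~sym (cancel-letter u s)) h)

  -- For t ≠ s the root sβ of s t s is still positive, and x s sends it to xβ, which is positive.
  step-right : ∀ {x y} s → BStep x y → y ~ (x ++ s ∷ []) ⊎ BStep (x ++ s ∷ []) (y ++ s ∷ [])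
  step-right {x} {y} s (t , h , q , l) = [
      (λ e → inj₁ (~trans q (++-congˡ x (same-reflection e ρ (reflection-simple s))))) ,
      (λ p' → inj₂ (step (isReflection ρ') regroup
      (subst (ℓ (x ++ s ∷ []) <_) (ℓ-respects-~ (~sym regroup)) (ℓ-up (x ++ s ∷ []) ρ' p'
        (Pos-resp (λ j → sym (trans (cong (λ f → f j) (act-++ x (s ∷ []) (reflect s β)))
            (act-cong x (reflect-involutive s β) j)))
          (up⇒Pos x ρ p (subst (ℓ x <_) (ℓ-respects-~ q) (<⇒ℓ< l))))))))
      ]′ (reflect-Pos s (isRoot ρ) p)
    where
    β = proj₁ (positive-root h)
    ρ = proj₁ (proj₂ (positive-root h))
    p = proj₂ (proj₂ (positive-root h))
    ρ' = reflection-conj (s ∷ []) ρ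
    regroup : (y ++ s ∷ []) ~ ((x ++ s ∷ []) ++ s ∷ t ++ s ∷ [])
    regroup = begin
      y ++ s ∷ []                            ≈⟨ ++-congʳ (s ∷ []) q ⟩
      (x ++ t) ++ s ∷ []                     ≡⟨ List.++-assoc x t _ ⟩
      x ++ t ++ s ∷ []                       ≈⟨ ++-congˡ x (square s _) ⟨
      x ++ s ∷ s ∷ t ++ s ∷ []               ≡⟨ List.++-assoc x (s ∷ []) _ ⟨
      (x ++ s ∷ []) ++ s ∷ t ++ s ∷ []       ∎
      where open ~-Reasoning

  lift-any : ∀ {x y} s → Star BStep x y → (x ++ s ∷ []) ≤B y ⊎ (x ++ s ∷ []) ≤B (y ++ s ∷ [])
  lift-any s ε = inj₂ (≤B-reflexive ~refl)
  lift-any s (b ◅ c) =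
    [ (λ e → inj₁ (_ , ~sym e , c)) , (λ b' → [ inj₁ ∘ ≤B-cons b' , inj₂ ∘ ≤B-cons b' ]′ (lift-any s c)) ]′ (step-right s b)

  ℓ-simple-≢ : ∀ u s → ℓ (u ++ s ∷ []) < ℓ u ⊎ ℓ u < ℓ (u ++ s ∷ [])
  ℓ-simple-≢ u s = [ inj₂ ∘ ℓ-up u (reflection-simple s) (unit-Pos s) , inj₁ ∘ ℓ-down u (reflection-simple s) (unit-Pos s) ]′
    (Root-sign (Root-act u (Root-unit s)))

  -- The lifting property, by induction on the chain. If the next element z is x s, then s is a
  -- descent of z and the claim for it is what the ascent s of x requires; otherwise the step x → z
  -- can be multiplied by s.
  lift-descent : ∀ {x y} s → Star BStep x y → ℓ (y ++ s ∷ []) < ℓ y →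
    (ℓ (x ++ s ∷ []) < ℓ x → (x ++ s ∷ []) ≤B (y ++ s ∷ [])) × (ℓ x < ℓ (x ++ s ∷ []) → x ≤B (y ++ s ∷ []))
  lift-descent s ε ys<y = (λ _ → ≤B-reflexive ~refl) , λ y<ys → contradiction y<ys (ℤ.<-asym ys<y)
  lift-descent {x} s (_◅_ {j = z} b c) ys<y = [ same , other ]′ (step-right s b)
    where
    Goal = (ℓ (x ++ s ∷ []) < ℓ x → (x ++ s ∷ []) ≤B _) × (ℓ x < ℓ (x ++ s ∷ []) → x ≤B _)
    down = proj₁ (lift-descent s c ys<y)
    up = proj₂ (lift-descent s c ys<y)
    same : z ~ (x ++ s ∷ []) → Goal
    same z~xs =
      (λ xs<x → contradiction xs<x (ℤ.<-asym (subst (ℓ x <_) (ℓ-respects-~ z~xs) (BStep⇒< b)))) ,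
      (λ x<xs → ≤B-respˡ zs~x (down (subst₂ _<_ (ℓ-respects-~ (~sym zs~x)) (ℓ-respects-~ (~sym z~xs)) x<xs)))
      where
      zs~x : (z ++ s ∷ []) ~ x
      zs~x = ~trans (++-congʳ (s ∷ []) z~xs) (cancel-letter x s)
    other : BStep (x ++ s ∷ []) (z ++ s ∷ []) → Goal
    other b' = [ (λ zs<z → (λ _ → ≤B-cons b' (down zs<z)) , λ x<xs → ≤B-trans (≤B-up x s x<xs) (≤B-cons b' (down zs<z)))
               , (λ z<zs → (λ xs<x → ≤B-trans (≤B-down x s xs<x) (≤B-cons b (up z<zs))) , λ _ → ≤B-cons b (up z<zs)) ]′
               (ℓ-simple-≢ z s)

-- Minimal elements of AD(u, v)

nonneg-* : ∀ {a b} → 0ℤ ≤ a → 0ℤ ≤ b → 0ℤ ≤ a * b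
nonneg-* {+ a} {+ b} _ _ = subst (0ℤ ≤_) (ℤ.pos-* a b) (+≤+ z≤n)

module Lifting {n : ℕ} (M : CoxeterMatrix n) (simply-laced : Coxeter.SimplyLaced M) where
  open Bruhat M simply-laced public

  infixl 25 _▷_
  _▷_ : Word → Fin n → Word
  u ▷ s = u ++ s ∷ []

  ≤B-any : ∀ {u v} s → u ≤B v → u ▷ s ≤B v ⊎ u ▷ s ≤B v ▷ s
  ≤B-any s (x , p , c) = [ inj₁ ∘ ≤B-respˡ xs~us , inj₂ ∘ ≤B-respˡ xs~us ]′ (lift-any s c)
    where xs~us = ++-congʳ (s ∷ []) (~sym p)

  ≤B-descent : ∀ {u v} s → u ≤B v → ℓ (v ▷ s) < ℓ v → ℓ (u ▷ s) < ℓ u → u ▷ s ≤B v ▷ s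
  ≤B-descent s (x , p , c) vs<v us<u = ≤B-respˡ (++-congʳ (s ∷ []) (~sym p))
    (proj₁ (lift-descent s c vs<v) (subst₂ _<_ (ℓ-respects-~ (++-congʳ (s ∷ []) p)) (ℓ-respects-~ p) us<u))

  ≤B-ascent : ∀ {u v} s → u ≤B v → ℓ (v ▷ s) < ℓ v → ℓ u < ℓ (u ▷ s) → u ≤B v ▷ s
  ≤B-ascent s (x , p , c) vs<v u<us = ≤B-respˡ (~sym p)
    (proj₂ (lift-descent s c vs<v) (subst₂ _<_ (ℓ-respects-~ p) (ℓ-respects-~ (++-congʳ (s ∷ []) p)) u<us))

  act-▷ : ∀ u s x → act (u ▷ s) x ≗ act u (reflect s x)
  act-▷ u s x j = cong (λ f → f j) (act-++ u (s ∷ []) x)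

  act-▷-unit : ∀ u s → act (u ▷ s) (unit s) ≗ neg (act u (unit s))
  act-▷-unit u s j = trans (act-▷ u s (unit s) j) (trans (act-cong u (reflect-unit s) j) (act-neg u (unit s) j))

  ℓ-nonneg : ∀ w → 0ℤ ≤ ℓ w
  ℓ-nonneg w with hasLength w
  ... | k , _ , e = subst (0ℤ ≤_) (sym e) (+≤+ z≤n)

  ≤B⇒ℓ≤ : ∀ {u v} → u ≤B v → ℓ u ≤ ℓ v
  ≤B⇒ℓ≤ (x , p , c) = subst (_≤ _) (ℓ-respects-~ (~sym p)) (go c)
    where
    go : ∀ {x y} → Star BStep x y → ℓ x ≤ ℓ y
    go ε = ℤ.≤-refl
    go (b ◅ c) = ℤ.≤-trans (ℤ.<⇒≤ (BStep⇒< b)) (go c)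

  ≤B-ε : ∀ {u v} → v ~ [] → u ≤B v → u ~ v
  ≤B-ε {u} {v} p h with reduce u
  ... | [] , q , _ = ~trans (~sym q) (~sym p)
  ... | s ∷ w , q , r with ℤ.≤-trans (ℤ.≤-reflexive (trans (sym r) (ℓ-respects-~ q)))
      (ℤ.≤-trans (≤B⇒ℓ≤ h) (ℤ.≤-reflexive (ℓ-respects-~ p)))
  ...   | +≤+ ()

  -- AD(u, v) through positive roots: by `ℓ-up` and `ℓ-down`, the signs of uβ and vβ decide whether
  -- the reflection in β is an ascent or a descent.
  record AD (u v : Word) (β : Vector n) : Set where
    constructor ad
    field
      isRoot : Root β
      pos : Pos β
      ascends : Pos (act u β)
      descends : Neg (act v β)

  -- Only α_s could lose its positivity under s, and α_s lies in AD(us, vs) only if s is a descent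
  -- of u and an ascent of v.
  AD-reflect : ∀ {u v β} s → ¬ AD u v (unit s) → ¬ (Neg (act u (unit s)) × Pos (act v (unit s))) →
               AD (u ▷ s) (v ▷ s) β → AD u v (reflect s β)
  AD-reflect {u} {v} {β} s not-AD not-DA (ad ρ p a d) = [ (λ e → ⊥-elim (not-simple e)) , (λ p' → ad (Root-reflect s ρ) p'
      (Pos-resp (act-▷ u s β) a) (Neg-resp (act-▷ v s β) d)) ]′ (reflect-Pos s ρ p)
    where
    not-simple : ¬ β ≗ unit s
    not-simple e = not-DA
      ( Pos⇒Neg (λ j → trans (sym (ℤ.neg-involutive _)) (cong -_ (sym (act-▷-unit u s j)))) (Pos-resp (act-cong (u ▷ s) e) a)
      , Neg⇒Pos (λ j → trans (sym (ℤ.neg-involutive _)) (cong -_ (sym (act-▷-unit v s j))))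
          (Neg-resp (act-cong (v ▷ s) e) d))

  right-descent : ∀ v → v ~ [] ⊎ ∃[ s ] Neg (act v (unit s))
  right-descent v with Fin.any? (λ s → Fin.all? (λ j → act v (unit s) j ℤ.≤? 0ℤ))
  ... | yes h = inj₂ h
  ... | no none = inj₁ (~trans (~reflexive (sym (List.reverse-involutive v)))
      (reverse-cong {u = reverse v} {v = []} (faithful λ s →
          subst Pos (sym (iact-reverse′ v (unit s))) ([ id , (λ q → contradiction (s , q) none) ]′
              (Root-sign (Root-act v (Root-unit s)))))))

  unit-sign : ∀ u s → Pos (act u (unit s)) ⊎ Neg (act u (unit s))
  unit-sign u s = Root-sign (Root-act u (Root-unit s))

  up-simple : ∀ u s → Pos (act u (unit s)) → ℓ u < ℓ (u ▷ s)
  up-simple u s = ℓ-up u (reflection-simple s) (unit-Pos s)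

  down-simple : ∀ u s → Neg (act u (unit s)) → ℓ (u ▷ s) < ℓ u
  down-simple u s = ℓ-down u (reflection-simple s) (unit-Pos s)

  -- A right descent s of v is either an ascent of u, and then α_s qualifies, or it can be cancelled
  -- from both u and v, which shortens v.
  AD-nonempty : ∀ k {u v} → ℓ v ≤ + k → u ≤B v → ¬ u ~ v → ∃[ β ] AD u v β
  AD-nonempty k {u} {v} v≤k u≤v u≁v = [ (λ v~ε → ⊥-elim (u≁v (≤B-ε v~ε u≤v))) ,
      (λ (s , d) → [ simple s d , both s d k v≤k ]′ (unit-sign u s)) ]′ (right-descent v)
    where
    simple : ∀ s → Neg (act v (unit s)) → Pos (act u (unit s)) → ∃[ β ] AD u v β
    simple s d a = unit s , ad (Root-unit s) (unit-Pos s) a d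
    both : ∀ s → Neg (act v (unit s)) → ∀ k → ℓ v ≤ + k → Neg (act u (unit s)) → ∃[ β ] AD u v β
    both s d zero v≤0 a =
      contradiction (ℤ.<-≤-trans (ℤ.≤-<-trans (ℓ-nonneg (v ▷ s)) (down-simple v s d)) v≤0) λ { (+<+ ()) }
    both s d (suc k) v≤k a = reflect s (proj₁ ih) , AD-reflect s
        (λ h' → Pos-Neg (Root-act u (Root-unit s)) (AD.ascends h') a)
        (λ (_ , q) → Pos-Neg (Root-act v (Root-unit s)) q d) (proj₂ ih)
      where
      ih : ∃[ β ] AD (u ▷ s) (v ▷ s) β
      ih = AD-nonempty k (ℤ.≤-trans (ℤ.≤-reflexive (ℓ-down-simple v s d)) (ℤ.+-monoˡ-≤ -1ℤ v≤k))
        (≤B-descent s u≤v (down-simple v s d) (down-simple u s a)) (λ q → u≁v (∙-cancelʳ (s ∷ []) u v q))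

  ht-reflect : ∀ s x → ht (reflect s x) ≡ ht x - pair x s
  ht-reflect s x = trans (sum-axpy x (unit s) (- pair x s))
      (cong (_+_ (ht x)) (trans (cong (_*_ (- pair x s)) (ht-unit s)) (ℤ.*-identityʳ _)))

  -- The numbers β_i ⟨β , α_i⟩ add up to the norm 2, and β_i ≥ 0.
  positive-pairing : ∀ {β} → Root β → Pos β → ∃[ s ] 0ℤ < pair β s
  positive-pairing {β} ρ p with Fin.any? (λ s → 0ℤ ℤ.<? pair β s)
  ... | yes h = h
  ... | no none =
      contradiction (subst (0ℤ ≤_) (trans (sum-neg (λ i → β i * pair β i)) (cong -_ (Root-norm ρ)))
        (sum-nonneg (λ i → - (β i * pair β i)) λ i → subst (0ℤ ≤_) (sym (ℤ.neg-distribʳ-* (β i) (pair β i)))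
          (nonneg-* (p i) (ℤ.neg-mono-≤ (ℤ.≮⇒≥ λ h → none (i , h)))))) λ ()

  -- The consequence of finiteness on which the induction on heights rests; besides it, finiteness
  -- serves to find a minimal root.
  Bounded : Set
  Bounded = ∀ {β} s → Root β → Pos β → ¬ β ≗ unit s → pair β s ≤ 1ℤ

  Minimal : Word → Word → Vector n → Set
  Minimal u v β = ∀ {γ} → AD u v γ → ht β ≤ ht γ

  record Good (u v t : Word) : Set where
    field
      ut≤v : (u ++ t) ≤B v
      u≤vt : u ≤B (v ++ t)
      ℓ-ut : ℓ (u ++ t) ≡ ℓ u + 1ℤ
      ℓ-vt : ℓ (v ++ t) ≡ ℓ v - 1ℤ

  Good-resp : ∀ {u v t t'} → t ~ t' → Good u v t → Good u v t'
  Good-resp {u} {v} p g = record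
    { ut≤v = ≤B-respˡ (++-congˡ u p) (Good.ut≤v g)
    ; u≤vt = ≤B-respʳ (++-congˡ v p) (Good.u≤vt g)
    ; ℓ-ut = trans (ℓ-respects-~ (++-congˡ u (~sym p))) (Good.ℓ-ut g)
    ; ℓ-vt = trans (ℓ-respects-~ (++-congˡ v (~sym p))) (Good.ℓ-vt g) }

  Good-simple : ∀ {u v} s → u ≤B v → AD u v (unit s) → Good u v (s ∷ [])
  Good-simple {u} {v} s u≤v (ad _ _ a d) = record
    { ut≤v = [ id , (λ us≤vs → ≤B-trans us≤vs (≤B-down v s (down-simple v s d))) ]′ (≤B-any s u≤v)
    ; u≤vt = ≤B-ascent s u≤v (down-simple v s d) (up-simple u s a)
    ; ℓ-ut = ℓ-up-simple u s a
    ; ℓ-vt = ℓ-down-simple v s d }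

  module Descent (bounded : Bounded) where

    -- Induction on ht β: for a simple s with ⟨β , α_s⟩ = 1, minimality of β forces s to be a descent of both
    -- or of neither of u and v, and one passes to the interval [us, vs] and the reflection in β - α_s.
    minimal-Good : ∀ k {u v β t} → ht β ≤ + k → u ≤B v → AD u v β → Minimal u v β → ReflectionIn β t → Good u v t
    minimal-Good zero β≤0 u≤v (ad ρ p _ _) minimal τ =
      contradiction (ℤ.<-≤-trans (ht-positive ρ p) β≤0) λ { (+<+ ()) }
    minimal-Good (suc k) {u} {v} {β} {t} β≤k u≤v β-AD minimal τ = [ simple , nonsimple ]′ (reflect-Pos s ρ p)
      where
      open AD β-AD renaming (isRoot to ρ; pos to p; ascends to a; descends to d)
      s = proj₁ (positive-pairing ρ p)
      simple : β ≗ unit s → Good u v t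
      simple e = Good-resp (same-reflection (λ j → sym (e j)) (reflection-simple s) τ) (Good-simple s u≤v
        (ad (Root-unit s) (unit-Pos s) (Pos-resp (act-cong u e) a) (Neg-resp (act-cong v e) d)))
      nonsimple : Pos (reflect s β) → Good u v t
      nonsimple γ-pos = cases (unit-sign u s) (unit-sign v s)
        where
        γ = reflect s β
        ρ' = Root-reflect s ρ
        β≢α : ¬ β ≗ unit s
        β≢α e = Pos-Neg ρ' γ-pos (Pos⇒Neg (λ j → trans (reflect-cong s e j) (reflect-unit s j)) (unit-Pos s))
        pairing : pair β s ≡ 1ℤ
        pairing = ℤ.≤-antisym (bounded s ρ p β≢α) (ℤ.i<j⇒suc[i]≤j (proj₂ (positive-pairing ρ p)))
        γ≗ : γ ≗ axpy β -1ℤ (unit s)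
        γ≗ j = cong (λ c → β j + - c * unit s j) pairing
        ht-γ : ht γ ≡ ht β - 1ℤ
        ht-γ = trans (ht-reflect s β) (cong (_-_ (ht β)) pairing)
        ht-γ<ht-β : ht γ < ht β
        ht-γ<ht-β = subst (_< ht β) (sym ht-γ) (subst (ht β - 1ℤ <_) (ℤ.+-identityʳ _)
            (ℤ.+-monoʳ-< (ht β) {x = -1ℤ} {y = 0ℤ} ℤ.-<+))
        γ-not-AD : ¬ AD u v γ
        γ-not-AD h = ℤ.<⇒≱ ht-γ<ht-β (minimal h)
        act-γ : ∀ w → act w γ ≗ axpy (act w β) -1ℤ (act w (unit s))
        act-γ w j = trans (act-cong w γ≗ j) (act-axpy w β -1ℤ (unit s) j)
        pos-γ : ∀ w → Pos (act w β) → Neg (act w (unit s)) → Pos (act w γ)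
        pos-γ w x y j = subst (0ℤ ≤_) (sym (trans (act-γ w j) (cong (_+_ (act w β j)) (ℤ.-1*i≡-i _))))
            (ℤ.+-mono-≤ (x j) (ℤ.neg-mono-≤ (y j)))
        neg-γ : ∀ w → Neg (act w β) → Pos (act w (unit s)) → Neg (act w γ)
        neg-γ w x y j = subst (_≤ 0ℤ) (sym (trans (act-γ w j) (cong (_+_ (act w β j)) (ℤ.-1*i≡-i _))))
            (ℤ.+-mono-≤ (x j) (ℤ.neg-mono-≤ (y j)))
        -- Because t α_s = α_s - β = -γ, the sign of wγ tells whether s is a descent of w t.
        act-t : ∀ w → act (w ++ t) (unit s) ≗ neg (act w γ)
        act-t w j = trans (cong (λ f → f j) (act-++ w t (unit s)))
            (trans (act-cong w (λ i → trans (reflection-act τ (unit s) i)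
            (trans (cong (λ c → unit s i + - c * β i) (trans (form-unitˡ s β) pairing))
                (trans (swap (unit s i) (β i)) (cong -_ (sym (γ≗ i)))))) j)
          (act-neg w γ j))
          where
          swap : ∀ a b → a + -1ℤ * b ≡ - (b + -1ℤ * a)
          swap = solve-∀
        t' = s ∷ t ▷ s
        τ' : ReflectionIn γ t'
        τ' = reflection-conj (s ∷ []) τ
        regroup : ∀ w → ((w ▷ s) ++ t') ~ ((w ++ t) ▷ s)
        regroup w = ~trans (~reflexive (List.++-assoc w (s ∷ []) t'))
            (~trans (++-congˡ w (square s _)) (~reflexive (sym (List.++-assoc w t _))))
        back : ∀ w → ((w ▷ s) ▷ s) ~ w
        back w = cancel-letter w s
        inner : u ▷ s ≤B v ▷ s → ¬ AD u v (unit s) → ¬ (Neg (act u (unit s)) × Pos (act v (unit s))) → Good (u ▷ s)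
            (v ▷ s) t'
        inner us≤vs not-AD not-DA = minimal-Good k (subst (_≤ + k) (sym ht-γ) (ℤ.+-monoˡ-≤ -1ℤ β≤k)) us≤vs γ-AD γ-minimal τ'
          where
          γ-AD : AD (u ▷ s) (v ▷ s) γ
          γ-AD = ad ρ' γ-pos
            (Pos-resp (λ j → sym (trans (act-▷ u s γ j) (act-cong u (reflect-involutive s β) j))) a)
            (Neg-resp (λ j → sym (trans (act-▷ v s γ j) (act-cong v (reflect-involutive s β) j))) d)
          -- For δ in AD(us, vs) the root sδ is in AD(u, v), whence ht δ = ht sδ - ⟨sδ , α_s⟩ ≥ ht β
          -- - 1. This applies the bound on pairings to sδ and not to β.
          γ-minimal : Minimal (u ▷ s) (v ▷ s) γ
          γ-minimal {δ} δ-AD = subst (_≤ ht δ) (sym ht-γ) (ℤ.≤-trans (ℤ.+-mono-≤ (minimal sδ-AD) (ℤ.neg-mono-≤ -pairing≤1))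
              (ℤ.≤-reflexive (trans (cong₂ _-_ (ht-reflect s δ) pair-sδ) (cancel (ht δ) (pair δ s)))))
            where
            sδ = reflect s δ
            sδ-AD : AD u v sδ
            sδ-AD = AD-reflect s not-AD not-DA δ-AD
            -pairing≤1 : pair sδ s ≤ 1ℤ
            -pairing≤1 = bounded s (AD.isRoot sδ-AD) (AD.pos sδ-AD) λ e → Pos-Neg (AD.isRoot δ-AD) (AD.pos δ-AD)
              (Pos⇒Neg (λ j → trans (sym (reflect-involutive s δ j)) (trans (reflect-cong s e j) (reflect-unit s j)))
                  (unit-Pos s))
            pair-sδ : pair sδ s ≡ - pair δ s
            pair-sδ = trans (pair-axpy δ (- pair δ s) (unit s) s)
                (trans (cong (λ b → pair δ s + - pair δ s * b) (trans (pair-unit s s) (B-diag s))) (simplify (pair δ s)))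
              where
              simplify : ∀ c → c + - c * + 2 ≡ - c
              simplify = solve-∀
            cancel : ∀ h c → h - c - - c ≡ h
            cancel = solve-∀
        cases : Pos (act u (unit s)) ⊎ Neg (act u (unit s)) → Pos (act v (unit s)) ⊎ Neg (act v (unit s)) → Good u v t
        -- Here α_s itself would be an element of AD(u, v) lower than β.
        cases (inj₁ x) (inj₂ y) = contradiction (minimal (ad (Root-unit s) (unit-Pos s) x y))
          (ℤ.<⇒≱ (subst (_< ht β) (sym (ht-unit s)) (ℤ.≤-<-trans (ℤ.i<j⇒suc[i]≤j (ht-positive ρ' γ-pos)) ht-γ<ht-β)))
        cases (inj₂ x) (inj₁ y) = contradiction (ad ρ' γ-pos (pos-γ u a x) (neg-γ v d y)) γ-not-AD
        cases (inj₂ x) (inj₂ y) = record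
          { ut≤v = [ ≤B-respˡ (back (u ++ t)) ∘ (λ h → ≤B-trans h (≤B-down v s (down-simple v s y)))
                   , ≤B-respˡ (back (u ++ t)) ∘ ≤B-respʳ (back v) ]′ (≤B-any s (≤B-respˡ (regroup u) (Good.ut≤v g)))
          ; u≤vt = [ (λ h → ≤B-respˡ (back u) (≤B-trans h (≤B-down (v ++ t) s (down-simple (v ++ t) s vt-neg))))
                   , ≤B-respˡ (back u) ∘ ≤B-respʳ (back (v ++ t)) ]′ (≤B-any s (≤B-respʳ (regroup v) (Good.u≤vt g)))
          ; ℓ-ut = shift (ℓ u) 1ℤ (ℓ-down-simple (u ++ t) s ut-neg) (ℓ-down-simple u s x)
              (trans (sym (ℓ-respects-~ (regroup u))) (Good.ℓ-ut g))
          ; ℓ-vt = shift (ℓ v) (- 1ℤ) (ℓ-down-simple (v ++ t) s vt-neg) (ℓ-down-simple v s y)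
              (trans (sym (ℓ-respects-~ (regroup v))) (Good.ℓ-vt g)) }
          where
          g = inner (≤B-descent s u≤v (down-simple v s y) (down-simple u s x))
            (λ h → Pos-Neg (Root-act u (Root-unit s)) (AD.ascends h) x) (λ (_ , q) → Pos-Neg (Root-act v (Root-unit s)) q y)
          -- uγ = uβ - uα_s is positive, so a negative vγ would put γ into AD(u, v), although it is
          -- lower than β.
          vγ-pos : Pos (act v γ)
          vγ-pos = [ id , (λ q → contradiction (ad ρ' γ-pos (pos-γ u a x) q) γ-not-AD) ]′ (Root-sign (Root-act v ρ'))
          ut-neg = Pos⇒Neg (act-t u) (pos-γ u a x)
          vt-neg = Pos⇒Neg (act-t v) vγ-pos
          shift : ∀ {A A' C'} C e → A' ≡ A - 1ℤ → C' ≡ C - 1ℤ → A' ≡ C' + e → A ≡ C + e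
          shift {A} C e refl refl h = trans (split A) (trans (cong (_+ 1ℤ) h) (merge C e))
            where
            split : ∀ A → A ≡ A - 1ℤ + 1ℤ
            split = solve-∀
            merge : ∀ C e → C - 1ℤ + e + 1ℤ ≡ C + e
            merge = solve-∀
        cases (inj₁ x) (inj₁ y) = record
          { ut≤v = ≤B-respˡ (back (u ++ t)) (≤B-respʳ (back v)
              (≤B-descent s (≤B-respˡ (regroup u) (Good.ut≤v g)) (drop v (up-simple v s y))
              (drop (u ++ t) (up-simple (u ++ t) s ut-pos))))
          ; u≤vt = ≤B-respˡ (back u) (≤B-respʳ (back (v ++ t))
              (≤B-descent s (≤B-respʳ (regroup v) (Good.u≤vt g)) (drop (v ++ t) (up-simple (v ++ t) s vt-pos))
              (drop u (up-simple u s x))))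
          ; ℓ-ut = shift (ℓ u) 1ℤ (ℓ-up-simple (u ++ t) s ut-pos) (ℓ-up-simple u s x)
              (trans (sym (ℓ-respects-~ (regroup u))) (Good.ℓ-ut g))
          ; ℓ-vt = shift (ℓ v) (- 1ℤ) (ℓ-up-simple (v ++ t) s vt-pos) (ℓ-up-simple v s y)
              (trans (sym (ℓ-respects-~ (regroup v))) (Good.ℓ-vt g)) }
          where
          g = inner ([ (λ us≤v → ≤B-trans us≤v (≤B-up v s (up-simple v s y))) , id ]′ (≤B-any s u≤v))
            (λ h → Pos-Neg (Root-act v (Root-unit s)) y (AD.descends h)) (λ (q , _) → Pos-Neg (Root-act u (Root-unit s)) x q)
          uγ-neg : Neg (act u γ)
          uγ-neg = [ (λ q → contradiction (ad ρ' γ-pos q (neg-γ v d y)) γ-not-AD) , id ]′ (Root-sign (Root-act u ρ'))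
          ut-pos = Neg⇒Pos (act-t u) uγ-neg
          vt-pos = Neg⇒Pos (act-t v) (neg-γ v d y)
          drop : ∀ w → ℓ w < ℓ (w ▷ s) → ℓ ((w ▷ s) ▷ s) < ℓ (w ▷ s)
          drop w = subst (_< ℓ (w ▷ s)) (ℓ-respects-~ (~sym (back w)))
          shift : ∀ {A A' C'} C e → A' ≡ A + 1ℤ → C' ≡ C + 1ℤ → A' ≡ C' + e → A ≡ C + e
          shift {A} C e refl refl h = trans (split A) (trans (cong (_- 1ℤ) h) (merge C e))
            where
            split : ∀ A → A ≡ A + 1ℤ - 1ℤ
            split = solve-∀
            merge : ∀ C e → C + 1ℤ + e - 1ℤ ≡ C + e
            merge = solve-∀

-- Finite simply-laced groups

i≤+∣i∣ : ∀ i → i ≤ + ℤ.∣ i ∣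
i≤+∣i∣ (+ _) = ℤ.≤-refl
i≤+∣i∣ -[1+ _ ] = -≤+

finite-bound : ∀ {n} (f : Fin n → ℤ) → ∃[ b ] (∀ i → f i ≤ + b)
finite-bound {zero} f = 0 , λ ()
finite-bound {suc n} f = ℤ.∣ f zero ∣ ℕ.+ b , λ where
    zero → ℤ.≤-trans (i≤+∣i∣ (f zero)) (+≤+ (ℕ.m≤m+n _ b))
    (suc i) → ℤ.≤-trans (h i) (+≤+ (ℕ.m≤n+m b _))
  where
  b = proj₁ (finite-bound (f ∘ suc))
  h = proj₂ (finite-bound (f ∘ suc))

module FiniteGLP {n : ℕ} (M : CoxeterMatrix n) (simply-laced : Coxeter.SimplyLaced M) where
  open Lifting M simply-laced public
  open ReflectionIn using (isReflection)

  height-bound : (L : List Word) → ∃[ H ] (∀ {w} s → Any (w ~_) L → ht (act w (unit s)) ≤ + H)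
  height-bound [] = 0 , λ _ ()
  height-bound (v ∷ L) = b ℕ.+ H , λ where
      s (here p) → ℤ.≤-trans (ℤ.≤-reflexive (sum-cong-≗ (act-respects-~ p (unit s)))) (ℤ.≤-trans (hb s) (+≤+ (ℕ.m≤m+n b H)))
      s (there a) → ℤ.≤-trans (hH s a) (+≤+ (ℕ.m≤n+m H b))
    where
    b = proj₁ (finite-bound λ s → ht (act v (unit s)))
    hb = proj₂ (finite-bound λ s → ht (act v (unit s)))
    H = proj₁ (height-bound L)
    hH = proj₂ (height-bound L)

  -- If c = ⟨x , y⟩ ≥ 2 then z ↦ c z - (its predecessor) produces roots of arbitrarily large height from x and y.
  grow : ∀ {x y c} → Root x → Root y → form x y ≡ c → + 2 ≤ c → ∀ j k → + j ≤ ht x → ht x < ht y →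
         ∃[ z ] (Root z × + (j ℕ.+ k) ≤ ht z)
  grow {x} ρ _ _ _ j zero j≤x _ = x , ρ , subst (λ i → + i ≤ ht x) (sym (ℕ.+-identityʳ j)) j≤x
  grow {x} {y} {c} ρ σ e 2≤c j (suc k) j≤x x<y =
    subst (λ i → ∃[ z ] (Root z × + i ≤ ht z)) (sym (ℕ.+-suc j k))
      (grow σ z-root yz≡c 2≤c (suc j) k (ℤ.≤-trans (ℤ.+-monoʳ-≤ 1ℤ j≤x) (ℤ.i<j⇒suc[i]≤j x<y)) y<z)
    where
    z = axpy (neg x) c y
    τ = proj₂ (Root⇒reflection σ)
    z-root : Root z
    z-root = Root-resp (λ j → trans (cong -_ (reflection-act τ x j))
        (trans (cong (λ f → - (x j + - f * y j)) e) (expand (x j) c (y j))))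
      (Root-neg (Root-act (proj₁ (Root⇒reflection σ)) ρ))
      where
      expand : ∀ a c b → - (a + - c * b) ≡ - a + c * b
      expand = solve-∀
    yz≡c : form y z ≡ c
    yz≡c = trans (form-axpyʳ y (neg x) c y) (trans (cong₂ (λ a b → a + c * b)
        (trans (form-cong {y} {y} (λ _ → refl) (neg-axpy x))
            (trans (form-axpyʳ y 0ᵛ -1ℤ x) (cong₂ (λ a b → a + -1ℤ * b) form-y-0 (trans (form-sym y x) e))))
        (Root-norm σ)) (simplify c))
      where
      form-y-0 : form y 0ᵛ ≡ 0ℤ
      form-y-0 = sum-zero λ i → trans (cong (_*_ (y i)) (pair-0 i)) (ℤ.*-zeroʳ (y i))
      simplify : ∀ c → 0ℤ + -1ℤ * c + c * + 2 ≡ c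
      simplify = solve-∀
    ht-z : ht z ≡ - ht x + c * ht y
    ht-z = trans (sum-axpy (neg x) y c) (cong (_+ c * ht y) (sum-neg x))
    y<z : ht y < ht z
    y<z = ℤ.suc[i]≤j⇒i<j (ℤ.0≤i-j⇒j≤i (subst (0ℤ ≤_) (trans (regroup c (ht y) (ht x)) (cong (_- (1ℤ + ht y)) (sym ht-z)))
      (ℤ.+-mono-≤ (nonneg-* (ℤ.i≤j⇒0≤j-i 2≤c) (ℤ.≤-trans (ℤ.≤-trans (+≤+ z≤n) j≤x) (ℤ.<⇒≤ x<y)))
          (ℤ.i≤j⇒0≤j-i (ℤ.i<j⇒suc[i]≤j x<y)))))
      where
      regroup : ∀ c y x → (c - + 2) * y + (y - (1ℤ + x)) ≡ - x + c * y - (1ℤ + y)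
      regroup = solve-∀

  module _ (finite : FiniteW) where
    private
      L = proj₁ finite
      listed = proj₂ finite

    root-height : ∀ {β} → Root β → ht β ≤ + proj₁ (height-bound L)
    root-height (root w s e) = subst (_≤ _) (sum-cong-≗ λ j → sym (e j)) (proj₂ (height-bound L) s (listed w))

    -- If c = ⟨β , α_s⟩ ≥ 2, then ht β > c because sβ = β - c α_s is positive. So `grow` can start
    -- from α_s and β, and after H steps it exceeds the bound H on the heights of roots.
    finite⇒Bounded : Bounded
    finite⇒Bounded {β} s ρ p β≢α = [ id , (λ big → contradiction (unbounded big) λ ()) ]′ (dichotomy (pair β s))
      where
      dichotomy : ∀ c → c ≤ 1ℤ ⊎ + 2 ≤ c
      dichotomy c with c ℤ.≤? 1ℤ
      ... | yes h = inj₁ h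
      ... | no h = inj₂ (ℤ.i<j⇒suc[i]≤j (ℤ.≰⇒> h))
      H = proj₁ (height-bound L)
      unbounded : + 2 ≤ pair β s → ⊥
      unbounded 2≤c = ℕ.1+n≰n (ℤ.drop‿+≤+ (ℤ.≤-trans (proj₂ (proj₂ large)) (root-height (proj₁ (proj₂ large)))))
        where
        1<ht : ht (unit s) < ht β
        1<ht = subst (_< ht β) (sym (ht-unit s)) (ℤ.suc[i]≤j⇒i<j (ℤ.≤-trans 2≤c (ℤ.<⇒≤ (ℤ.≰⇒> λ ht≤c →
          ℤ.<⇒≱ (ht-positive (Root-reflect s ρ) ([ (λ e → contradiction e β≢α) , id ]′ (reflect-Pos s ρ p)))
            (subst (_≤ 0ℤ) (sym (ht-reflect s β)) (subst (ht β - pair β s ≤_) (ℤ.+-inverseʳ (pair β s))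
                (ℤ.+-monoˡ-≤ (- pair β s) ht≤c)))))))
        large = grow (Root-unit s) ρ (form-unitˡ s β) 2≤c 1 H (ℤ.≤-reflexive (sym (ht-unit s))) 1<ht

    -- Each root is w α_s for some w in the list of all elements, so the existence of a lower root
    -- in AD(u, v) is decided by a finite search.
    minimize : ∀ k {u v β} → ht β ≤ + k → AD u v β → ∃[ γ ] (AD u v γ × Minimal u v γ)
    minimize zero β≤0 (ad ρ p _ _) = contradiction (ℤ.<-≤-trans (ht-positive ρ p) β≤0) λ { (+<+ ()) }
    minimize (suc k) {u} {v} {β} β≤k h = decide (Any.any? (λ w → Fin.any? (smaller? w)) L)
      where
      Smaller : Word → Fin n → Set
      Smaller w s = Pos γ × Pos (act u γ) × Neg (act v γ) × ht γ < ht β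
        where γ = act w (unit s)
      smaller? : ∀ w s → Dec (Smaller w s)
      smaller? w s = Fin.all? (λ j → 0ℤ ℤ.≤? γ j) ×-dec Fin.all? (λ j → 0ℤ ℤ.≤? act u γ j)
                     ×-dec Fin.all? (λ j → act v γ j ℤ.≤? 0ℤ) ×-dec (ht γ ℤ.<? ht β)
        where γ = act w (unit s)
      decide : Dec (Any (λ w → ∃ (Smaller w)) L) → ∃[ γ ] (AD u v γ × Minimal u v γ)
      decide (yes a) = go (Any.satisfied a)
        where
        go : ∃[ w ] ∃[ s ] Smaller w s → ∃[ γ ] (AD u v γ × Minimal u v γ)
        go (w , s , p , a , d , γ<β) = minimize k
          (subst (ht γ ≤_) (ℤ.+-comm -1ℤ (+ suc k)) (ℤ.≤-trans
              (ℤ.≤-trans (ℤ.≤-reflexive (sym (trans (ℤ.+-comm -1ℤ (1ℤ + ht γ)) (cancel (ht γ)))))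
              (ℤ.+-monoʳ-≤ -1ℤ (ℤ.i<j⇒suc[i]≤j γ<β)))
            (ℤ.+-monoʳ-≤ -1ℤ β≤k)))
          (ad (Root-act w (Root-unit s)) p a d)
          where
          γ = act w (unit s)
          cancel : ∀ x → 1ℤ + x + -1ℤ ≡ x
          cancel = solve-∀
      decide (no none) = β , h , λ {γ} γ-AD → ℤ.≮⇒≥ λ γ<β → none (found γ-AD γ<β)
        where
        found : ∀ {γ} → AD u v γ → ht γ < ht β → Any (λ w → ∃ (Smaller w)) L
        found {γ} (ad (root w s e) p a d) γ<β = Any.map (λ q → s ,
            Pos-resp (same q) p , Pos-resp (act-cong u (same q)) a , Neg-resp (act-cong v (same q)) d ,
            subst (_< ht β) (sum-cong-≗ (same q)) γ<β) (listed w)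
          where
          same : ∀ {w'} → w ~ w' → γ ≗ act w' (unit s)
          same q j = trans (e j) (act-respects-~ q (unit s) j)

    finite⇒GLP : AllIntervalsGLP
    finite⇒GLP u v (u≤v , u≁v) = t , isReflection τ , u<ut , vt<v , (u<ut , u+1) , Good.ut≤v g , Good.u≤vt g , (vt<v , v-1)
      where
      nonempty = AD-nonempty ℤ.∣ ℓ v ∣ (i≤+∣i∣ (ℓ v)) u≤v u≁v
      minimal = minimize ℤ.∣ ht (proj₁ nonempty) ∣ (i≤+∣i∣ _) (proj₂ nonempty)
      β = proj₁ minimal
      β-AD = proj₁ (proj₂ minimal)
      t = proj₁ (Root⇒reflection (AD.isRoot β-AD))
      τ = proj₂ (Root⇒reflection (AD.isRoot β-AD))
      g : Good u v t
      g = Descent.minimal-Good finite⇒Bounded ℤ.∣ ht β ∣ (i≤+∣i∣ _) u≤v β-AD (proj₂ (proj₂ minimal)) τ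
      ℓ<⇒<B : ∀ {x y r} → IsReflection r → y ~ (x ++ r) → ℓ x < ℓ y → x <B y
      ℓ<⇒<B h p l = ≤B-step (step h p l) , λ q → ℤ.<-irrefl (ℓ-respects-~ q) l
      u<ut : u <B (u ++ t)
      u<ut = ℓ<⇒<B (isReflection τ) ~refl (ℓ-up u τ (AD.pos β-AD) (AD.ascends β-AD))
      vt<v : (v ++ t) <B v
      vt<v = ℓ<⇒<B (isReflection τ)
        (~sym (~trans (~reflexive (List.++-assoc v t t))
            (~trans (++-congˡ v (reflection-square (isReflection τ))) (~reflexive (List.++-identityʳ v)))))
        (ℓ-down v τ (AD.pos β-AD) (AD.descends β-AD))
      successor : ∀ {x y} → ℓ y ≡ ℓ x + 1ℤ → x ℓ+1≡ y
      successor {x} e = k , hx , ℓ⇒HasLength (trans e (cong (_+ 1ℤ) ex))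
        where
        k = proj₁ (hasLength x)
        hx = proj₁ (proj₂ (hasLength x))
        ex = proj₂ (proj₂ (hasLength x))
      u+1 : u ℓ+1≡ (u ++ t)
      u+1 = successor (Good.ℓ-ut g)
      v-1 : (v ++ t) ℓ+1≡ v
      v-1 = successor (trans (split (ℓ v)) (cong (_+ 1ℤ) (sym (Good.ℓ-vt g))))
        where
        split : ∀ a → a ≡ a - 1ℤ + 1ℤ
        split = solve-∀

-- Definite and degenerate forms

square-nonneg : ∀ a → 0ℤ ≤ a * a
square-nonneg (+ a) = nonneg-* {+ a} {+ a} (+≤+ z≤n) (+≤+ z≤n)
square-nonneg -[1+ a ] = +≤+ z≤n

≤-from : ∀ {a b c} → b - a ≡ c → 0ℤ ≤ c → a ≤ b
≤-from e h = ℤ.0≤i-j⇒j≤i (subst (0ℤ ≤_) (sym e) h)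

sub-nonneg : ∀ {a b} → a ≤ b → 0ℤ ≤ b - a
sub-nonneg = ℤ.i≤j⇒0≤j-i

cancel-positive : ∀ {a b} → 0ℤ < a → 0ℤ ≤ a * b → 0ℤ ≤ b
cancel-positive {+ suc a} {+ b} _ _ = +≤+ z≤n
cancel-positive {+ suc a} { -[1+ b ]} _ ()
cancel-positive {+ 0} (+<+ ())

quad : ∀ {n} → (Fin n → Fin n → ℤ) → Vector n → ℤ
quad Q x = sum (λ i → x i * sum (λ j → Q i j * x j))

-- Iterates (a + r)² ≤ 2a² + 2r², in which the discarded term is (a - r)².
linear-square-bound : ∀ {n} (l : Vector n) →
  ∃[ K ] (0ℤ ≤ K × (∀ (x : Vector n) M → 0ℤ ≤ M → (∀ i → x i * x i ≤ M) → sum (λ i → l i * x i) * sum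
      (λ i → l i * x i) ≤ K * M))
linear-square-bound {zero} l = 0ℤ , ℤ.≤-refl , λ x M _ _ → ℤ.≤-reflexive (sym (ℤ.*-zeroˡ M))
linear-square-bound {suc n} l = K' , K'≥0 , λ x M M≥0 h →
    let a = l zero * x zero
        r = sum (λ i → l (suc i) * x (suc i))
    in ≤-from (identity (l zero) (x zero) r K M)
         (ℤ.+-mono-≤ (ℤ.+-mono-≤ (square-nonneg (a - r))
             (twice {(l zero * l zero) * (M - x zero * x zero)}
             (nonneg-* {l zero * l zero} (square-nonneg (l zero)) (sub-nonneg (h zero)))))
           (twice {K * M - r * r} (sub-nonneg (bound (x ∘ suc) M M≥0 (h ∘ suc)))))
  where
  K : ℤ
  K = proj₁ (linear-square-bound (l ∘ suc))
  K≥0 : 0ℤ ≤ K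
  K≥0 = proj₁ (proj₂ (linear-square-bound (l ∘ suc)))
  bound = proj₂ (proj₂ (linear-square-bound (l ∘ suc)))
  twice : ∀ {a} → 0ℤ ≤ a → 0ℤ ≤ + 2 * a
  twice {a} = nonneg-* {+ 2} {a} (+≤+ z≤n)
  K' = + 2 * (l zero * l zero) + + 2 * K
  K'≥0 : 0ℤ ≤ K'
  K'≥0 = ℤ.+-mono-≤ (twice {l zero * l zero} (square-nonneg (l zero))) (twice {K} K≥0)
  identity : ∀ l x r K M → (+ 2 * (l * l) + + 2 * K) * M - (l * x + r) * (l * x + r) ≡
    (l * x - r) * (l * x - r) + + 2 * ((l * l) * (M - x * x)) + + 2 * (K * M - r * r)
  identity = solve-∀

-- The constant C takes the place of compactness of the unit sphere; strict positivity alone would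
-- not bound the vectors of given norm effectively.
PositiveDefinite : ∀ {n} → (Fin n → Fin n → ℤ) → Set
PositiveDefinite Q = (∀ x → 0ℤ ≤ quad Q x) × ∃[ C ] (0ℤ ≤ C × (∀ x i → x i * x i ≤ C * quad Q x))

-- Completing the square: a q(x) = (a x₀ + l(x'))² + q''(x') with a = Q₀₀, and one continues with q''.
module CompleteSquare {n} (Q : Fin (suc n) → Fin (suc n) → ℤ) (Q-sym : ∀ i j → Q i j ≡ Q j i) where
  a = Q zero zero

  l : Vector n
  l j = Q zero (suc j)

  Q'' : Fin n → Fin n → ℤ
  Q'' i j = a * Q (suc i) (suc j) - l i * l j

  Q''-sym : ∀ i j → Q'' i j ≡ Q'' j i
  Q''-sym i j = cong₂ (λ b c → a * b - c) (Q-sym (suc i) (suc j)) (ℤ.*-comm (l i) (l j))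

  linear : Vector n → ℤ
  linear x = sum (λ j → l j * x j)

  minor : Fin n → Fin n → ℤ
  minor i j = Q (suc i) (suc j)

  expansion : ∀ x → quad Q x ≡ x zero * (a * x zero + linear (x ∘ suc)) + (x zero * linear (x ∘ suc) + quad minor (x ∘ suc))
  expansion x = cong (_+_ (x₀ * (a * x₀ + L))) (begin
      sum (λ i → x' i * (Q (suc i) zero * x₀ + r i))
        ≡⟨ sum-cong-≗ (λ i → trans (cong (λ z → x' i * (z * x₀ + r i)) (Q-sym (suc i) zero))
            (distribute (x' i) (l i) x₀ (r i))) ⟩
      sum (λ i → x' i * r i + x₀ * (l i * x' i))
        ≡⟨ sum-axpy (λ i → x' i * r i) (λ i → l i * x' i) x₀ ⟩
      quad minor x' + x₀ * L
        ≡⟨ ℤ.+-comm (quad minor x') (x₀ * L) ⟩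
      x₀ * L + quad minor x' ∎)
    where
    open ≡-Reasoning
    x₀ = x zero
    x' = x ∘ suc
    L = linear x'
    r : Vector n
    r i = sum (λ j → minor i j * x' j)
    distribute : ∀ y l x r → y * (l * x + r) ≡ y * r + x * (l * y)
    distribute = solve-∀

  identity : ∀ x → a * quad Q x ≡
    (a * x zero + linear (x ∘ suc)) * (a * x zero + linear (x ∘ suc)) + quad Q'' (x ∘ suc)
  identity x = trans (cong (_*_ a) (expansion x))
      (trans (algebra a x₀ L q') (cong (λ z → (a * x₀ + L) * (a * x₀ + L) + z) (sym quad-Q'')))
    where
    open ≡-Reasoning
    x₀ = x zero
    x' = x ∘ suc
    L = linear x'
    r : Vector n
    r i = sum (λ j → Q (suc i) (suc j) * x' j)
    q' = sum (λ i → x' i * r i)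
    algebra : ∀ a x L q → a * (x * (a * x + L) + (x * L + q)) ≡ (a * x + L) * (a * x + L) + (a * q - L * L)
    algebra = solve-∀
    quad-Q'' : quad Q'' x' ≡ a * q' - L * L
    quad-Q'' = begin
      sum (λ i → x' i * sum (λ j → (a * Q (suc i) (suc j) - l i * l j) * x' j))
        ≡⟨ sum-cong-≗ (λ i → cong (_*_ (x' i)) (trans (sum-cong-≗ λ j → inner a (Q (suc i) (suc j)) (l i) (l j) (x' j))
             (trans (sum-axpy (λ j → a * (Q (suc i) (suc j) * x' j)) (λ j → l j * x' j) (- l i))
               (cong (_+ - l i * L) (sym (*-distribˡ-sum a λ j → Q (suc i) (suc j) * x' j)))))) ⟩
      sum (λ i → x' i * (a * r i + - l i * L))
        ≡⟨ sum-cong-≗ (λ i → outer (x' i) a (r i) (l i) L) ⟩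
      sum (λ i → a * (x' i * r i) + - L * (l i * x' i))
        ≡⟨ sum-axpy (λ i → a * (x' i * r i)) (λ i → l i * x' i) (- L) ⟩
      sum (λ i → a * (x' i * r i)) + - L * L
        ≡⟨ cong₂ _+_ (sym (*-distribˡ-sum a λ i → x' i * r i)) (sym (ℤ.neg-distribˡ-* L L)) ⟩
      a * q' - L * L ∎
      where
      inner : ∀ a q l l' x → (a * q - l * l') * x ≡ a * (q * x) + - l * (l' * x)
      inner = solve-∀
      outer : ∀ x a r l L → x * (a * r + - l * L) ≡ a * (x * r) + - L * (l * x)
      outer = solve-∀

quad-unit : ∀ {n} (Q : Fin n → Fin n → ℤ) s → quad Q (unit s) ≡ Q s s
quad-unit Q s = trans (sum-single s _ λ j s≢j → trans (cong (_* sum (λ k → Q j k * unit s k)) (unit-other s≢j))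
    (ℤ.*-zeroˡ (sum (λ k → Q j k * unit s k))))
  (trans (cong₂ _*_ (unit-same s) (sum-unit (Q s) s)) (ℤ.*-identityˡ (Q s s)))

quad-scale : ∀ {n} (Q : Fin n → Fin n → ℤ) c x → quad Q (λ i → c * x i) ≡ c * c * quad Q x
quad-scale Q c x = trans (sum-cong-≗ λ i → trans (cong (_*_ (c * x i)) (trans (sum-cong-≗ λ j → swap (Q i j) c (x j))
    (sym (*-distribˡ-sum c λ j → Q i j * x j)))) (regroup c (x i) (sum λ j → Q i j * x j)))
  (sym (*-distribˡ-sum (c * c) λ i → x i * sum (λ j → Q i j * x j)))
  where
  swap : ∀ q c x → q * (c * x) ≡ c * (q * x)
  swap = solve-∀
  regroup : ∀ c x s → c * x * (c * s) ≡ c * c * (x * s)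
  regroup = solve-∀

definite-or-not : ∀ {n} (Q : Fin n → Fin n → ℤ) → (∀ i j → Q i j ≡ Q j i) →
  (∃[ x ] (¬ x ≗ 0ᵛ × quad Q x ≤ 0ℤ)) ⊎ PositiveDefinite Q
definite-or-not {zero} Q Q-sym = inj₂ ((λ _ → ℤ.≤-refl) , 0ℤ , ℤ.≤-refl {0ℤ} , λ x ())
definite-or-not {suc n} Q Q-sym = first (Q zero zero ℤ.≤? 0ℤ)
  where
  open CompleteSquare Q Q-sym
  first : Dec (a ≤ 0ℤ) → (∃[ x ] (¬ x ≗ 0ᵛ × quad Q x ≤ 0ℤ)) ⊎ PositiveDefinite Q
  first (yes a≤0) = inj₁ (unit zero , (λ h → contradiction (trans (sym (unit-same {suc n} zero)) (h zero)) λ ()) ,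
    subst (_≤ 0ℤ) (sym (quad-unit Q zero)) a≤0)
  first (no a≰0) = [ inj₁ ∘ indefinite , inj₂ ∘ definite ]′ (definite-or-not Q'' Q''-sym)
    where
    0<a : 0ℤ < a
    0<a = ℤ.≰⇒> a≰0
    indefinite : (∃[ y ] (¬ y ≗ 0ᵛ × quad Q'' y ≤ 0ℤ)) → ∃[ x ] (¬ x ≗ 0ᵛ × quad Q x ≤ 0ℤ)
    indefinite (y , y≢0 , qy≤0) = x , x≢0 , ℤ.0≤i-j⇒j≤i (cancel-positive 0<a (subst (0ℤ ≤_) (sym negated)
        (nonneg-* (square-nonneg a) (ℤ.neg-mono-≤ qy≤0))))
      where
      -- This choice makes the square a x₀ + l(x') vanish; scaling the other coordinates by a avoids
      -- a division.
      x : Vector (suc n)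
      x zero = - linear y
      x (suc j) = a * y j
      linear-ay : linear (λ j → a * y j) ≡ a * linear y
      linear-ay = trans (sum-cong-≗ λ j → swap (l j) a (y j)) (sym (*-distribˡ-sum a λ j → l j * y j))
        where
        swap : ∀ l a y → l * (a * y) ≡ a * (l * y)
        swap = solve-∀
      negated : a * (0ℤ - quad Q x) ≡ a * a * (- quad Q'' y)
      negated = trans (pull a (quad Q x)) (trans (cong -_ (trans (identity x)
          (trans (cong₂ (λ b c → (a * - linear y + b) * (a * - linear y + b) + c) linear-ay (quad-scale Q'' a y))
              (simplify a (linear y) (quad Q'' y)))))
        (ℤ.neg-distribʳ-* (a * a) (quad Q'' y)))
        where
        pull : ∀ a q → a * (0ℤ - q) ≡ - (a * q)
        pull = solve-∀
        simplify : ∀ a L q → (a * - L + a * L) * (a * - L + a * L) + a * a * q ≡ a * a * q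
        simplify = solve-∀
      x≢0 : ¬ x ≗ 0ᵛ
      x≢0 h = y≢0 λ j → [ (λ a≡0 → contradiction (subst (0ℤ <_) a≡0 0<a) (ℤ.<-irrefl refl)) , id ]′
        (ℤ.i*j≡0⇒i≡0∨j≡0 a (h (suc j)))
    definite : PositiveDefinite Q'' → PositiveDefinite Q
    definite (q''≥0 , C , C≥0 , bound) = q≥0 , C' , C'≥0 , bound'
      where
      K : ℤ
      K = proj₁ (linear-square-bound l)
      K≥0 : 0ℤ ≤ K
      K≥0 = proj₁ (proj₂ (linear-square-bound l))
      linear-bound : ∀ x M → 0ℤ ≤ M → (∀ i → x i * x i ≤ M) → linear x * linear x ≤ K * M
      linear-bound = proj₂ (proj₂ (linear-square-bound l))
      a≥0 : 0ℤ ≤ a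
      a≥0 = ℤ.<⇒≤ 0<a
      q≥0 : ∀ x → 0ℤ ≤ quad Q x
      q≥0 x = cancel-positive 0<a (subst (0ℤ ≤_) (sym (identity x))
          (ℤ.+-mono-≤ (square-nonneg (a * x zero + linear (x ∘ suc))) (q''≥0 (x ∘ suc))))
      2≥0 : 0ℤ ≤ + 2
      2≥0 = +≤+ z≤n
      -- With y = a x₀ + L one has y² ≤ a q and L² ≤ K C q'' ≤ K C a q. Hence x₀² ≤ (a x₀)² ≤ 2y² +
      -- 2L² ≤ C₀ q, while the summand C a takes care of the other coordinates.
      C₀ C' : ℤ
      C₀ = + 2 * a + + 2 * (K * (C * a))
      C' = C₀ + C * a
      C₀≥0 : 0ℤ ≤ C₀
      C₀≥0 = ℤ.+-mono-≤ (nonneg-* {+ 2} {a} 2≥0 a≥0)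
          (nonneg-* {+ 2} {K * (C * a)} 2≥0 (nonneg-* {K} {C * a} K≥0 (nonneg-* {C} {a} C≥0 a≥0)))
      C'≥0 : 0ℤ ≤ C'
      C'≥0 = ℤ.+-mono-≤ C₀≥0 (nonneg-* {C} {a} C≥0 a≥0)
      bound' : ∀ x i → x i * x i ≤ C' * quad Q x
      bound' x (suc i) = ≤-from (split C₀ C a q y q'' (x (suc i)) (identity x))
          (ℤ.+-mono-≤ (ℤ.+-mono-≤ (nonneg-* {C₀} {q} C₀≥0 (q≥0 x)) (nonneg-* {C} {y * y} C≥0 (square-nonneg y)))
              (sub-nonneg (bound (x ∘ suc) i)))
        where
        q = quad Q x
        q'' = quad Q'' (x ∘ suc)
        y = a * x zero + linear (x ∘ suc)
        split : ∀ C₀ C a q y q'' z → a * q ≡ y * y + q'' → (C₀ + C * a) * q - z * z ≡ C₀ * q + C * (y * y) +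
            (C * q'' - z * z)
        split C₀ C a q y q'' z e = trans (expand C₀ C a q z)
            (trans (cong (λ w → C₀ * q + C * w - z * z) e) (collect C₀ C q y q'' z))
          where
          expand : ∀ C₀ C a q z → (C₀ + C * a) * q - z * z ≡ C₀ * q + C * (a * q) - z * z
          expand = solve-∀
          collect : ∀ C₀ C q y q'' z → C₀ * q + C * (y * y + q'') - z * z ≡ C₀ * q + C * (y * y) + (C * q'' - z * z)
          collect = solve-∀
      bound' x zero = ≤-from (split K C a q q'' L x₀ (identity x))
          (ℤ.+-mono-≤ (ℤ.+-mono-≤ (ℤ.+-mono-≤ (ℤ.+-mono-≤ (ℤ.+-mono-≤
            -- This is (y + L)², the slack in (y - L)² ≤ 2y² + 2L².
            (square-nonneg (a * x₀ + + 2 * L))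
            (nonneg-* {(a - 1ℤ) * (a + 1ℤ)} {x₀ * x₀} (nonneg-* {a - 1ℤ} {a + 1ℤ} (sub-nonneg 1≤a)
                (ℤ.+-mono-≤ a≥0 (+≤+ {m = 0} {n = 1} z≤n))) (square-nonneg x₀)))
            (nonneg-* {+ 2} {K * (C * q'') - L * L} 2≥0 (sub-nonneg
                (linear-bound (x ∘ suc) (C * q'') (nonneg-* {C} {q''} C≥0 (q''≥0 (x ∘ suc))) (bound (x ∘ suc))))))
            (nonneg-* {+ 2} {q''} 2≥0 (q''≥0 (x ∘ suc))))
            (nonneg-* {+ 2 * (K * C) + C} {(a * x₀ + L) * (a * x₀ + L)}
                (ℤ.+-mono-≤ (nonneg-* {+ 2} {K * C} 2≥0 (nonneg-* {K} {C} K≥0 C≥0)) C≥0) (square-nonneg (a * x₀ + L))))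
            (nonneg-* {C} {q''} C≥0 (q''≥0 (x ∘ suc))))
        where
        x₀ = x zero
        L = linear (x ∘ suc)
        q = quad Q x
        q'' = quad Q'' (x ∘ suc)
        1≤a : 1ℤ ≤ a
        1≤a = ℤ.i<j⇒suc[i]≤j 0<a
        split : ∀ K C a q q'' L x → a * q ≡ (a * x + L) * (a * x + L) + q'' →
          (+ 2 * a + + 2 * (K * (C * a)) + C * a) * q - x * x ≡
          (a * x + + 2 * L) * (a * x + + 2 * L) + (a - 1ℤ) * (a + 1ℤ) * (x * x) + + 2 * (K * (C * q'') - L * L) + + 2 * q''
            + (+ 2 * (K * C) + C) * ((a * x + L) * (a * x + L)) + C * q''
        split K C a q q'' L x e = trans (expand K C a q x)
            (trans (cong (λ w → (+ 2 + + 2 * (K * C) + C) * w - x * x) e) (collect K C a q'' L x))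
          where
          expand : ∀ K C a q x → (+ 2 * a + + 2 * (K * (C * a)) + C * a) * q - x * x ≡ (+ 2 + + 2 * (K * C) + C) *
              (a * q) - x * x
          expand = solve-∀
          collect : ∀ K C a q'' L x → (+ 2 + + 2 * (K * C) + C) * ((a * x + L) * (a * x + L) + q'') - x * x ≡
            (a * x + + 2 * L) * (a * x + + 2 * L) + (a - 1ℤ) * (a + 1ℤ) * (x * x) + + 2 * (K * (C * q'') - L * L) + + 2 * q''
              + (+ 2 * (K * C) + C) * ((a * x + L) * (a * x + L)) + C * q''
          collect = solve-∀

-- Off-diagonal terms come in equal pairs. Evenness allows norms to be halved, so that strict
-- inequalities between them gain a whole unit.
quad-even : ∀ {n} (Q : Fin n → Fin n → ℤ) → (∀ i j → Q i j ≡ Q j i) → (∀ i → Q i i ≡ + 2) → ∀ x → ∃[ h ] (quad Q x ≡ + 2 * h)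
quad-even {zero} Q _ _ x = 0ℤ , refl
quad-even {suc n} Q Q-sym diag x = x zero * x zero + x zero * L + h ,
    trans (expansion x) (trans (cong₂ (λ c q → x zero * (c * x zero + L) + (x zero * L + q)) (diag zero) e)
        (collect (x zero) L h))
  where
  open CompleteSquare Q Q-sym
  L = linear (x ∘ suc)
  rec : ∃[ h ] (quad minor (x ∘ suc) ≡ + 2 * h)
  rec = quad-even minor (λ i j → Q-sym (suc i) (suc j)) (diag ∘ suc) (x ∘ suc)
  h = proj₁ rec
  e = proj₂ rec
  collect : ∀ x L h → x * (+ 2 * x + L) + (x * L + + 2 * h) ≡ + 2 * (x * x + x * L + h)
  collect = solve-∀

dot : ∀ {n} → Vector n → Vector n → ℤ
dot p x = sum (λ i → p i * x i)

χ : Bool → ℤ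
χ true = 1ℤ
χ false = 0ℤ

Supported : ∀ {n} → (Fin n → Bool) → Vector n → Set
Supported D x = ∀ i → D i ≡ false → x i ≡ 0ℤ

square-zero : ∀ a → a * a ≤ 0ℤ → a ≡ 0ℤ
square-zero a h = [ id , id ]′ (ℤ.i*j≡0⇒i≡0∨j≡0 a (ℤ.≤-antisym h (square-nonneg a)))

module Masked {n : ℕ} (B : Fin n → Fin n → ℤ) (B-sym : ∀ i j → B i j ≡ B j i) (D : Fin n → Bool)
              (p : Vector n) (p-supported : Supported D p) where
  open Form B B-sym

  cut : Vector n → Vector n
  cut x i = χ (D i) * x i

  -- Its quadratic form is x ↦ form (cut x) (cut x) + (norm of x off D)² + ⟨p , x⟩².
  Q : Fin n → Fin n → ℤ
  Q i j = χ (D i) * χ (D j) * B i j + (1ℤ - χ (D i)) * unit i j + p i * p j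

  Q-sym : ∀ i j → Q i j ≡ Q j i
  Q-sym i j = cong₂ _+_ (cong₂ _+_ (cong₂ _*_ (ℤ.*-comm (χ (D i)) (χ (D j))) (B-sym i j)) diagonal) (ℤ.*-comm (p i) (p j))
    where
    diagonal : (1ℤ - χ (D i)) * unit i j ≡ (1ℤ - χ (D j)) * unit j i
    diagonal with i Fin.≟ j
    ... | yes refl = cong (_*_ (1ℤ - χ (D i))) (sym (unit-same i))
    ... | no i≢j = trans (ℤ.*-zeroʳ (1ℤ - χ (D i)))
        (sym (trans (cong (_*_ (1ℤ - χ (D j))) (unit-other (i≢j ∘ sym))) (ℤ.*-zeroʳ (1ℤ - χ (D j)))))

  off-summand : Vector n → Fin n → ℤ
  off-summand x i = (1ℤ - χ (D i)) * (x i * x i)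

  off : Vector n → ℤ
  off x = sum (off-summand x)

  quad-Q : ∀ x → quad Q x ≡ form (cut x) (cut x) + off x + dot p x * dot p x
  quad-Q x = trans (sum-cong-≗ λ i → trans (cong (_*_ (x i)) (inner i))
      (outer (x i) (χ (D i)) (pair (cut x) i) (p i) (dot p x)))
    (trans (sum-axpy (λ i → cut x i * pair (cut x) i + 1ℤ * ((1ℤ - χ (D i)) * (x i * x i))) (λ i → p i * x i) (dot p x))
      (cong (_+ dot p x * dot p x) (trans (sum-axpy (λ i → cut x i * pair (cut x) i) (λ i → (1ℤ - χ (D i)) * (x i * x i)) 1ℤ)
        (cong (_+_ (form (cut x) (cut x))) (ℤ.*-identityˡ (off x))))))
    where
    inner : ∀ i → sum (λ j → Q i j * x j) ≡ χ (D i) * pair (cut x) i + (1ℤ - χ (D i)) * x i + p i * dot p x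
    inner i = trans (sum-cong-≗ λ j → expand (χ (D i)) (χ (D j)) (B i j) (unit i j) (p i) (p j) (x j))
      (trans (sum-axpy (λ j → χ (D i) * (B i j * cut x j) + (1ℤ - χ (D i)) * (x j * unit i j)) (λ j → p j * x j) (p i))
        (cong (_+ p i * dot p x) (trans (sum-axpy (λ j → χ (D i) * (B i j * cut x j)) (λ j → x j * unit i j) (1ℤ - χ (D i)))
          (cong₂ (λ a b → a + (1ℤ - χ (D i)) * b) (sym (*-distribˡ-sum (χ (D i)) λ j → B i j * cut x j)) (sum-unit x i)))))
      where
      expand : ∀ c d b u p q x → (c * d * b + (1ℤ - c) * u + p * q) * x ≡ c * (b * (d * x)) + (1ℤ - c) * (x * u) + p *
          (q * x)
      expand = solve-∀
    outer : ∀ x c P p S → x * (c * P + (1ℤ - c) * x + p * S) ≡ c * x * P + 1ℤ * ((1ℤ - c) * (x * x)) + S * (p * x)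
    outer = solve-∀

  dot-cut : ∀ x → dot p (cut x) ≡ dot p x
  dot-cut x = sum-cong-≗ λ i → pointwise i (D i) refl
    where
    pointwise : ∀ i b → D i ≡ b → p i * (χ (D i) * x i) ≡ p i * x i
    pointwise i true e rewrite e = cong (_*_ (p i)) (ℤ.*-identityˡ (x i))
    pointwise i false e rewrite e | p-supported i e = trans (ℤ.*-zeroˡ (0ℤ * x i)) (sym (ℤ.*-zeroˡ (x i)))

  cut-supported : ∀ x → Supported D (cut x)
  cut-supported x i e rewrite e = ℤ.*-zeroˡ (x i)

  supported-cut : ∀ {x} → Supported D x → cut x ≗ x
  supported-cut {x} h i with D i | h i
  ... | true | _ = ℤ.*-identityˡ (x i)
  ... | false | z = trans (ℤ.*-zeroˡ (x i)) (sym (z refl))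

  off-term : ∀ x i → 0ℤ ≤ off-summand x i
  off-term x i with D i
  ... | true = ℤ.≤-reflexive (sym (ℤ.*-zeroˡ (x i * x i)))
  ... | false = nonneg-* {1ℤ} {x i * x i} (+≤+ z≤n) (square-nonneg (x i))

  off-supported : ∀ {x} → Supported D x → off x ≡ 0ℤ
  off-supported {x} h = sum-zero pointwise
    where
    pointwise : ∀ i → (1ℤ - χ (D i)) * (x i * x i) ≡ 0ℤ
    pointwise i with D i | h i
    ... | true | _ = ℤ.*-zeroˡ (x i * x i)
    ... | false | z rewrite z refl = refl

  module _ (positive : ∀ {x} → Supported D x → ¬ x ≗ 0ᵛ → 0ℤ < form x x + dot p x * dot p x) where

    -- If `Q` is ≤ 0 at x, then the part of x in D is zero by `positive`, and after that the part
    -- off D as well. So `definite-or-not` returns a constant, and on vectors supported in D the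
    -- extra term vanishes.
    definite : ∃[ C ] (0ℤ ≤ C × (∀ {x} → Supported D x → ∀ i → x i * x i ≤ C * (form x x + dot p x * dot p x)))
    definite = [ (λ bad → ⊥-elim (impossible bad)) , (λ (_ , C , C≥0 , bound) → C , C≥0 , λ {x} h i →
        subst (λ q → x i * x i ≤ C * q) (trans (quad-Q x) (trans (cong₂ (λ a b → a + b + dot p x * dot p x)
          (form-cong (supported-cut h) (supported-cut h)) (off-supported h))
              (cong (_+ dot p x * dot p x) (ℤ.+-identityʳ (form x x))))) (bound x i)) ]′
      (definite-or-not Q Q-sym)
      where
      impossible : ¬ (∃[ x ] (¬ x ≗ 0ᵛ × quad Q x ≤ 0ℤ))
      impossible (x , x≢0 , q≤0) = go (Fin.all? λ i → y i ℤ.≟ 0ℤ)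
        where
        y = cut x
        F : ℤ
        F = form y y + dot p y * dot p y
        regroup : quad Q x ≡ F + off x
        regroup = trans (quad-Q x) (trans (cong (λ d → form y y + off x + d * d) (sym (dot-cut x)))
            (swap (form y y) (off x) (dot p y * dot p y)))
          where
          swap : ∀ a b c → a + b + c ≡ a + c + b
          swap = solve-∀
        off≥0 : 0ℤ ≤ off x
        off≥0 = sum-nonneg (off-summand x) (off-term x)
        go : Dec (y ≗ 0ᵛ) → ⊥
        go (no y≢0) = ℤ.<⇒≱ (ℤ.<-≤-trans (positive (cut-supported x) y≢0) (subst (F ≤_) (sym regroup)
          (subst (_≤ F + off x) (ℤ.+-identityʳ F) (ℤ.+-monoʳ-≤ F off≥0)))) q≤0
        go (yes y≡0) = x≢0 λ i → pointwise i (D i) refl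
          where
          F≡0 : F ≡ 0ℤ
          F≡0 = cong₂ _+_ (sum-zero λ i → trans (cong (_* pair y i) (y≡0 i)) (ℤ.*-zeroˡ (pair y i)))
            (cong₂ _*_ dot≡0 dot≡0)
            where
            dot≡0 : dot p y ≡ 0ℤ
            dot≡0 = sum-zero λ i → trans (cong (_*_ (p i)) (y≡0 i)) (ℤ.*-zeroʳ (p i))
          off≤0 : off x ≤ 0ℤ
          off≤0 = subst (_≤ 0ℤ) (trans regroup (trans (cong (_+ off x) F≡0) (ℤ.+-identityˡ (off x)))) q≤0
          pointwise : ∀ i b → D i ≡ b → x i ≡ 0ℤ
          pointwise i true e = trans (sym (ℤ.*-identityˡ (x i))) (trans (cong (λ b → χ b * x i) (sym e)) (y≡0 i))
          pointwise i false e = square-zero (x i) (subst (_≤ 0ℤ)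
              (trans (cong (λ b → (1ℤ - χ b) * (x i * x i)) e) (ℤ.*-identityˡ (x i * x i)))
            (ℤ.≤-trans (≤-sum (off-summand x) (off-term x) i) off≤0))

-- Lengths bounded by a definite form

module Lengths {n : ℕ} (M : CoxeterMatrix n) (simply-laced : Coxeter.SimplyLaced M) where
  open FiniteGLP M simply-laced public

  -- ρ - w ρ, for a functional ρ which is 1 on all simple roots.
  dev : Word → Vector n
  dev [] = 0ᵛ
  dev (s ∷ w) = axpy (reflect s (dev w)) 1ℤ (unit s)

  form-0ˡ : ∀ y → form 0ᵛ y ≡ 0ℤ
  form-0ˡ y = sum-zero λ i → ℤ.*-zeroˡ (pair y i)

  form-reflect : ∀ s x y → form (reflect s x) y ≡ form x (reflect s y)
  form-reflect s x y = trans (form-cong {reflect s x} {reflect s x} (λ _ → refl) (λ j → sym (reflect-involutive s y j)))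
      (reflect-form s x (reflect s y))

  dev-form : ∀ w y → form (dev w) y ≡ ht y - ht (iact w y)
  dev-form [] y = trans (form-0ˡ y) (sym (ℤ.+-inverseʳ (ht y)))
  dev-form (s ∷ w) y = trans (form-axpyˡ (reflect s (dev w)) 1ℤ (unit s) y)
    (trans (cong₂ (λ a b → a + 1ℤ * b) (trans (form-reflect s (dev w) y) (trans (dev-form w (reflect s y))
        (cong (_- ht (iact w (reflect s y))) (ht-reflect s y)))) (form-unitˡ s y))
      (cancel (ht y) (pair y s) (ht (iact w (reflect s y)))))
    where
    cancel : ∀ h p g → h - p - g + 1ℤ * p ≡ h - g
    cancel = solve-∀

  pair-dev : ∀ w s → pair (dev w) s ≡ 1ℤ - ht (iact w (unit s))
  pair-dev w s = trans (sym (form-unitʳ (dev w) s))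
      (trans (dev-form w (unit s)) (cong (_- ht (iact w (unit s))) (ht-unit s)))

  ht-dev′ : ∀ s w → ht (dev (s ∷ w)) ≡ ht (dev w) - pair (dev w) s + 1ℤ
  ht-dev′ s w = trans (sum-axpy (reflect s (dev w)) (unit s) 1ℤ)
      (cong₂ (λ a b → a + 1ℤ * b) (ht-reflect s (dev w)) (ht-unit s))

  ht-dev : ∀ s w → ht (dev (s ∷ w)) ≡ ht (dev w) + ht (iact w (unit s))
  ht-dev s w = trans (ht-dev′ s w) (trans (cong (λ p → ht (dev w) - p + 1ℤ) (pair-dev w s))
      (cancel (ht (dev w)) (ht (iact w (unit s)))))
    where
    cancel : ∀ d h → d - (1ℤ - h) + 1ℤ ≡ d + h
    cancel = solve-∀

  -- Formally |ρ - wρ|² = 2⟨ρ , ρ - wρ⟩, as ρ and wρ have equal norms. The recursion avoids ρ, which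
  -- need not be represented by a vector when the form is degenerate.
  norm-dev : ∀ w → form (dev w) (dev w) ≡ + 2 * ht (dev w)
  norm-dev [] = trans (form-0ˡ 0ᵛ) (sym (cong (_*_ (+ 2)) (sum-zero {n} λ _ → refl)))
  norm-dev (s ∷ w) = trans (form-axpy² (reflect s x) 1ℤ (unit s))
    (trans (cong₂ (λ a b → a + b + 1ℤ * 1ℤ * form (unit s) (unit s))
        (trans (reflect-form s x x) (norm-dev w)) (cong (λ c → 1ℤ * (c + c)) (trans (form-reflect s x (unit s))
          (trans (form-cong {x} {x} (λ _ → refl) (λ j → trans (reflect-unit s j) (neg-axpy (unit s) j)))
            (trans (form-axpyʳ x 0ᵛ -1ℤ (unit s)) (cong₂ (λ a b → a + -1ℤ * b) (trans (form-sym x 0ᵛ) (form-0ˡ x))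
                (form-unitʳ x s)))))))
      (trans (cong (λ a → + 2 * ht x + 1ℤ * (0ℤ + -1ℤ * c + (0ℤ + -1ℤ * c)) + 1ℤ * 1ℤ * a) (form-unit s))
        (trans (simplify (ht x) c) (cong (_*_ (+ 2)) (sym (ht-dev′ s w))))))
    where
    x = dev w
    c = pair x s
    simplify : ∀ h c → + 2 * h + 1ℤ * (0ℤ + -1ℤ * c + (0ℤ + -1ℤ * c)) + 1ℤ * 1ℤ * + 2 ≡ + 2 * (h - c + 1ℤ)
    simplify = solve-∀

  Reduced-tail : ∀ s w → Reduced (s ∷ w) → Reduced w × 0ℤ < ht (iact w (unit s))
  Reduced-tail s w r = go (ht (iact w (unit s))) refl
    where
    too-long : ∀ k {a b} → a ≤ + k → b ≤ 0ℤ → a + b ≢ + suc k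
    too-long k h h' e = ℕ.1+n≰n (ℤ.drop‿+≤+ (subst₂ _≤_ e (ℤ.+-identityʳ (+ k)) (ℤ.+-mono-≤ h h')))
    cancel : ∀ {a b} → a + 1ℤ ≡ b + 1ℤ → a ≡ b
    cancel {a} {b} e = trans (split a) (trans (cong (_- 1ℤ) e) (sym (split b)))
      where
      split : ∀ a → a ≡ a + 1ℤ - 1ℤ
      split = solve-∀
    go : ∀ i → ht (iact w (unit s)) ≡ i → Reduced w × 0ℤ < i
    go (+ suc k) e = cancel (trans (cong (λ i → ℓ w + sgn i) (sym e)) (trans r (ℤ.+-comm 1ℤ (+ length w)))) , +<+ (s≤s z≤n)
    go (+ 0) e = contradiction (trans (cong (λ i → ℓ w + sgn i) (sym e)) r) (too-long (length w) (ℓ-≤-length w) ℤ.≤-refl)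
    go -[1+ k ] e = contradiction (trans (cong (λ i → ℓ w + sgn i) (sym e)) r) (too-long (length w) (ℓ-≤-length w) -≤+)

  -- Each letter of a reduced word adds the height of a positive root.
  length≤ht-dev : ∀ w → Reduced w → + length w ≤ ht (dev w)
  length≤ht-dev [] r = ℤ.≤-reflexive (sym (sum-zero {n} λ _ → refl))
  length≤ht-dev (s ∷ w) r = subst₂ _≤_ (ℤ.+-comm (+ length w) 1ℤ) (sym (ht-dev s w))
    (ℤ.+-mono-≤ (length≤ht-dev w (proj₁ (Reduced-tail s w r))) (ℤ.i<j⇒suc[i]≤j (proj₂ (Reduced-tail s w r))))

  In : (Fin n → Bool) → Word → Set
  In D w = All (λ s → D s ≡ true) w

  unit-supported : ∀ {D : Fin n → Bool} {s} → D s ≡ true → Supported D (unit s)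
  unit-supported {D} {s} e i e' with s Fin.≟ i
  ... | yes refl = contradiction (trans (sym e) e') λ ()
  ... | no _ = refl

  axpy-supported : ∀ {D : Fin n → Bool} {x y} c → Supported D x → Supported D y → Supported D (axpy x c y)
  axpy-supported {x = x} c h k i e = trans (cong₂ (λ a b → a + c * b) (h i e) (k i e))
      (trans (ℤ.+-identityˡ (c * 0ℤ)) (ℤ.*-zeroʳ c))

  reflect-supported : ∀ {D : Fin n → Bool} {s x} → D s ≡ true → Supported D x → Supported D (reflect s x)
  reflect-supported {D} {s} {x} e h = axpy-supported (- pair x s) h (unit-supported {D} e)

  dev-supported : ∀ {D : Fin n → Bool} {w} → In D w → Supported D (dev w)
  dev-supported [] i e = refl
  dev-supported {D} {s ∷ w} (e ∷ es) = axpy-supported {D} {reflect s (dev w)} {unit s} 1ℤ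
      (reflect-supported {D} {s} {dev w} e (dev-supported es)) (unit-supported {D} e)

  DefiniteOn : (Fin n → Bool) → Set
  DefiniteOn D = ∀ {x} → Supported D x → ¬ x ≗ 0ᵛ → 0ℤ < form x x

  -- The height h of `dev w` grows only like the square root of the norm: the norm is 2h, each
  -- coordinate has square at most 2Ch, hence h² ≤ K · 2Ch and h ≤ 2KC.
  length-bound : ∀ D → DefiniteOn D → ∃[ K ] (∀ w → In D w → Reduced w → length w ℕ.≤ K)
  length-bound D positive = ℤ.∣ bound ∣ , λ w w∈D r → ℤ.drop‿+≤+
      (ℤ.≤-trans (length≤ht-dev w r) (ℤ.≤-trans (ht-bound w w∈D) (i≤+∣i∣ bound)))
    where
    module Mask = Masked B B-sym D 0ᵛ (λ _ _ → refl)
    dot-0 : ∀ x → dot 0ᵛ x ≡ 0ℤ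
    dot-0 x = sum-zero λ i → ℤ.*-zeroˡ (x i)
    no-dot : ∀ x → form x x + dot 0ᵛ x * dot 0ᵛ x ≡ form x x
    no-dot x = trans (cong (λ d → form x x + d * d) (dot-0 x)) (ℤ.+-identityʳ (form x x))
    definite = Mask.definite (λ {x} h ne → subst (0ℤ <_) (sym (no-dot x)) (positive h ne))
    C K bound : ℤ
    C = proj₁ definite
    C≥0 : 0ℤ ≤ C
    C≥0 = proj₁ (proj₂ definite)
    ones : Vector n
    ones _ = 1ℤ
    K = proj₁ (linear-square-bound ones)
    K≥0 : 0ℤ ≤ K
    K≥0 = proj₁ (proj₂ (linear-square-bound ones))
    bound = K * (C * + 2)
    bound≥0 : 0ℤ ≤ bound
    bound≥0 = nonneg-* {K} {C * + 2} K≥0 (nonneg-* {C} {+ 2} C≥0 (+≤+ z≤n))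
    ht-bound : ∀ w → In D w → ht (dev w) ≤ bound
    ht-bound w w∈D = decide (0ℤ ℤ.<? h)
      where
      x = dev w
      h = ht x
      decide : Dec (0ℤ < h) → h ≤ bound
      decide (no ¬0<h) = ℤ.≤-trans (ℤ.≮⇒≥ ¬0<h) bound≥0
      decide (yes 0<h) = ℤ.0≤i-j⇒j≤i (cancel-positive 0<h (subst (0ℤ ≤_) (factor h K C) (sub-nonneg
          (subst (λ z → z * z ≤ K * (C * (+ 2 * h))) (sum-cong-≗ λ i → ℤ.*-identityˡ (x i))
            (proj₂ (proj₂ (linear-square-bound ones)) x (C * (+ 2 * h))
                (nonneg-* {C} {+ 2 * h} C≥0 (nonneg-* {+ 2} {h} (+≤+ z≤n) (ℤ.<⇒≤ 0<h)))
              λ i → subst (λ q → x i * x i ≤ C * q) (trans (no-dot x) (norm-dev w))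
                  (proj₂ (proj₂ definite) {x} (dev-supported w∈D) i))))))
        where
        factor : ∀ h K C → K * (C * (+ 2 * h)) - h * h ≡ h * (K * (C * + 2) - h)
        factor = solve-∀

  words : ℕ → List Word
  words zero = [] ∷ []
  words (suc k) = [] ∷ List.concatMap (λ s → List.map (s ∷_) (words k)) (List.allFin n)

  ∈-words : ∀ k w → length w ℕ.≤ k → Any (w ≡_) (words k)
  ∈-words zero [] _ = here refl
  ∈-words (suc k) [] _ = here refl
  ∈-words (suc k) (s ∷ w) (s≤s h) = there (∈-concatMap⁺ (λ s → List.map (s ∷_) (words k))
    (Any.map (λ { refl → ∈-map⁺ (s ∷_) (∈-words k w h) }) (∈-allFin s)))

  definite⇒finite : DefiniteOn (λ _ → true) → FiniteW
  definite⇒finite positive = words K , λ w →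
      Any.map (λ e → ~trans (~sym (proj₁ (proj₂ (reduce w)))) (~reflexive e))
        (∈-words K (proj₁ (reduce w)) (proj₂ (length-bound (λ _ → true) positive) (proj₁ (reduce w))
            (everywhere (proj₁ (reduce w))) (proj₂ (proj₂ (reduce w)))))
    where
    K = proj₁ (length-bound (λ _ → true) positive)
    everywhere : ∀ w → In (λ _ → true) w
    everywhere [] = []
    everywhere (s ∷ w) = refl ∷ everywhere w

  finite-or-degenerate : (∃[ x ] (¬ x ≗ 0ᵛ × form x x ≤ 0ℤ)) ⊎ FiniteW
  finite-or-degenerate = [ inj₁ , (λ (q≥0 , C , C≥0 , bound) → inj₂ (definite⇒finite λ {x} _ x≢0 → ℤ.≰⇒> λ q≤0 → x≢0 λ i →
      square-zero (x i) (subst (λ q → x i * x i ≤ q) (trans (cong (_*_ C) (ℤ.≤-antisym q≤0 (q≥0 x))) (ℤ.*-zeroʳ C))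
          (bound x i)))) ]′
    (definite-or-not B B-sym)

-- Degenerate vectors of minimal height

sum-mono : ∀ {n} {f g : Fin n → ℤ} → (∀ i → f i ≤ g i) → sum f ≤ sum g
sum-mono {zero} h = ℤ.≤-refl
sum-mono {suc n} h = ℤ.+-mono-≤ (h zero) (sum-mono (h ∘ suc))

sum-nonneg-zero : ∀ {n} (f : Fin n → ℤ) → (∀ i → 0ℤ ≤ f i) → sum f ≤ 0ℤ → ∀ i → f i ≡ 0ℤ
sum-nonneg-zero f h s i = ℤ.≤-antisym (ℤ.≤-trans (≤-sum f h i) s) (h i)

1≤⇒0< : ∀ {i} → 1ℤ ≤ i → 0ℤ < i
1≤⇒0< = ℤ.suc[i]≤j⇒i<j

0<⇒1≤ : ∀ {i} → 0ℤ < i → 1ℤ ≤ i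
0<⇒1≤ = ℤ.i<j⇒suc[i]≤j

positive-* : ∀ {a b} → 0ℤ < a → 0ℤ < b → 0ℤ < a * b
positive-* {+ suc a} {+ suc b} _ _ = +<+ (s≤s z≤n)
positive-* {+ 0} (+<+ ())
positive-* {+ suc a} {+ 0} _ (+<+ ())

cancel-strict : ∀ {a b} → 0ℤ < a → 0ℤ < a * b → 0ℤ < b
cancel-strict {a} {b} 0<a 0<ab = ℤ.≰⇒> λ b≤0 →
  ℤ.<⇒≱ 0<ab (ℤ.0≤i-j⇒j≤i (subst (0ℤ ≤_) (rearrange a b) (nonneg-* {a} { - b} (ℤ.<⇒≤ 0<a) (ℤ.neg-mono-≤ b≤0))))
  where
  rearrange : ∀ a b → a * - b ≡ 0ℤ - a * b
  rearrange = solve-∀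

find-nonzero : ∀ {n} {x : Vector n} → ¬ x ≗ 0ᵛ → ∃[ i ] x i ≢ 0ℤ
find-nonzero {x = x} x≢0 = Fin.¬∀⟶∃¬ _ _ (λ i → x i ℤ.≟ 0ℤ) x≢0

find-positive : ∀ {n} {x : Vector n} → Pos x → ¬ x ≗ 0ᵛ → ∃[ i ] 0ℤ < x i
find-positive p x≢0 = proj₁ (find-nonzero x≢0) , ℤ.≤∧≢⇒< (p _) (proj₂ (find-nonzero x≢0) ∘ sym)

Pos-ht : ∀ {n} {x : Vector n} → Pos x → ¬ x ≗ 0ᵛ → 0ℤ < ht x
Pos-ht {x = x} p x≢0 = ℤ.<-≤-trans (proj₂ (find-positive p x≢0)) (≤-sum x p _)

∣_∣ᵛ : ∀ {n} → Vector n → Vector n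
∣ x ∣ᵛ i = + ℤ.∣ x i ∣

module Cartan {n : ℕ} (M : CoxeterMatrix n) (simply-laced : Coxeter.SimplyLaced M) where
  open Lengths M simply-laced public

  B-off : ∀ {i j} → i ≢ j → -1ℤ ≤ B i j × B i j ≤ 0ℤ
  B-off {i} {j} i≢j with bond i j
  ... | equal i≡j = contradiction i≡j i≢j
  ... | commute _ e rewrite e = -≤+ , ℤ.≤-refl
  ... | braid _ e rewrite e = ℤ.≤-refl , -≤+

  form-double : ∀ x y → form x y ≡ sum (λ i → sum (λ j → x i * (B i j * y j)))
  form-double x y = sum-cong-≗ λ i → *-distribˡ-sum (x i) (λ j → B i j * y j)

  -- Off-diagonal entries are ≤ 0, so replacing x_i x_j by its absolute value can only lower the
  -- form.
  form-abs : ∀ x → form ∣ x ∣ᵛ ∣ x ∣ᵛ ≤ form x x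
  form-abs x = subst₂ _≤_ (sym (form-double ∣ x ∣ᵛ ∣ x ∣ᵛ)) (sym (form-double x x)) (sum-mono λ i → sum-mono λ j → term i j)
    where
    abs-* : ∀ a c → + ℤ.∣ a ∣ * + ℤ.∣ c ∣ ≡ + ℤ.∣ a * c ∣
    abs-* a c = trans (sym (ℤ.pos-* ℤ.∣ a ∣ ℤ.∣ c ∣)) (cong +_ (sym (ℤ.abs-* a c)))
    pull : ∀ a b c → a * (b * c) ≡ b * (a * c)
    pull = solve-∀
    term : ∀ i j → + ℤ.∣ x i ∣ * (B i j * + ℤ.∣ x j ∣) ≤ x i * (B i j * x j)
    term i j = subst₂ _≤_ (sym (trans (pull (+ ℤ.∣ x i ∣) (B i j) (+ ℤ.∣ x j ∣)) (cong (_*_ (B i j)) (abs-* (x i) (x j)))))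
        (sym (pull (x i) (B i j) (x j))) (compare (i Fin.≟ j))
      where
      e = x i * x j
      compare : Dec (i ≡ j) → B i j * + ℤ.∣ e ∣ ≤ B i j * e
      compare (yes refl) = ℤ.≤-reflexive (cong (_*_ (B i i)) (ℤ.0≤i⇒+∣i∣≡i (square-nonneg (x i))))
      compare (no i≢j) = ≤-from (rearrange (B i j) e (+ ℤ.∣ e ∣))
          (nonneg-* { - B i j} {+ ℤ.∣ e ∣ - e} (ℤ.neg-mono-≤ (proj₂ (B-off i≢j))) (sub-nonneg (i≤+∣i∣ e)))
        where
        rearrange : ∀ b e f → b * e - b * f ≡ - b * (f - e)
        rearrange = solve-∀

  abs-≢0 : ∀ {x : Vector n} → ¬ x ≗ 0ᵛ → ¬ ∣ x ∣ᵛ ≗ 0ᵛ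
  abs-≢0 x≢0 h = x≢0 λ i → ℤ.∣i∣≡0⇒i≡0 (ℤ.+-injective (h i))

  form-cancel : ∀ x s → form (axpy x -1ℤ (unit s)) (axpy x -1ℤ (unit s)) ≡ form x x - + 2 * pair x s + + 2
  form-cancel x s = trans (form-axpy² x -1ℤ (unit s))
      (trans (cong₂ (λ c d → form x x + -1ℤ * (c + c) + -1ℤ * -1ℤ * d) (form-unitʳ x s) (form-unit s))
      (simplify (form x x) (pair x s)))
    where
    simplify : ∀ f c → f + -1ℤ * (c + c) + -1ℤ * -1ℤ * + 2 ≡ f - + 2 * c + + 2
    simplify = solve-∀

  remove-Pos : ∀ {x : Vector n} s → Pos x → 0ℤ < x s → Pos (axpy x -1ℤ (unit s))
  remove-Pos {x} s p 0<xs k = go (s Fin.≟ k)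
    where
    go : Dec (s ≡ k) → 0ℤ ≤ x k + -1ℤ * unit s k
    go (yes refl) = subst (λ u → 0ℤ ≤ x s + -1ℤ * u) (sym (unit-same s)) (sub-nonneg (0<⇒1≤ 0<xs))
    go (no s≢k) = subst (λ u → 0ℤ ≤ x k + -1ℤ * u) (sym (unit-other s≢k)) (subst (0ℤ ≤_) (sym (ℤ.+-identityʳ (x k))) (p k))

  ht-remove : ∀ (x : Vector n) s → ht (axpy x -1ℤ (unit s)) ≡ ht x - 1ℤ
  ht-remove x s = trans (sum-axpy x (unit s) -1ℤ) (cong (λ c → ht x + -1ℤ * c) (ht-unit s))

  pred-< : ∀ i → i - 1ℤ < i
  pred-< i = ℤ.suc[i]≤j⇒i<j (ℤ.≤-reflexive (cancel i))
    where
    cancel : ∀ i → 1ℤ + (i - 1ℤ) ≡ i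
    cancel = solve-∀

  remove-≗0 : ∀ {x : Vector n} s → axpy x -1ℤ (unit s) ≗ 0ᵛ → x ≗ unit s
  remove-≗0 {x} s h k = trans (split (x k) (unit s k)) (trans (cong (_+ unit s k) (h k)) (ℤ.+-identityˡ (unit s k)))
    where
    split : ∀ x u → x ≡ x + -1ℤ * u + u
    split = solve-∀

  module MinimalDegenerate (δ : Vector n) (δ-pos : Pos δ) (δ≢0 : ¬ δ ≗ 0ᵛ) (degenerate : form δ δ ≤ 0ℤ)
    (smaller : ∀ {y} → Pos y → ¬ y ≗ 0ᵛ → ht y < ht δ → 0ℤ < form y y) where

    half : ℤ
    half = proj₁ (quad-even B B-sym B-diag δ)

    form-half : form δ δ ≡ + 2 * half
    form-half = proj₂ (quad-even B B-sym B-diag δ)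

    δ-not-unit : ∀ {s} → ¬ δ ≗ unit s
    δ-not-unit {s} h = contradiction (subst (_≤ 0ℤ) (trans (form-cong h h) (form-unit s)) degenerate) λ { (+≤+ ()) }

    -- δ - α_s is nonzero and lower than δ, so that 0 < 2h - 2⟨δ , α_s⟩ + 2, where B(δ, δ) = 2h.
    pair-≤ : ∀ s → 0ℤ < δ s → pair δ s ≤ half
    pair-≤ s 0<δs = ℤ.0≤i-j⇒j≤i (subst (0ℤ ≤_) (cancel half (pair δ s))
        (sub-nonneg (0<⇒1≤ (cancel-strict {+ 2} (+<+ (s≤s z≤n)) (subst (0ℤ <_)
        (trans (form-cancel δ s) (trans (cong (λ f → f - + 2 * pair δ s + + 2) form-half) (factor half (pair δ s))))
        (smaller (remove-Pos s δ-pos 0<δs) (δ-not-unit ∘ remove-≗0 s)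
            (subst (_< ht δ) (sym (ht-remove δ s)) (pred-< (ht δ)))))))))
      where
      factor : ∀ h c → + 2 * h - + 2 * c + + 2 ≡ + 2 * (h - c + 1ℤ)
      factor = solve-∀
      cancel : ∀ h c → h - c + 1ℤ - 1ℤ ≡ h - c
      cancel = solve-∀

    term-≤ : ∀ s → 0ℤ ≤ δ s * half - δ s * pair δ s
    term-≤ s = go (0ℤ ℤ.<? δ s)
      where
      go : Dec (0ℤ < δ s) → 0ℤ ≤ δ s * half - δ s * pair δ s
      go (yes 0<δs) = subst (0ℤ ≤_) (distribute (δ s) half (pair δ s))
          (nonneg-* {δ s} (δ-pos s) (sub-nonneg (pair-≤ s 0<δs)))
        where
        distribute : ∀ d h c → d * (h - c) ≡ d * h - d * c
        distribute = solve-∀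
      go (no δs≯0) = ℤ.≤-reflexive (sym (trans (cong (λ d → d * half - d * pair δ s)
          (ℤ.≤-antisym (ℤ.≮⇒≥ δs≯0) (δ-pos s))) refl))

    -- Otherwise δ would be α_s or a sum α_s + α_r, whose norm is at least 2.
    3≤ht : + 3 ≤ ht δ
    3≤ht = ℤ.≮⇒≥ λ ht<3 → small (ℤ.i<j⇒suc[i]≤j ht<3)
      where
      s : Fin n
      s = proj₁ (find-positive δ-pos δ≢0)
      y = axpy δ -1ℤ (unit s)
      y-pos : Pos y
      y-pos = remove-Pos s δ-pos (proj₂ (find-positive δ-pos δ≢0))
      y≢0 : ¬ y ≗ 0ᵛ
      y≢0 = δ-not-unit ∘ remove-≗0 s
      r : Fin n
      r = proj₁ (find-positive y-pos y≢0)
      small : ¬ (1ℤ + ht δ ≤ + 3)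
      small h = contradiction (subst (_≤ 0ℤ) norm degenerate) (ℤ.<⇒≱ (ℤ.<-≤-trans (+<+ (s≤s z≤n)) 2≤))
        where
        y'-pos : Pos (axpy y -1ℤ (unit r))
        y'-pos = remove-Pos r y-pos (proj₂ (find-positive y-pos y≢0))
        ht-y' : ht (axpy y -1ℤ (unit r)) ≤ 0ℤ
        ht-y' = subst (_≤ 0ℤ) (sym (trans (ht-remove y r) (cong (_- 1ℤ) (ht-remove δ s))))
            (subst (_≤ 0ℤ) (rearrange (ht δ)) (ℤ.+-monoˡ-≤ (- (+ 3)) h))
          where
          rearrange : ∀ h → 1ℤ + h - + 3 ≡ h - 1ℤ - 1ℤ
          rearrange = solve-∀
        y≗ : y ≗ unit r
        y≗ = remove-≗0 r (sum-nonneg-zero (axpy y -1ℤ (unit r)) y'-pos ht-y')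
        δ≗ : δ ≗ axpy (unit r) 1ℤ (unit s)
        δ≗ k = trans (split (δ k) (unit s k)) (cong (_+ 1ℤ * unit s k) (y≗ k))
          where
          split : ∀ d u → d ≡ d + -1ℤ * u + 1ℤ * u
          split = solve-∀
        norm : form δ δ ≡ + 4 + + 2 * B s r
        norm = trans (form-cong δ≗ δ≗) (trans (form-axpy² (unit r) 1ℤ (unit s))
            (trans (cong₂ (λ a b → a + 1ℤ * (form (unit r) (unit s) + form (unit r) (unit s)) + 1ℤ * 1ℤ * b) (form-unit r)
            (form-unit s))
          (trans (cong (λ c → + 2 + 1ℤ * (c + c) + 1ℤ * 1ℤ * + 2) (trans (form-unitʳ (unit r) s) (pair-unit r s)))
              (simplify (B s r)))))
          where
          simplify : ∀ c → + 2 + 1ℤ * (c + c) + 1ℤ * 1ℤ * + 2 ≡ + 4 + + 2 * c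
          simplify = solve-∀
        -1≤B : -1ℤ ≤ B s r
        -1≤B = go (s Fin.≟ r)
          where
          go : Dec (s ≡ r) → -1ℤ ≤ B s r
          go (yes s≡r) = subst (λ k → -1ℤ ≤ B s k) s≡r (subst (-1ℤ ≤_) (sym (B-diag s)) -≤+)
          go (no s≢r) = proj₁ (B-off s≢r)
        2≤ : + 2 ≤ + 4 + + 2 * B s r
        2≤ = ℤ.+-monoʳ-≤ (+ 4) (ℤ.*-monoˡ-≤-nonNeg (+ 2) -1≤B)

    -- Summing δ_s ⟨δ , α_s⟩ ≤ δ_s h over s gives 2h ≤ (ht δ) h, which excludes h < 0 because ht δ ≥
    -- 3.
    half≡0 : half ≡ 0ℤ
    half≡0 = ℤ.≤-antisym half≤0 (ℤ.≮⇒≥ λ half<0 → ℤ.<⇒≱ half<0 (nonneg half<0))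
      where
      half≤0 : half ≤ 0ℤ
      half≤0 = ℤ.≮⇒≥ λ 0<half → ℤ.<⇒≱ (positive-* {+ 2} (+<+ (s≤s z≤n)) 0<half) (subst (_≤ 0ℤ) form-half degenerate)
      total : 0ℤ ≤ (ht δ - + 2) * half
      total = subst (0ℤ ≤_) (trans (sum-- (λ s → δ s * half) (λ s → δ s * pair δ s))
          (trans (cong₂ _-_ (sym (*-distribʳ-sum half δ)) form-half) (collect (ht δ) half)))
              (sum-nonneg (λ s → δ s * half - δ s * pair δ s) term-≤)
        where
        collect : ∀ t h → t * h - + 2 * h ≡ (t - + 2) * h
        collect = solve-∀
      nonneg : half < 0ℤ → 0ℤ ≤ half
      nonneg _ = cancel-positive {ht δ - + 2} (1≤⇒0< (subst (1ℤ ≤_) refl (ℤ.+-monoˡ-≤ (- (+ 2)) 3≤ht))) total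

    isotropic : form δ δ ≡ 0ℤ
    isotropic = trans form-half (cong (_*_ (+ 2)) half≡0)

    null : ∀ s → 0ℤ < δ s → pair δ s ≡ 0ℤ
    null s 0<δs = [ (λ δs≡0 → contradiction (subst (0ℤ <_) δs≡0 0<δs) (ℤ.<-irrefl refl)) , id ]′
      (ℤ.i*j≡0⇒i≡0∨j≡0 (δ s) (trans (sym (ℤ.neg-involutive _))
          (cong -_ (sum-nonneg-zero (λ s → - (δ s * pair δ s)) nonpositive
        (ℤ.≤-reflexive (trans (sum-neg (λ s → δ s * pair δ s)) (cong -_ isotropic))) s))))
      where
      nonpositive : ∀ s → 0ℤ ≤ - (δ s * pair δ s)
      nonpositive s = subst (0ℤ ≤_) (trans (cong (_- δ s * pair δ s) (trans (cong (_*_ (δ s)) half≡0) (ℤ.*-zeroʳ (δ s))))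
          (ℤ.+-identityˡ _)) (term-≤ s)

    S : Fin n → Bool
    S s = does (0ℤ ℤ.<? δ s)

    S-true : ∀ {s} → S s ≡ true → 0ℤ < δ s
    S-true {s} e with 0ℤ ℤ.<? δ s
    ... | yes h = h

    S-false : ∀ {s} → S s ≡ false → δ s ≡ 0ℤ
    S-false {s} e with 0ℤ ℤ.<? δ s
    ... | no h = ℤ.≤-antisym (ℤ.≮⇒≥ h) (δ-pos s)

    δ-supported : Supported S δ
    δ-supported s = S-false

    supported-case : ∀ {x} → Supported S x → ∀ s → 0ℤ < δ s ⊎ x s ≡ 0ℤ
    supported-case {x} h s = go (S s) refl
      where
      go : ∀ b → S s ≡ b → 0ℤ < δ s ⊎ x s ≡ 0ℤ
      go true e = inj₁ (S-true e)
      go false e = inj₂ (h s e)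

    radical : ∀ {x} → Supported S x → form x δ ≡ 0ℤ
    radical {x} h = sum-zero λ s → [ (λ 0<δs → trans (cong (_*_ (x s)) (null s 0<δs)) (ℤ.*-zeroʳ (x s))) ,
      (λ xs≡0 → trans (cong (_* pair δ s) xs≡0) (ℤ.*-zeroˡ (pair δ s))) ]′ (supported-case {x} h s)

-- A bad interval

module BadInterval {n : ℕ} (M : CoxeterMatrix n) (simply-laced : Coxeter.SimplyLaced M) where
  open Lengths M simply-laced

  -- The hypotheses express through θ alone that θ + α_o is isotropic and orthogonal to its support.
  module _ (D : Fin n → Bool) (o : Fin n) (o∉D : D o ≡ false) (definite : DefiniteOn D)
    (θ : Vector n) (θ-pos : Pos θ) (θ-supported : Supported D θ) (θ-norm : form θ θ ≡ + 2)
    (θ-o : pair θ o ≡ - (+ 2)) (orthogonal : ∀ {γ} → Supported D γ → pair γ o ≡ - form γ θ)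
    where
    open ReflectionIn using (isReflection; isRoot)

    -- y is reached from a simple root by adding simple roots, every partial sum being a root.
    data Path : Vector n → Word → Fin n → Set where
      start : ∀ {y i} → D i ≡ true → y ≗ unit i → Path y [] i
      add : ∀ {y y' w i} j → D j ≡ true → pair y j ≡ 1ℤ → y ≗ reflect j y' → Path y' w i → Path y (j ∷ w) i

    Path-act : ∀ {y w i} → Path y w i → y ≗ act w (unit i)
    Path-act (start _ e) = e
    Path-act (add j _ _ e π) k = trans (e k) (reflect-cong j (Path-act π) k)

    Path-letters : ∀ {y w i} → Path y w i → In D w
    Path-letters (start _ _) = []
    Path-letters (add j d _ _ π) = d ∷ Path-letters π

    Path-end : ∀ {y w i} → Path y w i → D i ≡ true
    Path-end (start d _) = d
    Path-end (add _ _ _ _ π) = Path-end π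

    reflect-back : ∀ {y} y' j → y ≗ reflect j y' → y' ≗ reflect j y
    reflect-back y' j e k = trans (sym (reflect-involutive j y' k)) (sym (reflect-cong j e k))

    Path-sum : ∀ {y} y' j → pair y j ≡ 1ℤ → y ≗ reflect j y' → y ≗ axpy y' 1ℤ (unit j)
    Path-sum {y} y' j p e k = trans (split (y k) (unit j k))
      (cong (_+ 1ℤ * unit j k) (trans (cong (λ c → y k + - c * unit j k) (sym p)) (sym (reflect-back y' j e k))))
      where
      split : ∀ y u → y ≡ y + - 1ℤ * u + 1ℤ * u
      split = solve-∀

    positive-summand : ∀ {y} → Pos y → form y y ≡ + 2 → ∃[ j ] (0ℤ < y j × 0ℤ < pair y j)
    positive-summand {y} p e = find (Fin.any? (λ j → (0ℤ ℤ.<? y j) ×-dec (0ℤ ℤ.<? pair y j)))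
      where
      find : Dec (∃[ j ] (0ℤ < y j × 0ℤ < pair y j)) → ∃[ j ] (0ℤ < y j × 0ℤ < pair y j)
      find (yes h) = h
      find (no none) = contradiction (subst (0ℤ ≤_) (trans (sum-neg (λ j → y j * pair y j)) (cong -_ e))
          (sum-nonneg (λ j → - (y j * pair y j)) nonneg)) λ ()
        where
        nonneg : ∀ j → 0ℤ ≤ - (y j * pair y j)
        nonneg j = go (0ℤ ℤ.<? y j)
          where
          go : Dec (0ℤ < y j) → 0ℤ ≤ - (y j * pair y j)
          go (yes h) = subst (0ℤ ≤_) (sym (ℤ.neg-distribʳ-* (y j) (pair y j)))
            (nonneg-* {y j} { - pair y j} (p j) (ℤ.neg-mono-≤ (ℤ.≮⇒≥ λ h' → none (j , h , h'))))
          go (no ¬h) = ℤ.≤-reflexive (sym (cong -_ (trans (cong (_* pair y j) (ℤ.≤-antisym (ℤ.≮⇒≥ ¬h) (p j)))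
              (ℤ.*-zeroˡ (pair y j)))))

    supported-positive : ∀ {y j} → Supported D y → 0ℤ < y j → D j ≡ true
    supported-positive {y} {j} h 0<y = go (D j) refl
      where
      go : ∀ b → D j ≡ b → b ≡ true
      go true _ = refl
      go false e = contradiction (subst (0ℤ <_) (h j e) 0<y) (ℤ.<-irrefl refl)

    reflect-by-1 : ∀ {y} j → pair y j ≡ 1ℤ → reflect j y ≗ axpy y -1ℤ (unit j)
    reflect-by-1 {y} j p k = cong (λ c → y k + - c * unit j k) p

    -- For a simple root with y_j > 0 and c = ⟨y , α_j⟩ > 0, the vector y - α_j is zero or has norm
    -- 4 - 2c > 0, which means c = 1. So each such y turns out to be a root.
    path : ∀ h {y} → Pos y → Supported D y → form y y ≡ + 2 → ht y ≤ + h → ∃[ w ] ∃[ i ] Path y w i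
    path h {y} p sup e y≤h = go h y≤h (Fin.all? λ k → y k ℤ.≟ unit j k)
      where
      j = proj₁ (positive-summand p e)
      0<yj = proj₁ (proj₂ (positive-summand p e))
      0<pair = proj₂ (proj₂ (positive-summand p e))
      d : D j ≡ true
      d = supported-positive {y} sup 0<yj
      go : ∀ h → ht y ≤ + h → Dec (y ≗ unit j) → ∃[ w ] ∃[ i ] Path y w i
      go h y≤h (yes e) = [] , j , start d e
      go zero y≤h (no _) = contradiction (ℤ.<-≤-trans (ℤ.<-≤-trans 0<yj (≤-sum y p j)) y≤h) λ { (+<+ ()) }
      go (suc h) y≤h (no y≢α) = j ∷ proj₁ rec , proj₁ (proj₂ rec) ,
          add j d pairing (λ k → sym (reflect-involutive j y k)) (proj₂ (proj₂ rec))
        where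
        y' = axpy y -1ℤ (unit j)
        norm-y' : form y' y' ≡ + 4 - + 2 * pair y j
        norm-y' = trans (form-axpy² y -1ℤ (unit j)) (trans
            (cong₂ (λ a b → a + -1ℤ * (form y (unit j) + form y (unit j)) + -1ℤ * -1ℤ * b) e (form-unit j))
          (trans (cong (λ c → + 2 + -1ℤ * (c + c) + -1ℤ * -1ℤ * + 2) (form-unitʳ y j)) (simplify (pair y j))))
          where
          simplify : ∀ c → + 2 + -1ℤ * (c + c) + -1ℤ * -1ℤ * + 2 ≡ + 4 - + 2 * c
          simplify = solve-∀
        y'≢0 : ¬ y' ≗ 0ᵛ
        y'≢0 h = y≢α λ k → trans (split (y k) (unit j k)) (trans (cong (_+ unit j k) (h k)) (ℤ.+-identityˡ (unit j k)))
          where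
          split : ∀ y u → y ≡ y + -1ℤ * u + u
          split = solve-∀
        y'-supported : Supported D y'
        y'-supported = axpy-supported {D} {y} {unit j} -1ℤ sup (unit-supported {D} d)
        pairing : pair y j ≡ 1ℤ
        pairing = ℤ.≤-antisym (small (pair y j) (subst (0ℤ <_) norm-y' (definite y'-supported y'≢0))) (ℤ.i<j⇒suc[i]≤j 0<pair)
          where
          small : ∀ c → 0ℤ < + 4 - + 2 * c → c ≤ 1ℤ
          small c h = ℤ.≮⇒≥ λ 1<c → ℤ.<⇒≱ h (≤-from (rearrange c)
              (nonneg-* {+ 2} {c - + 2} (+≤+ z≤n) (sub-nonneg (ℤ.i<j⇒suc[i]≤j 1<c))))
            where
            rearrange : ∀ c → 0ℤ - (+ 4 - + 2 * c) ≡ + 2 * (c - + 2)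
            rearrange = solve-∀
        y'-pos : Pos y'
        y'-pos k = go' (j Fin.≟ k)
          where
          go' : Dec (j ≡ k) → 0ℤ ≤ y' k
          go' (yes refl) = subst (λ u → 0ℤ ≤ y j + -1ℤ * u) (sym (unit-same j)) (sub-nonneg (ℤ.i<j⇒suc[i]≤j 0<yj))
          go' (no j≢k) = subst (λ u → 0ℤ ≤ y k + -1ℤ * u) (sym (unit-other j≢k))
              (subst (0ℤ ≤_) (sym (ℤ.+-identityʳ (y k))) (p k))
        ht-y' : ht y' ≡ ht y - 1ℤ
        ht-y' = trans (sum-axpy y (unit j) -1ℤ) (cong (λ c → ht y + -1ℤ * c) (ht-unit j))
        same : reflect j y ≗ y'
        same = reflect-by-1 {y} j pairing
        rec : ∃[ w ] ∃[ i ] Path (reflect j y) w i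
        rec = path h (Pos-resp (λ k → sym (same k)) y'-pos) (λ k e → trans (same k) (y'-supported k e))
          (trans (reflect-form j y y) e)
          (subst (_≤ + h) (sym (trans (sum-cong-≗ same) ht-y')) (ℤ.+-monoˡ-≤ -1ℤ y≤h))

    θ-path : ∃[ w ] ∃[ i ] Path θ w i
    θ-path = path ℤ.∣ ht θ ∣ θ-pos θ-supported θ-norm (i≤+∣i∣ (ht θ))

    -- η turns negative at a letter j where it has become α_j. There its product with the partial
    -- sum is 1 by construction of the path, and the earlier letters preserve the product.
    Path-inversion : ∀ {y w i η} → Path y w i → Root η → Pos η → Neg (iact w η) → form η y ≡ 1ℤ
    Path-inversion (start _ _) ρ p q = contradiction q (Pos-Neg ρ p)
    Path-inversion {y} {_} {_} {η} (add {y' = y'} j d py e π) ρ p q = [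
        (λ η≗α → trans (form-cong {η} {unit j} {y} {y} η≗α (λ _ → refl)) (trans (form-unitˡ j y) py)) ,
        (λ p' → trans (sym (reflect-form j η y)) (trans
            (form-cong {reflect j η} {reflect j η} (λ _ → refl) (λ k → sym (reflect-back y' j e k)))
          (Path-inversion π (Root-reflect j ρ) p' q))) ]′
      (reflect-Pos j ρ p)

    act-other : ∀ {w} → In D w → ∀ x {k} → D k ≡ false → act w x k ≡ x k
    act-other [] x e = refl
    act-other {s ∷ w} (d ∷ ds) x {k} e = trans (reflect-other (act w x) λ { refl → contradiction (trans (sym d) e) λ () }) (act-other ds x e)

    iact-other : ∀ {w} → In D w → ∀ x {k} → D k ≡ false → iact w x k ≡ x k
    iact-other [] x e = refl
    iact-other {s ∷ w} (d ∷ ds) x {k} e = trans (iact-other ds (reflect s x) e) (reflect-other x λ { refl → contradiction (trans (sym d) e) λ () })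

    Pos-by-coordinate : ∀ {γ} k → Root γ → 0ℤ < γ k → Pos γ
    Pos-by-coordinate k ρ h = [ id , (λ q → contradiction (q k) (ℤ.<⇒≱ h)) ]′ (Root-sign ρ)

    Longest : Word → Set
    Longest z = In D z × (∀ j → D j ≡ true → Neg (act z (unit j)))

    -- A reduced z is extended on the right as long as it keeps some α_j with j in D positive; the
    -- length bound on the definite part D ends this.
    longest : ∃[ z ] Longest z
    longest = go (suc K) [] [] refl (ℕ.≤-refl)
      where
      K = proj₁ (length-bound D definite)
      go : ∀ fuel z → In D z → Reduced z → K ℕ.< length z ℕ.+ fuel → ∃[ z ] Longest z
      go zero z z∈D r K<z = contradiction (proj₂ (length-bound D definite) z z∈D r)
          (ℕ.<⇒≱ (subst (K ℕ.<_) (ℕ.+-identityʳ (length z)) K<z))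
      go (suc fuel) z z∈D r K<z = decide (Fin.any? λ j → (D j Bool.≟ true) ×-dec Fin.all? (λ k → 0ℤ ℤ.≤? act z (unit j) k))
        where
        decide : Dec (∃[ j ] (D j ≡ true × Pos (act z (unit j)))) → ∃[ z ] Longest z
        decide (yes (j , d , p)) = go fuel (z ▷ j) (All.++⁺ z∈D (d ∷ []))
          (trans (ℓ-up-simple z j p) (trans (cong (_+ 1ℤ) r) (sym (cong +_ (List.length-++ z)))))
          (subst (K ℕ.<_) (trans (ℕ.+-suc (length z) fuel)
              (trans (cong (ℕ._+ fuel) (ℕ.+-comm 1 (length z))) (cong (ℕ._+ fuel) (sym (List.length-++ z))))) K<z)
        decide (no none) = z , z∈D , λ j d → [ (λ p → contradiction (j , d , p) none) , id ]′ (unit-sign z j)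

    Longest-Neg : ∀ {z y w i} → Longest z → Path y w i → Neg (act z y)
    Longest-Neg {z} (_ , h) (start {i = i} d e) = Neg-resp (act-cong z (λ k → sym (e k))) (h i d)
    Longest-Neg {z} {y} L@(_ , h) (add {y' = y'} j d py e π) k = subst (_≤ 0ℤ)
      (sym (trans (act-cong z (Path-sum y' j py e) k) (act-axpy z y' 1ℤ (unit j) k)))
      (ℤ.+-mono-≤ (Longest-Neg L π k) (subst (_≤ 0ℤ) (sym (ℤ.*-identityˡ _)) (h j d k)))

    -- Conjugating s_b by s_a shows that the reflection in a + b raises the length by at least 3.
    no-cover : ∀ u {a b γ r} → Root a → Root b → Pos a → Pos b → form a b ≡ -1ℤ → γ ≗ axpy a 1ℤ b →
               Pos (iact u a) → Pos (iact u b) → ReflectionIn γ r → ℓ (r ++ u) ≢ ℓ u + 1ℤ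
    no-cover u {a} {b} {γ} {r} ρa ρb pa pb ab γ≗ Ua Ub τ e = ℤ.<⇒≱ third
        (ℤ.≤-trans (ℤ.≤-reflexive (trans (ℓ-respects-~ conjugate) e))
        (ℤ.≤-trans (ℤ.≤-reflexive (ℤ.+-comm (ℓ u) 1ℤ)) (ℤ.≤-trans (ℤ.i<j⇒suc[i]≤j first) (ℤ.<⇒≤ second))))
      where
      A = proj₁ (Root⇒reflection ρa)
      τA = proj₂ (Root⇒reflection ρa)
      C = proj₁ (Root⇒reflection ρb)
      τC = proj₂ (Root⇒reflection ρb)
      ba : form b a ≡ -1ℤ
      ba = trans (form-sym b a) ab
      A-b : act A b ≗ γ
      A-b j = trans (reflection-act τA b j) (trans (cong (λ c → b j + - c * a j) ba) (trans (swap (a j) (b j)) (sym (γ≗ j))))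
        where
        swap : ∀ a b → b + - -1ℤ * a ≡ a + 1ℤ * b
        swap = solve-∀
      C-a : act C a ≗ γ
      C-a j = trans (reflection-act τC a j) (trans (cong (λ c → a j + - c * b j) ab) (trans (swap (a j) (b j)) (sym (γ≗ j))))
        where
        swap : ∀ a b → a + - -1ℤ * b ≡ a + 1ℤ * b
        swap = solve-∀
      iA-γ : iact A γ ≗ b
      iA-γ j = trans (iact-cong A (λ k → sym (A-b k)) j) (iact-act A b j)
      Uγ : Pos (iact u γ)
      Uγ = Pos-resp (λ j → sym (trans (iact-cong u γ≗ j) (iact-axpy u a 1ℤ b j))) λ j → ℤ.+-mono-≤ (Ua j)
          (subst (0ℤ ≤_) (sym (ℤ.*-identityˡ _)) (Ub j))
      first : ℓ u < ℓ (A ++ u)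
      first = ℓ-upˡ u τA pa Ua
      second : ℓ (A ++ u) < ℓ (C ++ A ++ u)
      second = ℓ-upˡ (A ++ u) τC pb (Pos-resp (λ j → sym (trans (cong (λ f → f j) (iact-++ A u b))
        (iact-cong u (λ k → trans (reflection-iact τA b k) (A-b k)) j))) Uγ)
      third : ℓ (C ++ A ++ u) < ℓ (A ++ C ++ A ++ u)
      third = ℓ-upˡ (C ++ A ++ u) τA pa (Pos-resp (λ j → sym (trans (cong (λ f → f j) (iact-++ C (A ++ u) a))
        (trans (iact-cong (A ++ u) (λ k → trans (reflection-iact τC a k) (C-a k)) j)
            (trans (cong (λ f → f j) (iact-++ A u γ)) (iact-cong u iA-γ j))))) Ub)
      conjugate : (A ++ C ++ A ++ u) ~ (r ++ u)
      conjugate = ~trans (~reflexive (sym (trans (List.++-assoc A (C ++ A) u) (cong (A ++_) (List.++-assoc C A u)))))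
        (++-congʳ u (~trans (++-congˡ A (++-congˡ C (~sym (reflection-involutive (isReflection τA)))))
            (same-reflection A-b (reflection-conj A τC) τ)))

    module Interval {z} (z-longest : Longest z) {w i} (π : Path θ w i) where
      z∈D : In D z
      z∈D = proj₁ z-longest

      -- Since z reverses all signs in W_D, the positive roots of W_D that u⁻¹ = z w⁻¹ keeps
      -- positive are those that w⁻¹ makes negative. From u to v one multiplies on the left by s_o,
      -- by the letters of w in order, and by s_i.
      u v : Word
      u = w ++ reverse z
      v = i ∷ reverse w ++ o ∷ u

      iact-u : ∀ x → iact u x ≗ act z (iact w x)
      iact-u x j = trans (cong (λ f → f j) (iact-++ w (reverse z) x)) (cong (λ f → f j) (iact-reverse′ z (iact w x)))

      iact-u-o : ∀ x → iact u x o ≡ x o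
      iact-u-o x = trans (iact-u x o) (trans (act-other z∈D (iact w x) o∉D) (iact-other (Path-letters π) x o∉D))

      reflect-o-o : ∀ x → reflect o x o ≡ x o - pair x o
      reflect-o-o x = trans (cong (λ c → x o + - pair x o * c) (unit-same o)) (cong (_+_ (x o)) (ℤ.*-identityʳ (- pair x o)))

      -- Every reflection met on the way from o u up to v has a root with positive o-coordinate.
      ascends-at : ∀ x a → In D x → Root (act x (unit a)) → D a ≡ true → 0ℤ < form (act x (unit a)) θ →
                   Pos (iact (reverse x ++ o ∷ u) (unit a))
      ascends-at x a x∈D ρ d h = Pos-resp (λ j → sym (trans (cong (λ f → f j) (iact-++ (reverse x) (o ∷ u) (unit a)))
          (cong (λ y → iact u (reflect o y) j) (iact-reverse′ x (unit a)))))
        (Pos-by-coordinate o (Root-iact u (Root-reflect o ρ)) (subst (0ℤ <_) (sym coordinate) h))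
        where
        γ = act x (unit a)
        γ-supported : Supported D γ
        γ-supported k e = trans (act-other x∈D (unit a) e) (unit-supported {D} d k e)
        coordinate : iact u (reflect o γ) o ≡ form γ θ
        coordinate = trans (iact-u-o (reflect o γ)) (trans (reflect-o-o γ)
            (trans (cong₂ _-_ (γ-supported o o∉D) (orthogonal γ-supported))
          (trans (ℤ.+-identityˡ _) (ℤ.neg-involutive (form γ θ)))))

      step-left : ∀ a x → Pos (iact x (unit a)) → BStep x (a ∷ x)
      step-left a x p = step {t = reverse x ++ a ∷ x}
          (reverse x , a , ~reflexive (cong (λ y → reverse x ++ a ∷ y) (sym (List.reverse-involutive x))))
        (~sym (\\-leftDividesˡ x (a ∷ x))) (subst (ℓ x <_) (sym (ℓ-ascent a x p))
            (ℤ.suc[i]≤j⇒i<j (ℤ.≤-reflexive (ℤ.+-comm 1ℤ (ℓ x)))))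

      -- x is the part of w already used, and θ = x y. The next letter a has ⟨xα_a , θ⟩ = ⟨α_a , y⟩
      -- = 1, the final letter has the norm 2; both are positive, so every letter is an ascent.
      climb : ∀ {y w' j} x → In D x → Path y w' j → θ ≗ act x y →
              (o ∷ u) ≤B (reverse x ++ o ∷ u) → ℓ (reverse x ++ o ∷ u) ≡ ℓ (o ∷ u) + + length x →
              (o ∷ u) ≤B (j ∷ reverse (x ++ w') ++ o ∷ u) × ℓ (j ∷ reverse (x ++ w') ++ o ∷ u) ≡ ℓ (o ∷ u) + + suc
                  (length (x ++ w'))
      climb {y} {_} {j} x x∈D (start d e) θ≗ le len rewrite List.++-identityʳ x =
        ≤B-trans le (≤B-step (step-left j (reverse x ++ o ∷ u) p)) , trans (ℓ-ascent j (reverse x ++ o ∷ u) p)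
            (trans (cong (_+ 1ℤ) len) (trans (ℤ.+-assoc (ℓ (o ∷ u)) (+ length x) 1ℤ)
          (cong (_+_ (ℓ (o ∷ u))) (ℤ.+-comm (+ length x) 1ℤ))))
        where
        θ≗' : θ ≗ act x (unit j)
        θ≗' k = trans (θ≗ k) (act-cong x e k)
        p = ascends-at x j x∈D (Root-act x (Root-unit j)) d
            (subst (0ℤ <_) (sym (trans (form-cong {y = θ} (λ k → sym (θ≗' k)) (λ _ → refl)) θ-norm)) (+<+ (s≤s z≤n)))
      climb {y} {a ∷ w'} {j} x x∈D (add {y' = y'} a d py e π) θ≗ le len =
        subst (λ x' → (o ∷ u) ≤B (j ∷ reverse x' ++ o ∷ u) × ℓ (j ∷ reverse x' ++ o ∷ u) ≡ ℓ (o ∷ u) + + suc (length x'))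
            (List.++-assoc x (a ∷ []) w')
          (climb (x ▷ a) (All.++⁺ x∈D (d ∷ [])) π (λ k → trans (θ≗ k) (trans (act-cong x e k) (sym (act-▷ x a y' k))))
            (subst (λ r → (o ∷ u) ≤B (r ++ o ∷ u)) (sym reverse-x')
                (≤B-trans le (≤B-step (step-left a (reverse x ++ o ∷ u) p))))
            (trans (cong (λ r → ℓ (r ++ o ∷ u)) reverse-x')
                (trans (ℓ-ascent a (reverse x ++ o ∷ u) p) (trans (cong (_+ 1ℤ) len)
                (trans (ℤ.+-assoc (ℓ (o ∷ u)) (+ length x) 1ℤ)
              (cong (λ l → ℓ (o ∷ u) + + l) (sym (List.length-++ x))))))))
        where
        reverse-x' : reverse (x ▷ a) ≡ a ∷ reverse x
        reverse-x' = List.reverse-++ x (a ∷ [])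
        p = ascends-at x a x∈D (Root-act x (Root-unit a)) d (subst (0ℤ <_)
          (sym (trans (form-cong {act x (unit a)} {act x (unit a)} (λ _ → refl) θ≗)
              (trans (act-form x (unit a) y) (trans (form-unitˡ a y) py)))) (+<+ (s≤s z≤n)))

      u-ascends : Pos (iact u (unit o))
      u-ascends = Pos-by-coordinate o (Root-iact u (Root-unit o))
          (subst (0ℤ <_) (sym (trans (iact-u-o (unit o)) (unit-same o))) (+<+ (s≤s z≤n)))

      climbed = climb [] [] π (λ _ → refl) (≤B-reflexive ~refl) (sym (ℤ.+-identityʳ (ℓ (o ∷ u))))

      ℓ-v : ℓ v ≡ ℓ u + + (2 ℕ.+ length w)
      ℓ-v = trans (proj₂ climbed) (trans (cong (_+ + suc (length w)) (ℓ-ascent o u u-ascends))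
          (ℤ.+-assoc (ℓ u) 1ℤ (+ suc (length w))))

      u<v : u <B v
      u<v = ≤B-cons (step-left o u u-ascends) (proj₁ climbed) , λ e →
        ℤ.<-irrefl (trans (ℤ.+-identityʳ (ℓ u)) (trans (ℓ-respects-~ e) ℓ-v))
            (ℤ.+-monoʳ-< (ℓ u) {x = 0ℤ} {y = + (2 ℕ.+ length w)} (+<+ (s≤s z≤n)))

      ℓ-++-≤ : ∀ x y → ℓ (x ++ y) ≤ + length x + ℓ y
      ℓ-++-≤ [] y = ℤ.≤-reflexive (sym (ℤ.+-identityˡ (ℓ y)))
      ℓ-++-≤ (s ∷ x) y = ℤ.≤-trans (ℤ.+-mono-≤ (ℓ-++-≤ x y) (sgn-≤1 (ht (iact (x ++ y) (unit s)))))
          (ℤ.≤-reflexive (rearrange (+ length x) (ℓ y)))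
        where
        rearrange : ∀ a b → a + b + 1ℤ ≡ 1ℤ + a + b
        rearrange = solve-∀

      θ≗ : θ ≗ act w (unit i)
      θ≗ = Path-act π

      module Contradiction {t β} (τ : ReflectionIn β t) (β-pos : Pos β)
        (u⊲ut : ℓ (u ++ t) ≡ ℓ u + 1ℤ) (vt⊲v : ℓ v ≡ ℓ (v ++ t) + 1ℤ) where

        γ : Vector n
        γ = act u β

        γ-root : Root γ
        γ-root = Root-act u (isRoot τ)

        γ-pos : Pos γ
        γ-pos = up⇒Pos u τ β-pos (subst (ℓ u <_) (sym u⊲ut) (ℤ.suc[i]≤j⇒i<j (ℤ.≤-reflexive (ℤ.+-comm 1ℤ (ℓ u)))))

        vβ-neg : Neg (reflect i (iact w (reflect o γ)))
        vβ-neg = Neg-resp same (down⇒Neg v τ β-pos (subst (ℓ (v ++ t) <_) (sym vt⊲v)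
            (ℤ.suc[i]≤j⇒i<j (ℤ.≤-reflexive (ℤ.+-comm 1ℤ (ℓ (v ++ t)))))))
          where
          same : act v β ≗ reflect i (iact w (reflect o γ))
          same = reflect-cong i λ j → trans (cong (λ f → f j) (act-++ (reverse w) (o ∷ u) β))
            (cong (λ f → f j) (sym (iact-reverse w (reflect o γ))))

        r : Word
        r = u ++ t ++ reverse u

        ρ : ReflectionIn γ r
        ρ = reflection-conj u τ

        ut~ru : (u ++ t) ~ (r ++ u)
        ut~ru = ~sym (~trans (~reflexive (trans (List.++-assoc u _ u) (cong (u ++_) (List.++-assoc t (reverse u) u))))
          (++-congˡ u (~trans (++-congˡ t (inverseˡ u)) (~reflexive (List.++-identityʳ t)))))

        ℓ-ru : ℓ (r ++ u) ≡ ℓ u + 1ℤ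
        ℓ-ru = trans (ℓ-respects-~ (~sym ut~ru)) u⊲ut

        U-o : ∀ {a} → Root a → 0ℤ < a o → Pos (iact u a)
        U-o {a} h 0<a = Pos-by-coordinate o (Root-iact u h) (subst (0ℤ <_) (sym (iact-u-o a)) 0<a)

        -- γ = α_o: then v t = s_i z⁻¹ is too short, because z sends α_i to a negative root.
        case-simple : ¬ γ ≗ unit o
        case-simple e = ℤ.<⇒≱ (ℤ.+-monoʳ-< (ℓ u) {x = + length w} {y = + suc (length w)} (+<+ ℕ.≤-refl)) (begin
            ℓ u + + suc (length w)            ≡⟨ shift (ℓ u) (+ length w) ⟩
            ℓ u + + (2 ℕ.+ length w) - 1ℤ     ≡⟨ cong (_- 1ℤ) ℓ-v ⟨
            ℓ v - 1ℤ                          ≡⟨ cong (_- 1ℤ) vt⊲v ⟩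
            ℓ (v ++ t) + 1ℤ - 1ℤ              ≡⟨ unshift (ℓ (v ++ t)) ⟩
            ℓ (v ++ t)                        ≡⟨ ℓ-respects-~ vt~ ⟩
            ℓ (i ∷ reverse z)                 ≡⟨ ℓ-descent i (reverse z)
                (subst Neg (sym (iact-reverse′ z (unit i))) (proj₂ z-longest i (Path-end π))) ⟩
            ℓ (reverse z) - 1ℤ                ≤⟨ ℤ.i-j≤i (ℓ (reverse z)) 1ℤ ⟩
            ℓ (reverse z)                     ≡⟨ ℓ-respects-~ (\\-leftDividesʳ w (reverse z)) ⟨
            ℓ (reverse w ++ u)                ≤⟨ ℓ-++-≤ (reverse w) u ⟩
            + length (reverse w) + ℓ u        ≡⟨ cong (λ l → + l + ℓ u) (List.length-reverse w) ⟩
            + length w + ℓ u                  ≡⟨ ℤ.+-comm (+ length w) (ℓ u) ⟩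
            ℓ u + + length w                  ∎)
          where
          open ℤ.≤-Reasoning
          shift : ∀ a b → a + (1ℤ + b) ≡ a + (+ 2 + b) - 1ℤ
          shift = solve-∀
          unshift : ∀ a → a + 1ℤ - 1ℤ ≡ a
          unshift = solve-∀
          vt~ : (v ++ t) ~ (i ∷ reverse z)
          vt~ = ++-congˡ (i ∷ []) (~trans (~reflexive (List.++-assoc (reverse w) (o ∷ u) t))
            (~trans (++-congˡ (reverse w) (~trans (++-congˡ (o ∷ [])
                (~trans ut~ru (++-congʳ u (same-reflection e ρ (reflection-simple o))))) (square o u)))
              (\\-leftDividesʳ w (reverse z))))

        module _ (η-pos : Pos (reflect o γ)) where
          η : Vector n
          η = reflect o γ

          η-root : Root η
          η-root = Root-reflect o γ-root

          γ≗ : γ ≗ reflect o η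
          γ≗ j = sym (reflect-involutive o γ j)

          -- γ = η + α_o with η in the inversion set of w⁻¹.
          case-inversion : ¬ Neg (iact w η)
          case-inversion neg-wη = no-cover u η-root (Root-unit o) η-pos (unit-Pos o) (trans (form-unitʳ η o) η-o) γ-sum
              Uη (U-o (Root-unit o) (subst (0ℤ <_) (sym (unit-same o)) (+<+ (s≤s z≤n)))) ρ ℓ-ru
            where
            -- w⁻¹ leaves the coordinates off D alone, and these are ≥ 0 before and ≤ 0 after.
            η-supported : Supported D η
            η-supported k e = ℤ.≤-antisym (subst (_≤ 0ℤ) (iact-other (Path-letters π) η e) (neg-wη k)) (η-pos k)
            η-o : pair η o ≡ -1ℤ
            η-o = trans (orthogonal η-supported) (cong -_ (Path-inversion π η-root η-pos neg-wη))
            γ-sum : γ ≗ axpy η 1ℤ (unit o)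
            γ-sum j = trans (γ≗ j) (cong (λ c → η j + - c * unit o j) η-o)
            -- -w⁻¹η is a positive root of W_D, so z makes it negative; therefore u⁻¹η = z w⁻¹η is
            -- positive.
            κ : Vector n
            κ = neg (iact w η)
            κ-root = Root-neg (Root-iact w η-root)
            κ-path = path ℤ.∣ ht κ ∣ {κ} (Neg⇒Pos (λ _ → refl) neg-wη)
              (λ k e → cong -_ (trans (iact-other (Path-letters π) η e) (η-supported k e))) (Root-norm κ-root)
                  (i≤+∣i∣ (ht κ))
            Uη : Pos (iact u η)
            Uη = Neg⇒Pos (λ j → trans (iact-u η j) (trans (sym (ℤ.neg-involutive _))
                (cong -_ (sym (act-neg z (iact w η) j)))))
              (Longest-Neg z-longest (proj₂ (proj₂ κ-path)))

          -- γ = θ + 2 α_o = (α_j + α_o) + (θ - α_j + α_o), where j is the first letter of w.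
          case-top : ¬ iact w η ≗ unit i
          case-top e = go π refl
            where
            η≗θ : η ≗ θ
            η≗θ k = trans (sym (act-iact w η k)) (trans (act-cong w e k) (sym (θ≗ k)))
            γ≗θ+2o : γ ≗ axpy θ (+ 2) (unit o)
            γ≗θ+2o k = trans (γ≗ k) (trans (reflect-cong o η≗θ k) (cong (λ c → θ k + - c * unit o k) θ-o))
            go : ∀ {w' i'} → Path θ w' i' → w' ≡ w → ⊥
            -- If θ were simple, ⟨θ , α_o⟩ = -2 would be an off-diagonal entry of the form.
            go {i' = i'} (start d h) _ = contradiction (trans (sym θ-o)
                (trans (pair-cong h o) (trans (pair-unit i' o) refl))) (bond-bound (bond o i'))
              where
              bond-bound : Bond o i' → - (+ 2) ≢ B o i'
              bond-bound (equal refl) = contradiction (trans (sym d) o∉D) λ ()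
              bond-bound (commute _ e) h = contradiction (trans h (cong entry e)) λ ()
              bond-bound (braid _ e) h = contradiction (trans h (cong entry e)) λ ()
            go (add j d θ-j _ _) _ = no-cover u a-root b-root a-pos b-pos ab γ≗a+b
                (U-o a-root (subst (0ℤ <_) (sym a-o) (+<+ (s≤s z≤n))))
                    (U-o b-root (subst (0ℤ <_) (sym b-o) (+<+ (s≤s z≤n)))) ρ ℓ-ru
              where
              j-o : pair (unit j) o ≡ -1ℤ
              j-o = trans (orthogonal (unit-supported {D} d)) (cong -_ (trans (form-unitˡ j θ) θ-j))
              a b : Vector n
              a = axpy (unit j) 1ℤ (unit o)
              b = axpy γ -1ℤ a
              a-root : Root a
              a-root = Root-resp (λ k → cong (λ c → unit j k + - c * unit o k) j-o) (Root-reflect o (Root-unit j))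
              γa : form γ a ≡ 1ℤ
              γa = trans (form-cong {y = a} γ≗θ+2o (λ _ → refl)) (trans (form-axpyˡ θ (+ 2) (unit o) a)
                (trans (cong₂ (λ p q → p + + 2 * q)
                  (trans (form-axpyʳ θ (unit j) 1ℤ (unit o)) (cong₂ (λ p q → p + 1ℤ * q) (trans (form-unitʳ θ j) θ-j)
                      (trans (form-unitʳ θ o) θ-o)))
                  (trans (form-axpyʳ (unit o) (unit j) 1ℤ (unit o))
                      (cong₂ (λ p q → p + 1ℤ * q) (trans (form-unitˡ o (unit j)) j-o) (form-unit o)))) refl))
              b-root : Root b
              b-root = Root-resp (λ k → trans (reflection-act (proj₂ (Root⇒reflection a-root)) γ k)
                  (cong (λ c → γ k + - c * a k) γa)) (Root-act (proj₁ (Root⇒reflection a-root)) γ-root)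
              a-o : a o ≡ 1ℤ
              a-o = cong₂ (λ p q → p + 1ℤ * q) (unit-supported {D} d o o∉D) (unit-same o)
              b-o : b o ≡ 1ℤ
              b-o = cong₂ (λ p q → p + -1ℤ * q) (trans (γ≗θ+2o o)
                  (cong₂ (λ p q → p + + 2 * q) (θ-supported o o∉D) (unit-same o))) a-o
              a-pos : Pos a
              a-pos = Pos-by-coordinate o a-root (subst (0ℤ <_) (sym a-o) (+<+ (s≤s z≤n)))
              b-pos : Pos b
              b-pos = Pos-by-coordinate o b-root (subst (0ℤ <_) (sym b-o) (+<+ (s≤s z≤n)))
              ab : form a b ≡ -1ℤ
              ab = trans (form-axpyʳ a γ -1ℤ a) (cong₂ (λ p q → p + -1ℤ * q) (trans (form-sym a γ) γa) (Root-norm a-root))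
              γ≗a+b : γ ≗ axpy a 1ℤ b
              γ≗a+b k = split (γ k) (a k)
                where
                split : ∀ g a → g ≡ a + 1ℤ * (g + -1ℤ * a)
                split = solve-∀

          case-reflected : ⊥
          case-reflected = [ (λ wη-pos → [ case-top , (λ q → Pos-Neg (Root-reflect i wη-root) q vβ-neg) ]′
              (reflect-Pos i wη-root wη-pos)) , case-inversion ]′
            (Root-sign wη-root)
            where
            wη-root : Root (iact w η)
            wη-root = Root-iact w η-root

        contradictory : ⊥
        contradictory = [ case-simple , case-reflected ]′ (reflect-Pos o γ-root γ-pos)

      ¬GLP : ¬ GLP u v
      ¬GLP (t , t-refl , _ , _ , (_ , a , ha , hat) , _ , _ , (_ , b , hb , hbv)) =
        Contradiction.contradictory (proj₁ (proj₂ (positive-root t-refl))) (proj₂ (proj₂ (positive-root t-refl)))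
          (trans (HasLength⇒ℓ hat) (cong (_+ 1ℤ) (sym (HasLength⇒ℓ ha))))
          (trans (HasLength⇒ℓ hbv) (cong (_+ 1ℤ) (sym (HasLength⇒ℓ hb))))

    bad-interval : ¬ AllIntervalsGLP
    bad-interval glp = Interval.¬GLP (proj₂ longest) (proj₂ (proj₂ θ-path))
        (glp _ _ (Interval.u<v (proj₂ longest) (proj₂ (proj₂ θ-path))))

-- The special node of a degenerate diagram

⊓-cases : ∀ a b → (a ℤ.⊓ b ≡ a × a ≤ b) ⊎ (a ℤ.⊓ b ≡ b × b ≤ a)
⊓-cases a b = [ (λ h → inj₁ (ℤ.i≤j⇒i⊓j≡i h , h)) , (λ h → inj₂ (ℤ.i≥j⇒i⊓j≡j h , h)) ]′ (ℤ.≤-total a b)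

-- The minimum is one of the two numbers. Applied to y and δ, this kills the diagonal terms of B(δ -
-- μ, y - μ) and leaves only terms ≤ 0.
⊓-disjoint : ∀ a b → (b - a ℤ.⊓ b) * (a - a ℤ.⊓ b) ≡ 0ℤ
⊓-disjoint a b = [ (λ (e , _) → trans (cong (λ m → (b - m) * (a - m)) e) (left a b)) ,
    (λ (e , _) → trans (cong (λ m → (b - m) * (a - m)) e) (right a b)) ]′ (⊓-cases a b)
  where
  left : ∀ a b → (b - a) * (a - a) ≡ 0ℤ
  left = solve-∀
  right : ∀ a b → (b - b) * (a - b) ≡ 0ℤ
  right = solve-∀

module Degenerate {n : ℕ} (M : CoxeterMatrix n) (simply-laced : Coxeter.SimplyLaced M) where
  open Cartan M simply-laced

  module _ (δ : Vector n) (δ-pos : Pos δ) (δ≢0 : ¬ δ ≗ 0ᵛ) (degenerate : form δ δ ≤ 0ℤ)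
    (smaller : ∀ {y} → Pos y → ¬ y ≗ 0ᵛ → ht y < ht δ → 0ℤ < form y y) where
    open MinimalDegenerate δ δ-pos δ≢0 degenerate smaller

    -- By submodularity: with μ = min(y, δ), form y y ≥ form μ μ + form (y - μ) (y - μ).
    positive-below : ∀ k → 0ℤ < δ k → ∀ h {y} → Pos y → Supported S y → y k ≡ 0ℤ → ¬ y ≗ 0ᵛ → ht y ≤ + h → 0ℤ < form y y
    positive-below k 0<δk zero p _ _ y≢0 y≤0 = contradiction (ℤ.<-≤-trans (Pos-ht p y≢0) y≤0) (ℤ.<-irrefl refl)
    positive-below k 0<δk (suc h) {y} p sup yk≡0 y≢0 y≤h = subst (0ℤ <_) (sym norm) (combine-a (Fin.all? λ i → a i ℤ.≟ 0ℤ))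
      where
      μ a b : Vector n
      μ i = y i ℤ.⊓ δ i
      a i = y i - μ i
      b i = δ i - μ i
      μ-pos : Pos μ
      μ-pos i = ℤ.⊓-glb (p i) (δ-pos i)
      a-pos : Pos a
      a-pos i = sub-nonneg (ℤ.i⊓j≤i (y i) (δ i))
      b-pos : Pos b
      b-pos i = sub-nonneg (ℤ.i⊓j≤j (y i) (δ i))
      mk≡0 : μ k ≡ 0ℤ
      mk≡0 = trans (cong (ℤ._⊓ δ k) yk≡0) (ℤ.i≤j⇒i⊓j≡i (δ-pos k))
      a-supported : Supported S a
      a-supported i e = trans (cong₂ (λ u v → u - u ℤ.⊓ v) (sup i e) (S-false e)) refl
      y≗ : y ≗ axpy μ 1ℤ a
      y≗ i = split (y i) (μ i)
        where
        split : ∀ y μ → y ≡ μ + 1ℤ * (y - μ)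
        split = solve-∀
      μ≗ : μ ≗ axpy δ -1ℤ b
      μ≗ i = split (δ i) (μ i)
        where
        split : ∀ d μ → μ ≡ d + -1ℤ * (d - μ)
        split = solve-∀
      μ≢0 : ¬ μ ≗ 0ᵛ
      μ≢0 h = [ (λ 0<δi → ℤ.<-irrefl (sym (h i)) (ℤ.<-≤-trans {0ℤ} {1ℤ} (+<+ (s≤s z≤n))
          (ℤ.⊓-glb (0<⇒1≤ 0<yi) (0<⇒1≤ 0<δi)))) ,
                (λ yi≡0 → ℤ.<-irrefl (sym yi≡0) 0<yi) ]′ (supported-case {y} sup i)
        where
        i : Fin n
        i = proj₁ (find-positive p y≢0)
        0<yi : 0ℤ < y i
        0<yi = proj₂ (find-positive p y≢0)
      ht-μ : ht μ ≡ ht δ - ht b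
      ht-μ = trans (sum-cong-≗ μ≗) (trans (sum-axpy δ b -1ℤ) (cong (_+_ (ht δ)) (ℤ.-1*i≡-i (ht b))))
      μ<δ : ht μ < ht δ
      μ<δ = subst₂ _<_ (sym ht-μ) (ℤ.+-identityʳ (ht δ))
          (ℤ.+-monoʳ-< (ht δ) (ℤ.neg-mono-< (ℤ.<-≤-trans (subst (0ℤ <_) bk 0<δk) (≤-sum b b-pos k))))
        where
        bk : δ k ≡ b k
        bk = sym (trans (cong (_-_ (δ k)) mk≡0) (ℤ.+-identityʳ (δ k)))
      0<mm : 0ℤ < form μ μ
      0<mm = smaller μ-pos μ≢0 μ<δ
      ba≤0 : 0ℤ ≤ - form b a
      ba≤0 = ℤ.neg-mono-≤ (subst (_≤ 0ℤ) (sym (form-double b a)) (subst (sum (λ i → sum (λ j → b i * (B i j * a j))) ≤_)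
          (sum-zero {n} λ i → sum-zero {n} λ j → refl) (sum-mono λ i → sum-mono λ j → term i j (i Fin.≟ j))))
        where
        pull : ∀ b c a → b * (c * a) ≡ c * (b * a)
        pull = solve-∀
        term : ∀ i j → Dec (i ≡ j) → b i * (B i j * a j) ≤ 0ℤ
        term i j (yes refl) = ℤ.≤-reflexive (trans (pull (b i) (B i i) (a i))
            (trans (cong (_*_ (B i i)) (⊓-disjoint (y i) (δ i))) (ℤ.*-zeroʳ (B i i))))
        term i j (no i≢j) = ℤ.0≤i-j⇒j≤i (subst (0ℤ ≤_) (rearrange (b i) (B i j) (a j))
            (nonneg-* { - B i j} {b i * a j} (ℤ.neg-mono-≤ (proj₂ (B-off i≢j))) (nonneg-* {b i} {a j} (b-pos i) (a-pos j))))
          where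
          rearrange : ∀ b c a → - c * (b * a) ≡ 0ℤ - b * (c * a)
          rearrange = solve-∀
      -- μ = δ - b, and δ is orthogonal to every vector on its support.
      ma : form μ a ≡ - form b a
      ma = trans (form-cong {y = a} μ≗ (λ _ → refl))
          (trans (form-axpyˡ δ -1ℤ b a) (trans (cong (_+ -1ℤ * form b a) (trans (form-sym δ a) (radical {a} a-supported)))
        (trans (ℤ.+-identityˡ _) (ℤ.-1*i≡-i (form b a)))))
      norm : form y y ≡ form μ μ + (- form b a + - form b a) + form a a
      norm = trans (form-cong y≗ y≗) (trans (form-axpy² μ 1ℤ a)
          (trans (cong (λ c → form μ μ + 1ℤ * (c + c) + 1ℤ * 1ℤ * form a a) ma)
          (simplify (form μ μ) (- form b a) (form a a))))
        where
        simplify : ∀ μ c a → μ + 1ℤ * (c + c) + 1ℤ * 1ℤ * a ≡ μ + (c + c) + a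
        simplify = solve-∀
      0<μ+ : 0ℤ < form μ μ + (- form b a + - form b a)
      0<μ+ = ℤ.+-mono-<-≤ 0<mm (ℤ.+-mono-≤ ba≤0 ba≤0)
      combine-a : Dec (a ≗ 0ᵛ) → 0ℤ < form μ μ + (- form b a + - form b a) + form a a
      combine-a (yes a≗0) = subst (0ℤ <_) (trans (sym (ℤ.+-identityʳ _))
          (cong (_+_ (form μ μ + (- form b a + - form b a))) (sym (zero-norm {a} a≗0)))) 0<μ+
      combine-a (no a≢0) = ℤ.+-mono-<-≤ 0<μ+ (ℤ.<⇒≤ (positive-below k 0<δk h {a} a-pos a-supported
          (trans (cong₂ _-_ yk≡0 mk≡0) refl) a≢0 a≤h))
        where
        ht-a : ht a ≡ ht y - ht μ
        ht-a = sum-- y μ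
        a≤h : ht a ≤ + h
        a≤h = subst (_≤ + h) (sym ht-a) (ℤ.+-mono-≤ y≤h (ℤ.neg-mono-≤ (0<⇒1≤ (Pos-ht μ-pos μ≢0))))

    positive-at : ∀ k → 0ℤ < δ k → ∀ {x} → Supported S x → x k ≡ 0ℤ → ¬ x ≗ 0ᵛ → 0ℤ < form x x
    positive-at k 0<δk {x} sup xk≡0 x≢0 = ℤ.<-≤-trans (positive-below k 0<δk ℤ.∣ ht ∣ x ∣ᵛ ∣ {∣ x ∣ᵛ} (λ _ → +≤+ z≤n)
      (λ i e → cong (λ z → + ℤ.∣ z ∣) (sup i e)) (cong (λ z → + ℤ.∣ z ∣) xk≡0) (abs-≢0 x≢0) (i≤+∣i∣ (ht ∣ x ∣ᵛ)))
          (form-abs x)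

    some-node : ∃[ k ] 0ℤ < δ k
    some-node = find-positive δ-pos δ≢0

    combination-norm : ∀ d c {x} → Supported S x → form (axpy (λ i → d * x i) c δ)
        (axpy (λ i → d * x i) c δ) ≡ d * d * form x x
    combination-norm d c {x} sup = trans (form-axpy² (λ i → d * x i) c δ)
        (trans (cong₂ (λ p q → form (λ i → d * x i) (λ i → d * x i) + c * (p + p) + c * c * q)
        (radical {λ i → d * x i} (λ i e → trans (cong (_*_ d) (sup i e)) (ℤ.*-zeroʳ d))) isotropic)
      (trans (cong (λ f → f + c * (0ℤ + 0ℤ) + c * c * 0ℤ) (quad-scale B d x)) (simplify (d * d * form x x) c)))
      where
      simplify : ∀ f c → f + c * (0ℤ + 0ℤ) + c * c * 0ℤ ≡ f
      simplify = solve-∀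

    dot-combination : ∀ p d c x → dot p (axpy (λ i → d * x i) c δ) ≡ d * dot p x + c * dot p δ
    dot-combination p d c x = trans (sum-cong-≗ λ i → distribute (p i) d (x i) c (δ i))
        (trans (sum-axpy (λ i → d * (p i * x i)) (λ i → p i * δ i) c)
      (cong (_+ c * dot p δ) (sym (*-distribˡ-sum d λ i → p i * x i))))
      where
      distribute : ∀ p d x c y → p * (d * x + c * y) ≡ d * (p * x) + c * (p * y)
      distribute = solve-∀

    -- Subtracting a multiple of δ moves any x into the hyperplane x_k = 0, where the form is definite.
    projection : ∀ {x} → Supported S x → (0ℤ < form x x) ⊎
        (form x x ≡ 0ℤ × ∃[ d ] ∃[ c ] (0ℤ < d × (∀ i → d * x i ≡ c * δ i)))
    projection {x} sup = go (Fin.all? λ i → y i ℤ.≟ 0ℤ)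
      where
      k : Fin n
      k = proj₁ some-node
      0<δk : 0ℤ < δ k
      0<δk = proj₂ some-node
      d c : ℤ
      d = δ k
      c = x k
      y = axpy (λ i → d * x i) (- c) δ
      norm : form y y ≡ d * d * form x x
      norm = combination-norm d (- c) sup
      0<dd : 0ℤ < d * d
      0<dd = positive-* {d} {d} 0<δk 0<δk
      go : Dec (y ≗ 0ᵛ) → (0ℤ < form x x) ⊎ (form x x ≡ 0ℤ × ∃[ d ] ∃[ c ] (0ℤ < d × (∀ i → d * x i ≡ c * δ i)))
      go (no y≢0) = inj₁ (cancel-strict {d * d} 0<dd (subst (0ℤ <_) norm (positive-at k 0<δk {y}
          (λ i e → trans (cong₂ (λ p q → d * p + - c * q) (sup i e) (S-false e)) (zeros d c)) (cancel d c) y≢0)))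
        where
        zeros : ∀ d c → d * 0ℤ + - c * 0ℤ ≡ 0ℤ
        zeros = solve-∀
        cancel : ∀ d c → d * c + - c * d ≡ 0ℤ
        cancel = solve-∀
      go (yes y≗0) = inj₂ ([ (λ dd≡0 → contradiction (subst (0ℤ <_) dd≡0 0<dd) (ℤ.<-irrefl refl)) , id ]′
          (ℤ.i*j≡0⇒i≡0∨j≡0 (d * d) (trans (sym norm) (zero-norm {y} y≗0)))
        , d , c , 0<δk , λ i → trans (split (d * x i) c (δ i)) (trans (cong (_+ c * δ i) (y≗0 i)) (ℤ.+-identityˡ (c * δ i))))
        where
        split : ∀ a c e → a ≡ a + - c * e + c * e
        split = solve-∀

    semidefinite : ∀ {x} → Supported S x → 0ℤ ≤ form x x
    semidefinite sup = [ ℤ.<⇒≤ , (λ (e , _) → ℤ.≤-reflexive (sym e)) ]′ (projection sup)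

    -- Chip firing: while the functional p + ⟨x , _⟩ is negative at a node i of the support of δ, add α_i to x.
    -- The energy does not increase, and together with x ≥ 0 this bounds x.
    module ChipFiring (p : Vector n) (p-supported : Supported S p) (0<g : 0ℤ < dot p δ) where
      g : ℤ
      g = dot p δ

      -- On the support of δ the form vanishes only at rational multiples of δ, and there p detects
      -- them because g > 0.
      definite-with-p : ∀ {x} → Supported S x → ¬ x ≗ 0ᵛ → 0ℤ < form x x + dot p x * dot p x
      definite-with-p {x} sup x≢0 = [ (λ 0<f → ℤ.+-mono-<-≤ 0<f (square-nonneg (dot p x))) , parallel ]′ (projection sup)
        where
        parallel : form x x ≡ 0ℤ × ∃[ d ] ∃[ c ] (0ℤ < d × (∀ i → d * x i ≡ c * δ i)) → 0ℤ < form x x + dot p x * dot p x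
        parallel (f≡0 , d , c , 0<d , h) = ℤ.≰⇒> λ q≤0 → contradiction (dot≡0 q≤0) dot≢0
          where
          dot≡0 : form x x + dot p x * dot p x ≤ 0ℤ → dot p x ≡ 0ℤ
          dot≡0 q≤0 = square-zero (dot p x) (subst (_≤ 0ℤ) (trans (cong (_+ dot p x * dot p x) f≡0) (ℤ.+-identityˡ _)) q≤0)
          proportional : d * dot p x ≡ c * g
          proportional = trans (*-distribˡ-sum d (λ i → p i * x i))
              (trans (sum-cong-≗ λ i → trans (pull d (p i) (x i))
              (trans (cong (_*_ (p i)) (h i)) (sym (pull c (p i) (δ i)))))
            (sym (*-distribˡ-sum c λ i → p i * δ i)))
            where
            pull : ∀ d p x → d * (p * x) ≡ p * (d * x)
            pull = solve-∀
          positive≢0 : ∀ {a} → 0ℤ < a → a ≢ 0ℤ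
          positive≢0 0<a refl = ℤ.<-irrefl refl 0<a
          cancel : ∀ {a b} → 0ℤ < a → a * b ≡ 0ℤ → b ≡ 0ℤ
          cancel {a} 0<a e = [ (λ a≡0 → contradiction a≡0 (positive≢0 0<a)) , id ]′ (ℤ.i*j≡0⇒i≡0∨j≡0 a e)
          dot≢0 : dot p x ≢ 0ℤ
          dot≢0 e = x≢0 λ i → cancel 0<d (trans (h i) (trans (cong (_* δ i) c≡0) (ℤ.*-zeroˡ (δ i))))
            where
            c≡0 : c ≡ 0ℤ
            c≡0 = cancel 0<g (trans (ℤ.*-comm g c) (trans (sym proportional) (trans (cong (_*_ d) e) (ℤ.*-zeroʳ d))))

      module Firing (C : ℤ) (C≥0 : 0ℤ ≤ C)
        (coordinate-bound : ∀ {x} → Supported S x → ∀ i → x i * x i ≤ C * (form x x + dot p x * dot p x)) where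

        energy : Vector n → ℤ
        energy x = form x x + + 2 * dot p x

        record State (x : Vector n) : Set where
          field
            pos : Pos x
            supported : Supported S x
            energy≤0 : energy x ≤ 0ℤ

        R H : ℤ
        R = C * (+ 2 * (+ 2 * C * (g * g)) + (+ 2 * C * (g * g)) * (+ 2 * C * (g * g)))
        H = sum {n} (λ _ → R)

        -- Put μ = -p(x). Energy ≤ 0 means B(x, x) ≤ 2μ. The vector y = g x + μδ is killed by p and
        -- has norm g² B(x, x), so μ² ≤ y_k² ≤ 2Cg² μ and μ ≤ M₀ = 2Cg². Then x_i ≤ x_i² ≤ C (2μ +
        -- μ²) ≤ C (2M₀ + M₀²) = `R`.
        height-bounded : ∀ {x} → State x → ht x ≤ H
        height-bounded {x} st = sum-mono bounded
          where
          open State st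
          μ M₀ : ℤ
          μ = - dot p x
          M₀ = + 2 * C * (g * g)
          M₀≥0 : 0ℤ ≤ M₀
          M₀≥0 = nonneg-* {+ 2 * C} {g * g} (nonneg-* {+ 2} {C} (+≤+ z≤n) C≥0) (square-nonneg g)
          form≤2m : form x x ≤ + 2 * μ
          form≤2m = ℤ.0≤i-j⇒j≤i (subst (0ℤ ≤_) (rearrange (form x x) (dot p x)) (ℤ.neg-mono-≤ energy≤0))
            where
            rearrange : ∀ f d → - (f + + 2 * d) ≡ + 2 * - d - f
            rearrange = solve-∀
          μ≥0 : 0ℤ ≤ μ
          μ≥0 = cancel-positive {+ 2} (+<+ (s≤s z≤n)) (ℤ.≤-trans (semidefinite supported) form≤2m)
          k : Fin n
          k = proj₁ some-node
          y : Vector n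
          y = axpy (λ i → g * x i) μ δ
          y-supported : Supported S y
          y-supported i e = trans (cong₂ (λ a b → g * a + μ * b) (supported i e) (S-false e)) (zeros g μ)
            where
            zeros : ∀ d c → d * 0ℤ + c * 0ℤ ≡ 0ℤ
            zeros = solve-∀
          y-form : form y y + dot p y * dot p y ≡ g * g * form x x
          y-form = trans (cong₂ (λ f d → f + d * d) (combination-norm g μ supported)
              (trans (dot-combination p g μ x) (cancel g (dot p x))))
            (ℤ.+-identityʳ (g * g * form x x))
            where
            cancel : ∀ g d → g * d + - d * g ≡ 0ℤ
            cancel = solve-∀
          μ≤y : μ ≤ y k
          μ≤y = ≤-from (rearrange (g * x k) μ (δ k)) (ℤ.+-mono-≤ (nonneg-* {g} {x k} (ℤ.<⇒≤ 0<g) (pos k))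
              (nonneg-* {μ} {δ k - 1ℤ} μ≥0 (sub-nonneg (0<⇒1≤ (proj₂ some-node)))))
            where
            rearrange : ∀ a μ d → a + μ * d - μ ≡ a + μ * (d - 1ℤ)
            rearrange = solve-∀
          mm≤ : 0ℤ ≤ μ * (M₀ - μ)
          mm≤ = subst (0ℤ ≤_) (collect C (g * g) (form x x) μ (y k))
            (ℤ.+-mono-≤ (ℤ.+-mono-≤ (sub-nonneg (subst (λ q → y k * y k ≤ C * q) y-form (coordinate-bound y-supported k)))
              (nonneg-* {C * (g * g)} {+ 2 * μ - form x x} (nonneg-* {C} {g * g} C≥0 (square-nonneg g))
                  (sub-nonneg form≤2m)))
              (nonneg-* {y k - μ} {y k + μ} (sub-nonneg μ≤y) (ℤ.+-mono-≤ (ℤ.≤-trans μ≥0 μ≤y) μ≥0)))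
            where
            collect : ∀ C G f μ y → C * (G * f) - y * y + C * G * (+ 2 * μ - f) + (y - μ) * (y + μ) ≡ μ * (+ 2 * C * G - μ)
            collect = solve-∀
          μ≤M₀ : μ ≤ M₀
          μ≤M₀ = go (0ℤ ℤ.<? μ)
            where
            go : Dec (0ℤ < μ) → μ ≤ M₀
            go (yes 0<μ) = ℤ.0≤i-j⇒j≤i (cancel-positive 0<μ mm≤)
            go (no μ≯0) = ℤ.≤-trans (ℤ.≮⇒≥ μ≯0) M₀≥0
          bounded : ∀ i → x i ≤ R
          bounded i = ≤-from (collect C (form x x) (dot p x) M₀ (x i)) (ℤ.+-mono-≤ (ℤ.+-mono-≤ (ℤ.+-mono-≤ (ℤ.+-mono-≤
              (sub-nonneg (coordinate-bound supported i))
              (nonneg-* {C} {+ 2 * μ - form x x} C≥0 (sub-nonneg form≤2m)))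
              (nonneg-* {C} {+ 2 * (M₀ - μ)} C≥0 (nonneg-* {+ 2} {M₀ - μ} (+≤+ z≤n) (sub-nonneg μ≤M₀))))
              (nonneg-* {C} {(M₀ - μ) * (M₀ + μ)} C≥0 (nonneg-* {M₀ - μ} {M₀ + μ} (sub-nonneg μ≤M₀) (ℤ.+-mono-≤ M₀≥0 μ≥0))))
              (square-step (x i) (pos i)))
            where
            collect : ∀ C f d M x → C * (+ 2 * M + M * M) - x ≡
              C * (f + d * d) - x * x + C * (+ 2 * - d - f) + C * (+ 2 * (M - - d)) + C * ((M - - d) * (M + - d)) +
                  (x * x - x)
            collect = solve-∀
            square-step : ∀ x → 0ℤ ≤ x → 0ℤ ≤ x * x - x
            square-step (+ 0) _ = ℤ.≤-refl
            square-step (+ suc x) _ = subst (0ℤ ≤_) (factor (+ suc x))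
                (nonneg-* {+ suc x} {+ suc x - 1ℤ} (+≤+ z≤n) (+≤+ z≤n))
              where
              factor : ∀ x → x * (x - 1ℤ) ≡ x * x - x
              factor = solve-∀

        Stable : Vector n → Set
        Stable x = ∀ i → 0ℤ < δ i → 0ℤ ≤ p i + pair x i

        -- The energy changes by 2(p_i + ⟨x , α_i⟩ + 1), and a negative integer is at most -1.
        fire : ∀ {x} i → 0ℤ < δ i → p i + pair x i < 0ℤ → State x → State (axpy x 1ℤ (unit i))
        fire {x} i 0<δi neg-i st = record
          { pos = λ j → ℤ.+-mono-≤ (pos j) (subst (0ℤ ≤_) (sym (ℤ.*-identityˡ (unit i j))) (unit-Pos i j))
          ; supported = axpy-supported {S} {x} {unit i} 1ℤ supported (unit-supported {S} i∈S)
          ; energy≤0 = ℤ.≤-trans (≤-from gap (nonneg-* {+ 2} { - (1ℤ + (p i + pair x i))} (+≤+ z≤n)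
              (ℤ.neg-mono-≤ (ℤ.i<j⇒suc[i]≤j neg-i)))) energy≤0 }
          where
          open State st
          i∈S : S i ≡ true
          i∈S = go (S i) refl
            where
            go : ∀ b → S i ≡ b → b ≡ true
            go true _ = refl
            go false e = contradiction (subst (0ℤ <_) (S-false e) 0<δi) (ℤ.<-irrefl refl)
          dot-x' : dot p (axpy x 1ℤ (unit i)) ≡ dot p x + 1ℤ * p i
          dot-x' = trans (sum-cong-≗ λ j → distribute (p j) (x j) (unit i j))
              (trans (sum-axpy (λ j → p j * x j) (λ j → p j * unit i j) 1ℤ) (cong (λ q → dot p x + 1ℤ * q) (sum-unit p i)))
            where
            distribute : ∀ p x u → p * (x + 1ℤ * u) ≡ p * x + 1ℤ * (p * u)
            distribute = solve-∀
          energy-x' : energy (axpy x 1ℤ (unit i)) ≡ form x x + 1ℤ * (pair x i + pair x i) + 1ℤ * 1ℤ * + 2 + + 2 *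
              (dot p x + 1ℤ * p i)
          energy-x' = cong₂ (λ f d → f + + 2 * d) (trans (form-axpy² x 1ℤ (unit i))
              (cong₂ (λ c d → form x x + 1ℤ * (c + c) + 1ℤ * 1ℤ * d) (form-unitʳ x i) (form-unit i))) dot-x'
          gap : energy x - energy (axpy x 1ℤ (unit i)) ≡ + 2 * - (1ℤ + (p i + pair x i))
          gap = trans (cong (_-_ (energy x)) energy-x') (collect (form x x) (dot p x) (pair x i) (p i))
            where
            collect : ∀ f d c q → f + + 2 * d - (f + 1ℤ * (c + c) + 1ℤ * 1ℤ * + 2 + + 2 * (d + 1ℤ * q)) ≡ + 2 * -
                (1ℤ + (q + c))
            collect = solve-∀

        -- Each firing raises the height by one, and `H` bounds the height.
        stabilize : ∀ fuel {x} → State x → H < ht x + + fuel → ∃[ y ] (Supported S y × Stable y)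
        stabilize zero {x} st H< = contradiction (height-bounded st) (ℤ.<⇒≱ (subst (H <_) (ℤ.+-identityʳ (ht x)) H<))
        stabilize (suc fuel) {x} st H< = go (Fin.any? λ i → (0ℤ ℤ.<? δ i) ×-dec (p i + pair x i ℤ.<? 0ℤ))
          where
          go : Dec (∃[ i ] (0ℤ < δ i × p i + pair x i < 0ℤ)) → ∃[ y ] (Supported S y × Stable y)
          go (yes (i , 0<δi , neg-i)) = stabilize fuel (fire i 0<δi neg-i st)
              (subst (H <_) (sym (trans (cong (_+ + fuel) (trans (sum-axpy x (unit i) 1ℤ)
              (cong (λ u → ht x + 1ℤ * u) (ht-unit i))))
            (ℤ.+-assoc (ht x) 1ℤ (+ fuel)))) H<)
          go (no none) = x , State.supported st , λ i 0<δi → ℤ.≮⇒≥ λ neg-i → none (i , 0<δi , neg-i)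

        stabilized : ∃[ y ] (Supported S y × Stable y)
        stabilized = stabilize (suc ℤ.∣ H ∣) {0ᵛ} (record
          { pos = λ _ → ℤ.≤-refl
          ; supported = λ _ _ → refl
          ; energy≤0 = ℤ.≤-reflexive (cong₂ (λ f d → f + + 2 * d) (zero-norm {0ᵛ} λ _ → refl)
              (sum-zero {n} λ i → ℤ.*-zeroʳ (p i))) })
          (subst (H <_) (sym (trans (cong (_+ + suc ℤ.∣ H ∣) (sum-zero {n} λ _ → refl)) (ℤ.+-identityˡ (+ suc ℤ.∣ H ∣))))
              (ℤ.suc[i]≤j⇒i<j (ℤ.+-monoʳ-≤ 1ℤ (i≤+∣i∣ H))))

      stable : ∃[ y ] (Supported S y × (∀ i → 0ℤ < δ i → 0ℤ ≤ p i + pair y i))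
      stable = go (Masked.definite B B-sym S p p-supported definite-with-p)
        where
        go : ∃[ C ] (0ℤ ≤ C × (∀ {x} → Supported S x → ∀ i → x i * x i ≤ C * (form x x + dot p x * dot p x))) →
             ∃[ y ] (Supported S y × (∀ i → 0ℤ < δ i → 0ℤ ≤ p i + pair y i))
        go (C , C≥0 , bound) = Firing.stabilized C C≥0 (λ {x} → bound {x})

    -- Let g be the least positive value at δ of an integral functional. A stable functional p with p(δ) = g is
    -- nonzero at some i with δ_i = g, and g divides δ, so that g = 1 by minimality of δ.
    module SpecialNode (no-special : ∀ k → δ k ≡ 1ℤ → ⊥) where

      module Minimal {p : Vector n} (p-supported : Supported S p) (0<g : 0ℤ < dot p δ)
        (minimal : ∀ {q} → Supported S q → 0ℤ < dot q δ → dot q δ < dot p δ → ⊥) where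
        g : ℤ
        g = dot p δ

        -- The remainder of δ_j modulo g is the value at δ of an integral functional, the j-th
        -- coordinate minus a multiple of the i-th; by minimality of g it is zero. So δ = g ε, and
        -- an ε lower than δ has positive norm although B(δ, δ) = g² B(ε, ε) = 0. Hence g = 1 and
        -- δ_i = 1.
        contradictory-at : ∀ i → δ i ≡ g → ⊥
        contradictory-at i δi≡g = multiple (λ j → decompose j (S j) refl)
          where
          instance
            g-nonZero : ℤ.NonZero g
            g-nonZero = ℤ.≢-nonZero λ g≡0 → ℤ.<-irrefl (sym g≡0) 0<g
          quotient remainder : Fin n → ℤ
          quotient j = δ j DivMod./ g
          remainder j = + (δ j DivMod.% g)
          i-supported : Supported S (unit i)
          i-supported k e with i Fin.≟ k
          ... | yes refl = contradiction (trans (sym δi≡g) (S-false e)) (λ g≡0 → ℤ.<-irrefl (sym g≡0) 0<g)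
          ... | no _ = refl
          remainder≡0 : ∀ j → S j ≡ true → remainder j ≡ 0ℤ
          remainder≡0 j e = ℤ.≤-antisym (ℤ.≮⇒≥ λ 0<r → minimal {axpy (unit j) (- quotient j) (unit i)}
                (axpy-supported {S} {unit j} {unit i} (- quotient j) (unit-supported {S} e) i-supported)
                (subst (0ℤ <_) (sym value) 0<r)
                (subst (_< g) (sym value) (subst (remainder j <_) (ℤ.0≤i⇒+∣i∣≡i (ℤ.<⇒≤ 0<g)) (+<+ (DivMod.n%d<d (δ j) g)))))
              (+≤+ z≤n)
            where
            dot-unit : ∀ k → dot (unit k) δ ≡ δ k
            dot-unit k = trans (sum-cong-≗ λ l → trans (ℤ.*-comm (unit k l) (δ l)) refl) (sum-unit δ k)
            value : dot (axpy (unit j) (- quotient j) (unit i)) δ ≡ remainder j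
            value = trans (sum-cong-≗ λ k → distribute (unit j k) (- quotient j) (unit i k) (δ k))
                (trans (sum-axpy (λ k → unit j k * δ k) (λ k → unit i k * δ k) (- quotient j))
              (trans (cong₂ (λ a b → a + - quotient j * b) (trans (dot-unit j) (DivMod.a≡a%n+[a/n]*n (δ j) g))
                  (trans (dot-unit i) δi≡g)) (cancel (remainder j) (quotient j) g)))
              where
              distribute : ∀ u c v d → (u + c * v) * d ≡ u * d + c * (v * d)
              distribute = solve-∀
              cancel : ∀ r q g → r + q * g + - q * g ≡ r
              cancel = solve-∀
          decompose : ∀ j b → S j ≡ b → ∃[ e ] (δ j ≡ g * e)
          decompose j false e = 0ℤ , trans (S-false e) (sym (ℤ.*-zeroʳ g))
          decompose j true e = quotient j , trans (DivMod.a≡a%n+[a/n]*n (δ j) g)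
            (trans (cong (_+ quotient j * g) (remainder≡0 j e)) (trans (ℤ.+-identityˡ _) (ℤ.*-comm (quotient j) g)))
          multiple : (∀ j → ∃[ e ] (δ j ≡ g * e)) → ⊥
          multiple h = go (1ℤ ℤ.<? g)
            where
            ε′ : Vector n
            ε′ j = proj₁ (h j)
            δ≗ : δ ≗ (λ j → g * ε′ j)
            δ≗ j = proj₂ (h j)
            ε-pos : Pos ε′
            ε-pos j = cancel-positive 0<g (subst (0ℤ ≤_) (δ≗ j) (δ-pos j))
            ε≢0 : ¬ ε′ ≗ 0ᵛ
            ε≢0 e = δ≢0 λ j → trans (δ≗ j) (trans (cong (_*_ g) (e j)) (ℤ.*-zeroʳ g))
            norm : form δ δ ≡ g * g * form ε′ ε′
            norm = trans (form-cong δ≗ δ≗) (quad-scale B g ε′)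
            ht-δ : ht δ ≡ g * ht ε′
            ht-δ = trans (sum-cong-≗ δ≗) (sym (*-distribˡ-sum g ε′))
            go : Dec (1ℤ < g) → ⊥
            go (yes 1<g) = ℤ.<-irrefl (trans (sym isotropic) norm)
                (positive-* {g * g} (positive-* {g} {g} 0<g 0<g) (smaller {ε′} ε-pos ε≢0 ht-smaller))
              where
              rearrange : ∀ g h → (g - + 2) * h + (h - 1ℤ) ≡ g * h - (1ℤ + h)
              rearrange = solve-∀
              ht-smaller : ht ε′ < ht δ
              ht-smaller = ℤ.suc[i]≤j⇒i<j (≤-from (trans (cong (_- (1ℤ + ht ε′)) ht-δ) (sym (rearrange g (ht ε′))))
                (ℤ.+-mono-≤ (nonneg-* {g - + 2} {ht ε′} (sub-nonneg (ℤ.i<j⇒suc[i]≤j 1<g)) (ℤ.<⇒≤ (Pos-ht ε-pos ε≢0)))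
                    (sub-nonneg (0<⇒1≤ (Pos-ht ε-pos ε≢0)))))
            go (no g≤1) = no-special i (trans δi≡g (ℤ.≤-antisym (ℤ.≮⇒≥ g≤1) (0<⇒1≤ 0<g)))

        contradictory : ⊥
        contradictory = from-stable (ChipFiring.stable p p-supported 0<g)
          where
          from-stable : ∃[ y ] (Supported S y × (∀ i → 0ℤ < δ i → 0ℤ ≤ p i + pair y i)) → ⊥
          from-stable (y , y-supported , stable) = find (Fin.any? λ i → (0ℤ ℤ.<? δ i) ×-dec (0ℤ ℤ.<? q i))
            where
            q : Vector n
            q i = p i + pair y i
            -- Adding ⟨y , _⟩ to p does not change its value at δ, since δ is orthogonal to its
            -- support.
            total : sum (λ i → δ i * q i) ≡ g
            total = trans (sum-cong-≗ λ i → distribute (δ i) (p i) (pair y i))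
                (trans (sum-axpy (λ i → p i * δ i) (λ i → δ i * pair y i) 1ℤ)
              (trans (cong (λ f → g + 1ℤ * f) (trans (form-sym δ y) (radical {y} y-supported))) (ℤ.+-identityʳ g)))
              where
              distribute : ∀ d p c → d * (p + c) ≡ p * d + 1ℤ * (d * c)
              distribute = solve-∀
            term-nonneg : ∀ i → 0ℤ ≤ δ i * q i
            term-nonneg i = go (0ℤ ℤ.<? δ i)
              where
              go : Dec (0ℤ < δ i) → 0ℤ ≤ δ i * q i
              go (yes 0<δi) = nonneg-* {δ i} {q i} (δ-pos i) (stable i 0<δi)
              go (no δi≯0) = ℤ.≤-reflexive (sym (trans (cong (_* q i) (ℤ.≤-antisym (ℤ.≮⇒≥ δi≯0) (δ-pos i)))
                  (ℤ.*-zeroˡ (q i))))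
            find : Dec (∃[ i ] (0ℤ < δ i × 0ℤ < q i)) → ⊥
            find (no none) = ℤ.<-irrefl (sym (trans (sym total)
                (sum-zero λ i → ℤ.≤-antisym (ℤ.≮⇒≥ λ 0<t → none (i , positive-factor i 0<t)) (term-nonneg i)))) 0<g
              where
              positive-factor : ∀ i → 0ℤ < δ i * q i → 0ℤ < δ i × 0ℤ < q i
              positive-factor i 0<t = 0<δi , cancel-strict 0<δi 0<t
                where
                0<δi : 0ℤ < δ i
                0<δi = ℤ.≤∧≢⇒< (δ-pos i) λ e → ℤ.<-irrefl refl
                    (subst (0ℤ <_) (trans (cong (_* q i) (sym e)) (ℤ.*-zeroˡ (q i))) 0<t)
            -- δ_i ≤ δ_i q_i ≤ g, while δ_i is itself the positive value of a coordinate functional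
            -- and hence at least g.
            find (yes (i , 0<δi , 0<qi)) = contradictory-at i (ℤ.≤-antisym δi≤g (ℤ.≮⇒≥ λ δi<g → minimal {unit i}
                (λ k e → unit-off k e (i Fin.≟ k)) (subst (0ℤ <_) (sym dot-unit) 0<δi) (subst (_< g) (sym dot-unit) δi<g)))
              where
              dot-unit : dot (unit i) δ ≡ δ i
              dot-unit = trans (sum-cong-≗ λ l → trans (ℤ.*-comm (unit i l) (δ l)) refl) (sum-unit δ i)
              unit-off : ∀ k → S k ≡ false → Dec (i ≡ k) → unit i k ≡ 0ℤ
              unit-off k e (yes refl) = contradiction (subst (0ℤ <_) (S-false e) 0<δi) (ℤ.<-irrefl refl)
              unit-off k e (no i≢k) = unit-other i≢k
              δi≤g : δ i ≤ g
              δi≤g = ℤ.≤-trans (≤-from (factor (δ i) (q i)) (nonneg-* {δ i} {q i - 1ℤ} (δ-pos i) (sub-nonneg (0<⇒1≤ 0<qi))))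
                (subst (δ i * q i ≤_) total (≤-sum (λ i → δ i * q i) term-nonneg i))
                where
                factor : ∀ d q → d * q - d ≡ d * (q - 1ℤ)
                factor = solve-∀

      -- Descent on the value p(δ) replaces the choice of a functional with the least positive one.
      -- It starts from δ as a functional, with value Σ δ_i².
      search : ∀ G {p} → Supported S p → 0ℤ < dot p δ → dot p δ ≤ + G → ⊥
      search zero sup 0<g g≤0 = contradiction (ℤ.<-≤-trans 0<g g≤0) (ℤ.<-irrefl refl)
      search (suc G) sup 0<g g≤G = Minimal.contradictory sup 0<g λ {q} q-sup 0<q q<g →
        search G q-sup 0<q (ℤ.0≤i-j⇒j≤i (subst (0ℤ ≤_) (cancel (+ G) (dot q δ))
            (sub-nonneg (ℤ.≤-trans (ℤ.i<j⇒suc[i]≤j q<g) g≤G))))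
        where
        cancel : ∀ a b → 1ℤ + a - (1ℤ + b) ≡ a - b
        cancel = solve-∀

      contradictory : ⊥
      contradictory = search ℤ.∣ dot δ δ ∣ {δ} δ-supported (square-sum) (i≤+∣i∣ (dot δ δ))
        where
        square-sum : 0ℤ < dot δ δ
        square-sum = ℤ.<-≤-trans (positive-* (proj₂ some-node) (proj₂ some-node))
            (≤-sum (λ i → δ i * δ i) (λ i → square-nonneg (δ i)) (proj₁ some-node))

-- The generalized lifting property forces finiteness

module Infinite {n : ℕ} (M : CoxeterMatrix n) (simply-laced : Coxeter.SimplyLaced M)
  (glp : Coxeter.AllIntervalsGLP M) where
  open Cartan M simply-laced

  -- No minimal vector has to be chosen: the induction hypothesis for lower heights is the
  -- minimality of δ that the construction of the bad interval asks for.
  no-degenerate : ∀ h {δ} → Pos δ → ¬ δ ≗ 0ᵛ → ht δ ≤ + h → ¬ form δ δ ≤ 0ℤ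
  no-degenerate zero p δ≢0 δ≤0 _ = contradiction (ℤ.<-≤-trans (Pos-ht p δ≢0) δ≤0) (ℤ.<-irrefl refl)
  no-degenerate (suc h) {δ} p δ≢0 δ≤h degenerate = Degenerate.SpecialNode.contradictory M simply-laced δ p δ≢0 degenerate smaller no-special
    where
    cancel : ∀ a b → 1ℤ + a - (1ℤ + b) ≡ a - b
    cancel = solve-∀
    smaller : ∀ {y} → Pos y → ¬ y ≗ 0ᵛ → ht y < ht δ → 0ℤ < form y y
    smaller {y} q y≢0 y<δ = ℤ.≰⇒> (no-degenerate h q y≢0
      (ℤ.0≤i-j⇒j≤i (subst (0ℤ ≤_) (cancel (+ h) (ht y)) (sub-nonneg (ℤ.≤-trans (ℤ.i<j⇒suc[i]≤j y<δ) δ≤h)))))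
    open MinimalDegenerate δ p δ≢0 degenerate smaller
    no-special : ∀ k → δ k ≡ 1ℤ → ⊥
    no-special k δk≡1 = BadInterval.bad-interval M simply-laced D k k∉D definite θ θ-pos θ-supported θ-norm θ-k orthogonal glp
      where
      0<δk : 0ℤ < δ k
      0<δk = subst (0ℤ <_) (sym δk≡1) (+<+ (s≤s z≤n))
      D : Fin n → Bool
      D i = S i ∧ not (does (k Fin.≟ i))
      k∉D : D k ≡ false
      k∉D = trans (cong (λ b → S k ∧ not b) (dec-true (k Fin.≟ k) refl)) (Bool.∧-zeroʳ (S k))
      D-false : ∀ {i} → S i ≡ false → D i ≡ false
      D-false {i} e = cong (_∧ not (does (k Fin.≟ i))) e
      D⊆S : ∀ {x} → Supported D x → Supported S x
      D⊆S h i e = h i (D-false e)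
      definite : DefiniteOn D
      definite {x} h x≢0 = Degenerate.positive-at M simply-laced δ p δ≢0 degenerate smaller k 0<δk {x} (D⊆S {x} h)
          (h k k∉D) x≢0
      θ : Vector n
      θ = axpy δ -1ℤ (unit k)
      θ-pos : Pos θ
      θ-pos = remove-Pos k p 0<δk
      θ-supported : Supported D θ
      θ-supported i e = go (k Fin.≟ i)
        where
        go : Dec (k ≡ i) → θ i ≡ 0ℤ
        go (yes refl) = cong₂ (λ a b → a + -1ℤ * b) δk≡1 (unit-same k)
        go (no k≢i) = cong₂ (λ a b → a + -1ℤ * b) (S-false
            (trans (sym (Bool.∧-identityʳ (S i))) (trans (cong (λ b → S i ∧ not b) (sym (dec-false (k Fin.≟ i) k≢i))) e)))
            (unit-other k≢i)
      pair-δk : pair δ k ≡ 0ℤ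
      pair-δk = null k 0<δk
      θ-norm : form θ θ ≡ + 2
      θ-norm = trans (form-cancel δ k) (cong₂ (λ f c → f - + 2 * c + + 2) isotropic pair-δk)
      θ-k : pair θ k ≡ - (+ 2)
      θ-k = trans (pair-axpy δ -1ℤ (unit k) k) (cong₂ (λ c b → c + -1ℤ * b) pair-δk (trans (pair-unit k k) (B-diag k)))
      orthogonal : ∀ {γ} → Supported D γ → pair γ k ≡ - form γ θ
      orthogonal {γ} h = sym (trans (cong -_ (trans (form-axpyʳ γ δ -1ℤ (unit k))
          (cong₂ (λ f c → f + -1ℤ * c) (radical {γ} (D⊆S {γ} h)) (form-unitʳ γ k)))) (simplify (pair γ k)))
        where
        simplify : ∀ c → - (0ℤ + -1ℤ * c) ≡ c
        simplify = solve-∀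

  GLP⇒finite : FiniteW
  GLP⇒finite = [ (λ (x , x≢0 , x≤0) → ⊥-elim (no-degenerate ℤ.∣ ht ∣ x ∣ᵛ ∣ {∣ x ∣ᵛ} (λ _ → +≤+ z≤n) (abs-≢0 x≢0)
      (i≤+∣i∣ (ht ∣ x ∣ᵛ)) (ℤ.≤-trans (form-abs x) x≤0))) , id ]′
    finite-or-degenerate

theorem6p9 : (n : ℕ) (M : CoxeterMatrix n) →
    Coxeter.AllIntervalsGLP M ⇔ (Coxeter.FiniteW M × Coxeter.SimplyLaced M)
theorem6p9 n M = mk⇔
  (λ glp → Infinite.GLP⇒finite M (Order.GLP⇒SimplyLaced M glp) glp , Order.GLP⇒SimplyLaced M glp)
  (λ (finite , simply-laced) → FiniteGLP.finite⇒GLP M simply-laced finite)
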